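{- For every integer $n$ with $1 \le n \le 3$ we have $\mathcal{MBV}_{n,n} = \mathcal{GSV}_n$, and for every integer $n \geq 4$ we have $\mathcal{MBV}_{n,n} \subsetneq \mathcal{GSV}_n$.
   Context: Let $[n]=\{1,\dots,n\}$. A valuation with ground set $E \subseteq [n]$ is a function $u: 2^E \to \mathbb{R}_{\geq 0}$ with $u(\emptyset)=0$ and $u(S)\le u(T)$ whenever $S \subseteq T$; two valuations are equal only if they have the same ground set and agree everywhere. For $p \in \mathbb{R}^E$ let $D(u,p)=\arg\max_{S \subseteq E}\big(u(S)-\sum_{i\in S}p_i\big)$. The valuation $u$ is gross substitutes if for all $p,q \in \mathbb{R}^E$ with $p \le q$ coordinatewise and every $S \in D(u,p)$ there is $T \in D(u,q)$ with $\{i \in S: p_i=q_i\}\subseteq T$. $\mathcal{GSV}_n$ is the set of gross substitutes valuations whose ground set is some subset of $[n]$. Merging: for valuations $u^1$ on $E^1$ and $u^2$ on $E^2$, $u^1 \ast u^2$ is the valuation on $E^1\cup E^2$ given by $(u^1\ast u^2)(S)=\max\{u^1(T)+u^2(S\setminus T): T \subseteq S\cap E^1,\ S\setminus T \subseteq E^2\}$. Endowment: for a valuation $u$ on $E$ and $T\subseteq E$, $\partial^T u$ is the valuation on $E\setminus T$ given by $\partial^T u(S)=u(S\cup T)-u(T)$. For a matroid on ground set $E$ with independent sets $\mathcal{I}$ and weights $w\in\mathbb{R}^E_{\ge 0}$, its weighted rank is $\rho^w(T)=\max\{\sum_{i\in I}w_i: I\in\mathcal{I}, I\subseteq T\}$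 for $T \subseteq E$. $\mathcal{MBV}_{n,n}$ is the smallest subset of $\mathcal{GSV}_n$ that contains the weighted ranks (for all nonnegative weights) of all matroids whose ground set is a subset of $[n]$ and that is closed under merging and endowment. -}

module Defs where

open import Level using (0ℓ)
open import Data.Nat using (ℕ; zero; suc; _<_)
open import Data.Bool using (Bool; true; false)
open import Data.Vec using (Vec; []; _∷_)
open import Data.Fin using (Fin) renaming (zero to fzero; suc to fsuc)
open import Data.Fin.Subset using (Subset; _∈_; _⊆_; _∪_; _∩_; _─_; ⊥; ⁅_⁆; ∣_∣)
open import Data.Product using (Σ; ∃; _×_; _,_)
open import Relation.Binary.PropositionalEquality using (_≡_; _≢_)
open import Relation.Nullary using (¬_)
open import Algebra.Structures using (IsCommutativeRing)
open import Relation.Binary.Structures using (IsTotalOrder)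

-- The real numbers, axiomatised as a Dedekind-complete ordered field
-- (unique up to isomorphism, classically).  The theorem is stated for
-- every such structure.

record CompleteOrderedField : Set₁ where
  infixl 6 _+_
  infixl 7 _*_
  infix  4 _≤_
  field
    Carrier : Set
    _+_ _*_ : Carrier → Carrier → Carrier
    -_      : Carrier → Carrier
    0# 1#   : Carrier
    _≤_     : Carrier → Carrier → Set
    isCommutativeRing : IsCommutativeRing _≡_ _+_ _*_ -_ 0# 1#
    0≢1     : 0# ≢ 1#
    inverse : ∀ x → x ≢ 0# → ∃ λ y → x * y ≡ 1#
    isTotalOrder : IsTotalOrder _≡_ _≤_
    +-mono  : ∀ x y z → x ≤ y → x + z ≤ y + z
    *-pos   : ∀ x y → 0# ≤ x → 0# ≤ y → 0# ≤ x * y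
    complete : (P : Carrier → Set) → ∃ P →
               (∃ λ b → ∀ x → P x → x ≤ b) →
               ∃ λ s → (∀ x → P x → x ≤ s) ×
                       (∀ b → (∀ x → P x → x ≤ b) → s ≤ b)

module Valuations (ℝ : CompleteOrderedField) where
  open CompleteOrderedField ℝ renaming (Carrier to R)

  _-ᴿ_ : R → R → R
  x -ᴿ y = x + (- y)

  sumOver : ∀ {n} → Subset n → (Fin n → R) → R
  sumOver {zero}  []            p = 0#
  sumOver {suc n} (true  ∷ S)   p = p fzero + sumOver S (λ i → p (fsuc i))
  sumOver {suc n} (false ∷ S)   p = sumOver S (λ i → p (fsuc i))

  -- A valuation with ground set E ⊆ [n].  Values of `val` on sets that
  -- are not subsets of `ground` are irrelevant junk.
  record Valuation (n : ℕ) : Set where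
    field
      ground   : Subset n
      val      : Subset n → R
      val-∅    : val ⊥ ≡ 0#
      val-nonneg : ∀ S → S ⊆ ground → 0# ≤ val S
      val-mono : ∀ S T → S ⊆ T → T ⊆ ground → val S ≤ val T
  open Valuation public

  _≈ᵥ_ : ∀ {n} → Valuation n → Valuation n → Set
  u ≈ᵥ v = (ground u ≡ ground v) × (∀ S → S ⊆ ground u → val u S ≡ val v S)

  Demand : ∀ {n} → Valuation n → (Fin n → R) → Subset n → Set
  Demand u p S = S ⊆ ground u ×
    (∀ T → T ⊆ ground u → val u T -ᴿ sumOver T p ≤ val u S -ᴿ sumOver S p)

  -- gross substitutes (prices only matter on the ground set)
  IsGS : ∀ {n} → Valuation n → Set
  IsGS {n} u = ∀ (p q : Fin n → R) → (∀ i → i ∈ ground u → p i ≤ q i) →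
    ∀ S → Demand u p S →
    ∃ λ T → Demand u q T × (∀ i → i ∈ S → p i ≡ q i → i ∈ T)

  GSV : ∀ n → Valuation n → Set
  GSV n u = IsGS u

  IsMaxOf : {A : Set} → (A → Set) → (A → R) → R → Set
  IsMaxOf P f x = (∃ λ a → P a × f a ≡ x) × (∀ a → P a → f a ≤ x)

  record Matroid (n : ℕ) : Set₁ where
    field
      E       : Subset n
      Indep   : Subset n → Set
      indep⊆E : ∀ I → Indep I → I ⊆ E
      indep-∅ : Indep ⊥
      indep-down : ∀ I J → J ⊆ I → Indep I → Indep J
      exchange : ∀ I J → Indep I → Indep J →
                 ∣ I ∣ < ∣ J ∣ → ∃ λ j → j ∈ J × ¬ (j ∈ I) × Indep (I ∪ ⁅ j ⁆)
  
  IsWeightedRank : ∀ {n} → Matroid n → (Fin n → R) → Valuation n → Set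
  IsWeightedRank M w u = ground u ≡ Matroid.E M ×
    (∀ T → T ⊆ Matroid.E M →
       IsMaxOf (λ I → Matroid.Indep M I × I ⊆ T) (λ I → sumOver I w) (val u T))

  IsMerge : ∀ {n} → Valuation n → Valuation n → Valuation n → Set
  IsMerge u₁ u₂ w = ground w ≡ (ground u₁ ∪ ground u₂) ×
    (∀ S → S ⊆ ground w →
       IsMaxOf (λ T → T ⊆ (S ∩ ground u₁) × (S ─ T) ⊆ ground u₂)
               (λ T → val u₁ T + val u₂ (S ─ T)) (val w S))

  IsEndow : ∀ {n} → Valuation n → Subset n → Valuation n → Set
  IsEndow u T w = ground w ≡ (ground u ─ T) ×
    (∀ S → S ⊆ ground w → val w S ≡ val u (S ∪ T) -ᴿ val u T)

  data MBVgen (n : ℕ) : Valuation n → Set₁ where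
    rank  : ∀ (M : Matroid n) (w : Fin n → R) →
            (∀ i → i ∈ Matroid.E M → 0# ≤ w i) →
            ∀ u → IsWeightedRank M w u → MBVgen n u
    merge : ∀ u₁ u₂ w → MBVgen n u₁ → MBVgen n u₂ → IsMerge u₁ u₂ w → MBVgen n w
    endow : ∀ u T w → MBVgen n u → T ⊆ ground u → IsEndow u T w → MBVgen n w

{-# OPTIONS --safe #-}

-- Weighted ranks satisfy the M♮-concave exchange property, which implies gross substitutability;
-- endowment amounts to making some items free.  A merge is obtained from the disjoint sum of two
-- valuations by identifying the two copies of each item, one item at a time: an optimal bundle
-- for the identified item is an optimal bundle for both copies at a common, possibly higher, price.
--
-- On at most three items, local exchange inequalities show that a gross substitutes valuation is
-- the value of an optimal assignment of items to three unit-demand agents, i.e. a merge of three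
-- weighted ranks of rank-one matroids.
--
-- On n ≥ 4 items split into two classes of size at least two, let a nonempty set be worth 5 if it
-- meets both classes, and otherwise 3 or 4 according to whether it is a singleton.  This is a gross
-- substitutes valuation; whenever it is a merge, it is one of the two merged valuations; it is not
-- a weighted rank; and an endowment on all of [n] is trivial.

module Submission where

open import Defs
open import Algebra.Bundles using (CommutativeMonoid; CommutativeRing)
import Algebra.Properties.Ring as RingProperties
import Algebra.Solver.CommutativeMonoid.Normal as CMNormal
open import Algebra.Structures using (IsCommutativeRing)
open import Data.Bool using (Bool; true; false; if_then_else_)
open import Data.Empty using (⊥-elim) renaming (⊥ to False)
open import Data.Fin using (Fin; toℕ; fromℕ<) renaming (zero to fzero; suc to fsuc)
import Data.Fin.Properties as Finₚ
open import Data.Fin.Subset using (Subset; inside; outside; _∈_; _∉_; _⊆_; _∪_; _∩_; _─_; ⊥; ⊤; ⁅_⁆; ∁; ∣_∣)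
open import Data.Fin.Subset.Properties
open import Data.List using (List; []; _∷_)
open import Data.Nat as ℕ using (ℕ; zero; suc)
import Data.Nat.Properties as ℕₚ
open import Data.Nat.Tactic.RingSolver using (solve-∀)
open import Data.Product using (∃; _×_; _,_; proj₁; proj₂)
open import Data.Sum using (_⊎_; inj₁; inj₂; [_,_]′)
open import Data.Unit using (tt) renaming (⊤ to Unit)
open import Data.Vec using (Vec; []; _∷_; here; there; head; tail; lookup; allFin; _[_]≔_) renaming (map to mapᵥ)
import Data.Vec.Functional as F
open import Data.Vec.N-ary using (N-ary; _$ⁿ_)
open import Data.Vec.Properties using ([]=⇒lookup; lookup⇒[]=)
open import Function using (_∘_)
open import Function.Bundles using (_⇔_; mk⇔)
open import Relation.Binary.PropositionalEquality
open import Relation.Binary.Structures using (IsTotalOrder)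
open import Relation.Nullary using (¬_; Dec; yes; no; does; contradiction; ¬?; _×-dec_; _→-dec_; map′; decidable-stable)

-- Why items are identified one at a time: once the rest of the market is optimised away, a pair of
-- copies of one item leaves only four numbers, the best utilities given which of the two copies is
-- held. Gross substitutability makes these submodular, and demand with one copy and with two is
-- compared through them. The rest of the market must be arbitrary for this, hence the abstract
-- markets. The values 3, 4 and 5 satisfy 3 + 3 > 5, so two items cannot have their full single
-- worth in different summands; 4 - 3 = 1, which leaves the other summand at most 1 on each item; 3
-- + 1 < 5, so the pairs worth 5 need a single summand; and 4 is neither 3 nor 3 + 3, which rules
-- out weighted ranks. Every item needs a partner in its own class and a pair across the classes
-- that avoids it, hence two items per class and `n ≥ 4`. The argument is constructive. Totality of
-- the order decides equality and order of reals, but independence in a matroid is an arbitrary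
-- predicate, so its decidability is available only under a double negation, which is removed
-- because the conclusion about demand is decidable.

-- Finite subsets: inserting, deleting and recombining items.

module Subsets where

  infixl 6 _⊞_ _⊟_
  -- Vector updates rather than unions with singletons, so that membership, cardinality and price
  -- sums follow by recursion on the vector.
  _⊞_ _⊟_ : ∀ {n} → Subset n → Fin n → Subset n
  S ⊞ i = S [ i ]≔ inside
  S ⊟ i = S [ i ]≔ outside

  i∈S⊞i : ∀ {n} {S : Subset n} i → i ∈ S ⊞ i
  i∈S⊞i {S = _ ∷ _} fzero    = here
  i∈S⊞i {S = _ ∷ _} (fsuc i) = there (i∈S⊞i i)

  ∈-⊞⁺ : ∀ {n} {S : Subset n} i {k} → k ∈ S → k ∈ S ⊞ i
  ∈-⊞⁺ fzero    here        = here
  ∈-⊞⁺ fzero    (there k∈S) = there k∈S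
  ∈-⊞⁺ (fsuc i) here        = here
  ∈-⊞⁺ (fsuc i) (there k∈S) = there (∈-⊞⁺ i k∈S)

  ∈-⊞⁻ : ∀ {n} {S : Subset n} i {k} → k ∈ S ⊞ i → k ≡ i ⊎ k ∈ S
  ∈-⊞⁻ {S = _ ∷ _} fzero    here      = inj₁ refl
  ∈-⊞⁻ {S = _ ∷ _} fzero    (there k) = inj₂ (there k)
  ∈-⊞⁻ {S = _ ∷ _} (fsuc i) here      = inj₂ here
  ∈-⊞⁻ {S = _ ∷ _} (fsuc i) (there k) with ∈-⊞⁻ i k
  ... | inj₁ refl = inj₁ refl
  ... | inj₂ k∈S  = inj₂ (there k∈S)

  ∈-⊟⁺ : ∀ {n} {S : Subset n} i {k} → k ∈ S → k ≢ i → k ∈ S ⊟ i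
  ∈-⊟⁺ fzero    here        k≢i = contradiction refl k≢i
  ∈-⊟⁺ fzero    (there k∈S) k≢i = there k∈S
  ∈-⊟⁺ (fsuc i) here        k≢i = here
  ∈-⊟⁺ (fsuc i) (there k∈S) k≢i = there (∈-⊟⁺ i k∈S λ { refl → k≢i refl })

  ∈-⊟⁻ : ∀ {n} {S : Subset n} i {k} → k ∈ S ⊟ i → k ∈ S × k ≢ i
  ∈-⊟⁻ {S = _ ∷ _} fzero    (there k) = there k , λ ()
  ∈-⊟⁻ {S = _ ∷ _} (fsuc i) here      = here , λ ()
  ∈-⊟⁻ {S = _ ∷ _} (fsuc i) (there k) with ∈-⊟⁻ i k
  ... | k∈S , k≢i = there k∈S , λ { refl → k≢i refl }

  ⊞-⊆ : ∀ {n} {S T : Subset n} i → S ⊆ T → i ∈ T → S ⊞ i ⊆ T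
  ⊞-⊆ i S⊆T i∈T k∈ with ∈-⊞⁻ i k∈
  ... | inj₁ refl = i∈T
  ... | inj₂ k∈S  = S⊆T k∈S

  ∉⊥⊞ : ∀ {n} {i j : Fin n} → i ≢ j → j ∉ ⊥ ⊞ i
  ∉⊥⊞ {i = i} i≢j j∈ = [ (λ j≡i → i≢j (sym j≡i)) , ∉⊥ ]′ (∈-⊞⁻ i j∈)

  ⊥⊞-disjoint : ∀ {n} {i j k : Fin n} → i ≢ j → k ∈ ⊥ ⊞ i → k ∉ ⊥ ⊞ j
  ⊥⊞-disjoint {i = i} i≢j k∈i k∈j =
    [ (λ { refl → ∉⊥⊞ (λ j≡i → i≢j (sym j≡i)) k∈j }) , ∉⊥ ]′ (∈-⊞⁻ i k∈i)

  ⊆-⊞⁻ : ∀ {n} {S T : Subset n} j → S ⊆ T ⊞ j → j ∉ S → S ⊆ T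
  ⊆-⊞⁻ j S⊆ j∉S k∈S with ∈-⊞⁻ j (S⊆ k∈S)
  ... | inj₁ refl = contradiction k∈S j∉S
  ... | inj₂ k∈T  = k∈T

  ⊆-⊞⊞⁻ : ∀ {n} {S T : Subset n} i j → S ⊆ T ⊞ i ⊞ j → i ∉ S → S ⊆ T ⊞ j
  ⊆-⊞⊞⁻ i j S⊆ i∉S k∈S with ∈-⊞⁻ j (S⊆ k∈S)
  ... | inj₁ refl = i∈S⊞i j
  ... | inj₂ k∈ with ∈-⊞⁻ i k∈
  ... | inj₁ refl = contradiction k∈S i∉S
  ... | inj₂ k∈T  = ∈-⊞⁺ j k∈T

  ∣⊞∣ : ∀ {n} {S : Subset n} i → i ∉ S → ∣ S ⊞ i ∣ ≡ suc ∣ S ∣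
  ∣⊞∣ {S = true ∷ S}  fzero    i∉S = contradiction here i∉S
  ∣⊞∣ {S = false ∷ S} fzero    i∉S = refl
  ∣⊞∣ {S = true ∷ S}  (fsuc i) i∉S = cong suc (∣⊞∣ i λ i∈S → i∉S (there i∈S))
  ∣⊞∣ {S = false ∷ S} (fsuc i) i∉S = ∣⊞∣ i λ i∈S → i∉S (there i∈S)

  ∣⊟∣ : ∀ {n} {S : Subset n} i → i ∈ S → suc ∣ S ⊟ i ∣ ≡ ∣ S ∣
  ∣⊟∣ {S = true ∷ S}  fzero    here        = refl
  ∣⊟∣ {S = true ∷ S}  (fsuc i) (there i∈S) = cong suc (∣⊟∣ i i∈S)
  ∣⊟∣ {S = false ∷ S} (fsuc i) (there i∈S) = ∣⊟∣ i i∈S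

  ⊞≡∪⁅⁆ : ∀ {n} (S : Subset n) i → S ⊞ i ≡ S ∪ ⁅ i ⁆
  ⊞≡∪⁅⁆ S i = ⊆-antisym (⊞-⊆ i (p⊆p∪q ⁅ i ⁆) (q⊆p∪q S ⁅ i ⁆ (x∈⁅x⁆ i))) back
    where
    back : S ∪ ⁅ i ⁆ ⊆ S ⊞ i
    back k∈ with x∈p∪q⁻ S ⁅ i ⁆ k∈
    ... | inj₁ k∈S = ∈-⊞⁺ i k∈S
    ... | inj₂ k∈i with x∈⁅y⁆⇒x≡y i k∈i
    ... | refl = i∈S⊞i i

  ∈-─⁻ : ∀ {n} (S T : Subset n) {k} → k ∈ S ─ T → k ∈ S × k ∉ T
  ∈-─⁻ (true ∷ S) (false ∷ T) here = here , λ ()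
  ∈-─⁻ (false ∷ S) (false ∷ T) {fzero} ()
  ∈-─⁻ (_ ∷ S) (true ∷ T) {fzero} ()
  ∈-─⁻ (_ ∷ S) (_ ∷ T) (there k∈) with ∈-─⁻ S T k∈
  ... | k∈S , k∉T = there k∈S , λ { (there k∈T) → k∉T k∈T }

  ∩-absorb : ∀ {n} {S T : Subset n} → S ⊆ T → S ∩ T ≡ S
  ∩-absorb {S = S} {T} S⊆T = ⊆-antisym (p∩q⊆p S T) (λ k∈S → x∈p∩q⁺ (k∈S , S⊆T k∈S))

  ∪-lub : ∀ {n} {S T U : Subset n} → S ⊆ U → T ⊆ U → S ∪ T ⊆ U
  ∪-lub {S = S} {T} S⊆U T⊆U k∈ with x∈p∪q⁻ S T k∈
  ... | inj₁ k∈S = S⊆U k∈S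
  ... | inj₂ k∈T = T⊆U k∈T

  ⊆-─-∪ : ∀ {n} (S T : Subset n) → S ⊆ (S ─ T) ∪ T
  ⊆-─-∪ S T {k} k∈S with k ∈? T
  ... | yes k∈T = x∈p∪q⁺ (inj₂ k∈T)
  ... | no  k∉T = x∈p∪q⁺ (inj₁ (x∈p∧x∉q⇒x∈p─q k∈S k∉T))

  ∪-─-cancel : ∀ {n} {S T : Subset n} → (∀ {k} → k ∈ S → k ∉ T) → (S ∪ T) ─ T ≡ S
  ∪-─-cancel {S = S} {T} disjoint = ⊆-antisym forth
      (λ k∈S → x∈p∧x∉q⇒x∈p─q (x∈p∪q⁺ (inj₁ k∈S)) (disjoint k∈S))
    where
    forth : (S ∪ T) ─ T ⊆ S
    forth k∈ with ∈-─⁻ (S ∪ T) T k∈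
    ... | k∈S∪T , k∉T with x∈p∪q⁻ S T k∈S∪T
    ... | inj₁ k∈S = k∈S
    ... | inj₂ k∈T = contradiction k∈T k∉T

  -- Serves to complete a bundle `T` chosen on the ground set `E` by a choice `S` among the
  -- remaining items.
  splice : ∀ {n} → Subset n → Subset n → Subset n → Subset n
  splice E T S = (T ∩ E) ∪ (S ─ E)

  splice-∩ : ∀ {n} (E T S : Subset n) → splice E T S ∩ E ≡ T ∩ E
  splice-∩ E T S = ⊆-antisym forth
      (λ k∈ → x∈p∩q⁺ (x∈p∪q⁺ (inj₁ k∈) , proj₂ (x∈p∩q⁻ T E k∈)))
    where
    forth : splice E T S ∩ E ⊆ T ∩ E
    forth k∈ with x∈p∩q⁻ (splice E T S) E k∈
    ... | k∈∪ , k∈E with x∈p∪q⁻ (T ∩ E) (S ─ E) k∈∪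
    ... | inj₁ k∈TE = k∈TE
    ... | inj₂ k∈SE = contradiction k∈E (proj₂ (∈-─⁻ S E k∈SE))

  splice-─ : ∀ {n} (E T S : Subset n) → splice E T S ─ E ≡ S ─ E
  splice-─ E T S = ⊆-antisym forth
      (λ k∈ → x∈p∧x∉q⇒x∈p─q (x∈p∪q⁺ (inj₂ k∈)) (proj₂ (∈-─⁻ S E k∈)))
    where
    forth : splice E T S ─ E ⊆ S ─ E
    forth k∈ with ∈-─⁻ (splice E T S) E k∈
    ... | k∈∪ , k∉E with x∈p∪q⁻ (T ∩ E) (S ─ E) k∈∪
    ... | inj₁ k∈TE = contradiction (proj₂ (x∈p∩q⁻ T E k∈TE)) k∉E
    ... | inj₂ k∈SE = k∈SE

-- Ordered-field arithmetic, with a small prover for linear inequalities.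

module OrderedField (ℝ : CompleteOrderedField) where
  open CompleteOrderedField ℝ renaming (Carrier to R)
  open IsCommutativeRing isCommutativeRing public
    using (+-comm; +-assoc; +-identityˡ; +-identityʳ; -‿inverseˡ; -‿inverseʳ)
  open IsTotalOrder isTotalOrder public using (antisym; total)
    renaming (refl to ≤-refl; trans to ≤-trans; reflexive to ≤-reflexive)

  private
    +-commutativeMonoid : CommutativeMonoid _ _
    +-commutativeMonoid = record
      { isCommutativeMonoid = IsCommutativeRing.+-isCommutativeMonoid isCommutativeRing }
    module S = CMNormal +-commutativeMonoid

    commutativeRing : CommutativeRing _ _
    commutativeRing = record { isCommutativeRing = isCommutativeRing }
    open RingProperties (CommutativeRing.ring commutativeRing)
      using (-‿distribˡ-*; -‿distribʳ-*; -‿involutive)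

  open S public using (_⊕_) renaming (Expr to Lin; id to 𝟘)

  -- If x ≡ y then `total x y` and `total y x` have the same tag;
  -- conversely, equal tags give x ≤ y and y ≤ x.
  infix 4 _≟_ _≤?_
  _≟_ : ∀ x y → Dec (x ≡ y)
  x ≟ y with total x y in eq₁ | total y x in eq₂
  ... | inj₁ x≤y | inj₁ y≤x = yes (antisym x≤y y≤x)
  ... | inj₂ y≤x | inj₂ x≤y = yes (antisym x≤y y≤x)
  ... | inj₁ _   | inj₂ _   = no λ { refl → contradiction (trans (sym eq₁) eq₂) λ () }
  ... | inj₂ _   | inj₁ _   = no λ { refl → contradiction (trans (sym eq₁) eq₂) λ () }

  _≤?_ : ∀ x y → Dec (x ≤ y)
  x ≤? y with total x y | x ≟ y
  ... | inj₁ x≤y | _        = yes x≤y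
  ... | inj₂ y≤x | yes refl = yes ≤-refl
  ... | inj₂ y≤x | no x≢y   = no λ x≤y → x≢y (antisym x≤y y≤x)

  ≰⇒≥ : ∀ {x y} → ¬ (x ≤ y) → y ≤ x
  ≰⇒≥ {x} {y} x≰y with total x y
  ... | inj₁ x≤y = contradiction x≤y x≰y
  ... | inj₂ y≤x = y≤x

  +-mono₂ : ∀ {a b c d} → a ≤ b → c ≤ d → a + c ≤ b + d
  +-mono₂ {a} {b} {c} {d} a≤b c≤d = ≤-trans (+-mono a b c a≤b)
    (subst₂ _≤_ (+-comm c b) (+-comm d b) (+-mono c d b c≤d))

  +-cancelʳ-≤ : ∀ {x y} z → x + z ≤ y + z → x ≤ y
  +-cancelʳ-≤ {x} {y} z le = subst₂ _≤_ (undo x) (undo y) (+-mono _ _ (- z) le)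
    where
    undo : ∀ w → (w + z) + (- z) ≡ w
    undo w = trans (+-assoc w z (- z)) (trans (cong (w +_) (-‿inverseʳ z)) (+-identityʳ w))

  infix 3 _≼_
  infix 2 _⊢_

  record LinIneq (k : ℕ) : Set where
    constructor _≼_
    field lhs rhs : Lin k

  record LinProblem (k : ℕ) : Set where
    constructor _⊢_
    field
      hyps : List (LinIneq k)
      goal : LinIneq k

  private
    Holds : ∀ {k} → Vec R k → LinIneq k → Set
    Holds ρ (l ≼ r) = S.⟦ l ⟧ ρ ≤ S.⟦ r ⟧ ρ

    -- Hypotheses are added crosswise, their right sides to the left of the goal, so that when the
    -- goal is exactly their sum both sides normalise to the same expression.
    addHyps : ∀ {k} → List (LinIneq k) → LinIneq k → LinIneq k
    addHyps []             g         = g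
    addHyps ((l ≼ r) ∷ hs) (gl ≼ gr) = addHyps hs ((gl ⊕ r) ≼ (gr ⊕ l))

    Implies : ∀ {k} → Vec R k → List (LinIneq k) → LinIneq k → Set
    Implies ρ []       g = Holds ρ g
    Implies ρ (h ∷ hs) g = Holds ρ h → Implies ρ hs g

    -- The terms contributed by one hypothesis can be cancelled only after the later hypotheses have
    -- been supplied; `weaken` therefore carries the cancellation `drop` under their arrows.
    implies : ∀ {k} (ρ : Vec R k) hs (g : LinIneq k) →
              Holds ρ (addHyps hs g) → Implies ρ hs g
    implies ρ []             g         p = p
    implies ρ ((l ≼ r) ∷ hs) (gl ≼ gr) p h = strip hs _ _ p
      where
      drop : ∀ {x y} → x + S.⟦ r ⟧ ρ ≤ y + S.⟦ l ⟧ ρ → x ≤ y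
      drop le = +-cancelʳ-≤ _ (≤-trans le (+-mono₂ ≤-refl h))

      strip : ∀ hs gl gr → Holds ρ (addHyps hs ((gl ⊕ r) ≼ (gr ⊕ l))) → Implies ρ hs (gl ≼ gr)
      strip hs gl gr p = weaken hs gl gr (implies ρ hs ((gl ⊕ r) ≼ (gr ⊕ l)) p)
        where
        weaken : ∀ hs gl gr → Implies ρ hs ((gl ⊕ r) ≼ (gr ⊕ l)) → Implies ρ hs (gl ≼ gr)
        weaken []        gl gr q = drop q
        weaken (h ∷ hs)  gl gr q = λ x → weaken hs gl gr (q x)

    variables : ∀ k → Vec (Lin k) k
    variables k = mapᵥ S.var (allFin k)

  rearrange : ∀ {k} (ρ : Vec R k) (f : N-ary k (Lin k) (Lin k × Lin k)) → let (l , r) = f $ⁿ variables k in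
              S.normalise l ≡ S.normalise r → S.⟦ l ⟧ ρ ≡ S.⟦ r ⟧ ρ
  rearrange {k} ρ f balanced = let (l , r) = f $ⁿ variables k in
    trans (sym (S.correct l ρ)) (trans (cong (λ v → S.⟦ v ⟧⇓ ρ) balanced) (S.correct r ρ))

  -- Linear arithmetic: the goal must be the sum of the hypotheses up to
  -- terms cancelled on both sides.
  linear : ∀ {k} (ρ : Vec R k) (f : N-ary k (Lin k) (LinProblem k)) → let (hs ⊢ g) = f $ⁿ variables k in
           S.normalise (LinIneq.lhs (addHyps hs g)) ≡ S.normalise (LinIneq.rhs (addHyps hs g)) → Implies ρ hs g
  linear {k} ρ f balanced = let (hs ⊢ g) = f $ⁿ variables k in implies ρ hs g (≤-reflexive
    (trans (sym (S.correct (LinIneq.lhs (addHyps hs g)) ρ))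
    (trans (cong (λ v → S.⟦ v ⟧⇓ ρ) balanced) (S.correct (LinIneq.rhs (addHyps hs g)) ρ))))

  infixl 6 _⊖_
  _⊖_ : R → R → R
  _⊖_ = Valuations._-ᴿ_ ℝ

  ⊖-+ : ∀ x y → (x ⊖ y) + y ≡ x
  ⊖-+ x y = trans (+-assoc x (- y) y) (trans (cong (x +_) (-‿inverseˡ y)) (+-identityʳ x))

  ⊖-≤⁺ : ∀ {a b c d} → a + d ≤ c + b → a ⊖ b ≤ c ⊖ d
  ⊖-≤⁺ {a} {b} {c} {d} = linear (a ∷ b ∷ c ∷ d ∷ (a ⊖ b) ∷ (c ⊖ d) ∷ [])
    (λ a b c d x y → (x ⊕ b ≼ a) ∷ (c ≼ y ⊕ d) ∷ (a ⊕ d ≼ c ⊕ b) ∷ [] ⊢ x ≼ y) refl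
    (≤-reflexive (⊖-+ a b)) (≤-reflexive (sym (⊖-+ c d)))

  ⊖-≤⁻ : ∀ {a b c d} → a ⊖ b ≤ c ⊖ d → a + d ≤ c + b
  ⊖-≤⁻ {a} {b} {c} {d} = linear (a ∷ b ∷ c ∷ d ∷ (a ⊖ b) ∷ (c ⊖ d) ∷ [])
    (λ a b c d x y → (a ≼ x ⊕ b) ∷ (y ⊕ d ≼ c) ∷ (x ≼ y) ∷ [] ⊢ a ⊕ d ≼ c ⊕ b) refl
    (≤-reflexive (sym (⊖-+ a b))) (≤-reflexive (⊖-+ c d))

  -- From 1 ≤ 0 follows 0 ≤ -1, so the square of -1, which is 1, is nonnegative, and antisymmetry
  -- gives 0 = 1.
  1≰0 : ¬ (1# ≤ 0#)
  1≰0 1≤0 = 0≢1 (antisym (subst (0# ≤_) square (*-pos _ _ 0≤-1 0≤-1)) 1≤0)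
    where
    open IsCommutativeRing isCommutativeRing using (*-identityˡ)
    0≤-1 : 0# ≤ - 1#
    0≤-1 = linear ((- 1#) ∷ 1# ∷ []) (λ n i → (i ≼ 𝟘) ∷ (𝟘 ≼ n ⊕ i) ∷ [] ⊢ 𝟘 ≼ n) refl
      1≤0 (≤-reflexive (sym (-‿inverseˡ 1#)))
    square : (- 1#) * (- 1#) ≡ 1#
    square = trans (sym (-‿distribˡ-* 1# (- 1#)))
      (trans (cong -_ (*-identityˡ (- 1#))) (-‿involutive 1#))

  infixl 6 _⊔_
  _⊔_ : R → R → R
  x ⊔ y with total x y
  ... | inj₁ _ = y
  ... | inj₂ _ = x

  ⊔-sel : ∀ x y → x ⊔ y ≡ x ⊎ x ⊔ y ≡ y
  ⊔-sel x y with total x y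
  ... | inj₁ _ = inj₂ refl
  ... | inj₂ _ = inj₁ refl

  x≤x⊔y : ∀ x y → x ≤ x ⊔ y
  x≤x⊔y x y with total x y
  ... | inj₁ x≤y = x≤y
  ... | inj₂ _   = ≤-refl

  y≤x⊔y : ∀ x y → y ≤ x ⊔ y
  y≤x⊔y x y with total x y
  ... | inj₁ _   = ≤-refl
  ... | inj₂ y≤x = y≤x

  0≤1 : 0# ≤ 1#
  0≤1 = ≰⇒≥ 1≰0

  ι : ℕ → R
  ι zero    = 0#
  ι (suc n) = 1# + ι n

  ι-nonneg : ∀ n → 0# ≤ ι n
  ι-nonneg zero    = ≤-refl
  ι-nonneg (suc n) = linear (1# ∷ ι n ∷ []) (λ i x → (𝟘 ≼ i) ∷ (𝟘 ≼ x) ∷ [] ⊢ 𝟘 ≼ i ⊕ x) refl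
    0≤1 (ι-nonneg n)

  ι-+ : ∀ m n → ι (m ℕ.+ n) ≡ ι m + ι n
  ι-+ zero    n = sym (+-identityˡ (ι n))
  ι-+ (suc m) n = trans (cong (1# +_) (ι-+ m n)) (sym (+-assoc 1# (ι m) (ι n)))

  ι-mono : ∀ {m n} → m ℕ.≤ n → ι m ≤ ι n
  ι-mono {n = n} ℕ.z≤n   = ι-nonneg n
  ι-mono         (ℕ.s≤s m≤n) = +-mono₂ ≤-refl (ι-mono m≤n)

  ι-cancel : ∀ m n → ι m ≤ ι n → m ℕ.≤ n
  ι-cancel zero    n       _  = ℕ.z≤n
  ι-cancel (suc m) zero    le = contradiction
    (linear (1# ∷ ι m ∷ []) (λ i x → (i ⊕ x ≼ 𝟘) ∷ (𝟘 ≼ x) ∷ [] ⊢ i ≼ 𝟘) refl le (ι-nonneg m)) 1≰0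
  ι-cancel (suc m) (suc n) le = ℕ.s≤s (ι-cancel m n
    (linear (1# ∷ ι m ∷ ι n ∷ []) (λ i x y → (i ⊕ x ≼ i ⊕ y) ∷ [] ⊢ x ≼ y) refl le))

  argmax : ∀ {n} (g : Subset n → R) → ∃ λ S → ∀ T → g T ≤ g S
  argmax {zero}  g = [] , λ { [] → ≤-refl }
  argmax {suc n} g with argmax (λ S → g (true ∷ S)) | argmax (λ S → g (false ∷ S))
  ... | S , S-max | T , T-max with total (g (true ∷ S)) (g (false ∷ T))
  ... | inj₁ le = false ∷ T , λ { (true ∷ U) → ≤-trans (S-max U) le ; (false ∷ U) → T-max U }
  ... | inj₂ le = true ∷ S , λ { (true ∷ U) → S-max U ; (false ∷ U) → ≤-trans (T-max U) le }

  infixl 6 _⊓_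
  _⊓_ : R → R → R
  x ⊓ y with total x y
  ... | inj₁ _ = x
  ... | inj₂ _ = y

  x⊓y≤x : ∀ x y → x ⊓ y ≤ x
  x⊓y≤x x y with total x y
  ... | inj₁ _   = ≤-refl
  ... | inj₂ y≤x = y≤x

  x⊓y≤y : ∀ x y → x ⊓ y ≤ y
  x⊓y≤y x y with total x y
  ... | inj₁ x≤y = x≤y
  ... | inj₂ _   = ≤-refl

  ⊓-glb : ∀ {x y z} → z ≤ x → z ≤ y → z ≤ x ⊓ y
  ⊓-glb {x} {y} z≤x z≤y with total x y
  ... | inj₁ _ = z≤x
  ... | inj₂ _ = z≤y

-- Markets, and closure of gross substitutability under identifying copies of items.

module Markets (ℝ : CompleteOrderedField) where
  open CompleteOrderedField ℝ renaming (Carrier to R)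
  open Valuations ℝ using (sumOver)
  open OrderedField ℝ

  -- Bundles and prices are abstract so that one notion of gross substitutability covers single
  -- items, sets of items and products of these, and so that two copies of an item can be joined
  -- next to an arbitrary remainder. In `Keeps-trans` the second step is at fixed prices: it serves
  -- to replace a demanded bundle by another one at the same prices.
  record Market : Set₁ where
    field
      Bundle Price : Set
      cost         : Bundle → Price → R
      _≤ₚ_         : Price → Price → Set
      -- the items of the first bundle whose price did not change are in the second
      Keeps        : Price → Price → Bundle → Bundle → Set
      ≤ₚ-refl      : ∀ p → p ≤ₚ p
      Keeps-trans  : ∀ {p q X Y Z} → Keeps p q X Y → Keeps q q Y Z → Keeps p q X Z
      maximiser    : (g : Bundle → R) → ∃ λ X → ∀ Y → g Y ≤ g X

  open Market

  Demanded : (M : Market) → (Bundle M → R) → Price M → Bundle M → Set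
  Demanded M f p X = ∀ Y → f Y + cost M X p ≤ f X + cost M Y p

  GS : (M : Market) → (Bundle M → R) → Set
  GS M f = ∀ p q → _≤ₚ_ M p q → ∀ X → Demanded M f p X →
    ∃ λ Y → Demanded M f q Y × Keeps M p q X Y

  GS-cong : ∀ M {f g} → (∀ X → f X ≡ g X) → GS M f → GS M g
  GS-cong M f≡g gs p q p≤q X dem =
    let Y , demY , keep = gs p q p≤q X λ Y →
          subst₂ (λ a b → a + cost M X p ≤ b + cost M Y p) (sym (f≡g Y)) (sym (f≡g X)) (dem Y)
    in Y , (λ Z → subst₂ (λ a b → a + cost M Y q ≤ b + cost M Z q) (f≡g Z) (f≡g Y) (demY Z)) , keep

  -- The section makes every bundle of `N` an image, so optimality is tested against the same
  -- alternatives in both markets. Prices travel only from `M` to `N`; the map may thus land in a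
  -- thin part of the prices of `N`, such as equal prices for two copies.
  GS-transport : ∀ M N (φ : Bundle M → Bundle N) (φ⁻¹ : Bundle N → Bundle M)
    (ψ : Price M → Price N) → (∀ X → φ (φ⁻¹ X) ≡ X) →
    (∀ X p → cost N (φ X) (ψ p) ≡ cost M X p) →
    (∀ {p q} → _≤ₚ_ M p q → _≤ₚ_ N (ψ p) (ψ q)) →
    (∀ {p q X Y} → Keeps N (ψ p) (ψ q) (φ X) (φ Y) → Keeps M p q X Y) →
    ∀ {f} → GS N f → GS M (λ X → f (φ X))
  GS-transport M N φ φ⁻¹ ψ section cost≡ ≤-pres keeps {f} gs p q p≤q X dem
    with gs (ψ p) (ψ q) (≤-pres p≤q) (φ X) (λ Y → subst
           (λ Z → f Z + cost N (φ X) (ψ p) ≤ f (φ X) + cost N Z (ψ p)) (section Y)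
           (subst₂ (λ a b → f (φ (φ⁻¹ Y)) + a ≤ f (φ X) + b)
             (sym (cost≡ X p)) (sym (cost≡ (φ⁻¹ Y) p)) (dem (φ⁻¹ Y))))
  ... | Y , demY , keep =
    φ⁻¹ Y
    , (λ Z → subst₂ (λ a b → f (φ Z) + a ≤ f (φ (φ⁻¹ Y)) + b) (cost≡ (φ⁻¹ Y) q) (cost≡ Z q)
               (subst (λ W → f (φ Z) + cost N W (ψ q) ≤ f W + cost N (φ Z) (ψ q))
                 (sym (section Y)) (demY (φ Z))))
    , keeps (subst (Keeps N (ψ p) (ψ q) (φ X)) (sym (section Y)) keep)

  itemCost : Bool → R → R
  itemCost true  r = r
  itemCost false r = 0#

  item : Market
  item = record
    { Bundle = Bool ; Price = R ; cost = itemCost ; _≤ₚ_ = _≤_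
    ; Keeps = λ r s x y → r ≡ s → x ≡ true → y ≡ true
    ; ≤ₚ-refl = λ _ → ≤-refl
    ; Keeps-trans = λ xy yz r≡s x → yz refl (xy r≡s x)
    ; maximiser = max }
    where
    max : (g : Bool → R) → ∃ λ x → ∀ y → g y ≤ g x
    max g with total (g true) (g false)
    ... | inj₁ le = false , λ { true → le ; false → ≤-refl }
    ... | inj₂ le = true , λ { true → ≤-refl ; false → le }

  subsets : ℕ → Market
  subsets n = record
    { Bundle = Subset n ; Price = Fin n → R ; cost = sumOver
    ; _≤ₚ_ = λ p q → ∀ i → p i ≤ q i
    ; Keeps = λ p q S T → ∀ i → i ∈ S → p i ≡ q i → i ∈ T
    ; ≤ₚ-refl = λ p i → ≤-refl
    ; Keeps-trans = λ ST TU i i∈S eq → TU i (ST i i∈S eq) refl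
    ; maximiser = argmax }

  infixr 5 _⊗_
  _⊗_ : Market → Market → Market
  M ⊗ N = record
    { Bundle = Bundle M × Bundle N ; Price = Price M × Price N
    ; cost = λ { (X , Y) (p , q) → cost M X p + cost N Y q }
    ; _≤ₚ_ = λ { (p , q) (p′ , q′) → _≤ₚ_ M p p′ × _≤ₚ_ N q q′ }
    ; Keeps = λ { (p , q) (p′ , q′) (X , Y) (X′ , Y′) → Keeps M p p′ X X′ × Keeps N q q′ Y Y′ }
    ; ≤ₚ-refl = λ { (p , q) → ≤ₚ-refl M p , ≤ₚ-refl N q }
    ; Keeps-trans = λ { (a , b) (c , d) → Keeps-trans M a c , Keeps-trans N b d }
    ; maximiser = max }
    where
    max : (g : Bundle M × Bundle N → R) → ∃ λ X → ∀ Y → g Y ≤ g X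
    max g = let best X = maximiser N (λ Y → g (X , Y))
                X , X-max = maximiser M (λ X → g (X , proj₁ (best X)))
            in (X , proj₁ (best X)) , λ { (U , V) → ≤-trans (proj₂ (best U) V) (X-max U) }

  trivial : Market
  trivial = record
    { Bundle = Unit ; Price = Unit ; cost = λ _ _ → 0# ; _≤ₚ_ = λ _ _ → Unit
    ; Keeps = λ _ _ _ _ → Unit ; ≤ₚ-refl = λ _ → tt ; Keeps-trans = λ _ _ → tt
    ; maximiser = λ g → tt , λ _ → ≤-refl }

  -- Demand for a separable value splits: varying one component against the fixed other one shows
  -- that each component is demanded on its own, and the two responses add up.
  GS-⊗ : ∀ M N {f g} → GS M f → GS N g → GS (M ⊗ N) (λ { (X , Y) → f X + g Y })
  GS-⊗ M N {f} {g} gsM gsN (p , q) (p′ , q′) (p≤ , q≤) (X , Y) dem =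
    let X′ , demX , keepX = gsM p p′ p≤ X λ Z →
          linear (f X ∷ g Y ∷ cost M X p ∷ cost N Y q ∷ f Z ∷ cost M Z p ∷ [])
            (λ fX gY cX cY fZ cZ → ((fZ ⊕ gY) ⊕ (cX ⊕ cY) ≼ (fX ⊕ gY) ⊕ (cZ ⊕ cY)) ∷ []
              ⊢ fZ ⊕ cX ≼ fX ⊕ cZ) refl (dem (Z , Y))
        Y′ , demY , keepY = gsN q q′ q≤ Y λ Z →
          linear (f X ∷ g Y ∷ cost M X p ∷ cost N Y q ∷ g Z ∷ cost N Z q ∷ [])
            (λ fX gY cX cY gZ cZ → ((fX ⊕ gZ) ⊕ (cX ⊕ cY) ≼ (fX ⊕ gY) ⊕ (cX ⊕ cZ)) ∷ []
              ⊢ gZ ⊕ cY ≼ gY ⊕ cZ) refl (dem (X , Z))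
    in (X′ , Y′)
       , (λ { (U , V) → linear (f X′ ∷ g Y′ ∷ cost M X′ p′ ∷ cost N Y′ q′ ∷ f U ∷ g V ∷ cost M U p′ ∷ cost N V q′ ∷ [])
            (λ fX gY cX cY fU gV cU cV → (fU ⊕ cX ≼ fX ⊕ cU) ∷ (gV ⊕ cY ≼ gY ⊕ cV) ∷ []
              ⊢ (fU ⊕ gV) ⊕ (cX ⊕ cY) ≼ (fX ⊕ gY) ⊕ (cU ⊕ cV)) refl (demX U) (demY V) })
       , keepX , keepY

  -- The joint item can play the role of either copy, but not of both.
  aggregate : ∀ M → (Bundle (item ⊗ item ⊗ M) → R) → Bundle (item ⊗ M) → R
  aggregate M f (false , Z) = f (false , false , Z)
  aggregate M f (true  , Z) = f (true , false , Z) ⊔ f (false , true , Z)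

  module Aggregation (M : Market) (f : Bundle (item ⊗ item ⊗ M) → R) (gs : GS (item ⊗ item ⊗ M) f) where

    private
      g : Bundle (item ⊗ M) → R
      g = aggregate M f

      Demanded₂ : Price (item ⊗ item ⊗ M) → Bundle (item ⊗ item ⊗ M) → Set
      Demanded₂ = Demanded (item ⊗ item ⊗ M) f

      Demanded₁ : Price (item ⊗ M) → Bundle (item ⊗ M) → Set
      Demanded₁ = Demanded (item ⊗ M) g

      opt : ∀ x y p → ∃ λ X → ∀ Y → f (x , y , Y) ⊖ cost M Y p ≤ f (x , y , X) ⊖ cost M X p
      opt x y p = maximiser M (λ Z → f (x , y , Z) ⊖ cost M Z p)

      -- The best utility from the rest of the market at prices `p`, given which copies are held.
      -- Demand in the two-copy market and in the joined one is expressed through these four numbers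
      -- alone.
      h : Bool → Bool → Price M → R
      h x y p = let Z = proj₁ (opt x y p) in f (x , y , Z) ⊖ cost M Z p

      h-bound : ∀ x y p Z → f (x , y , Z) ≤ h x y p + cost M Z p
      h-bound x y p Z = subst (_≤ h x y p + cost M Z p) (⊖-+ _ (cost M Z p))
        (+-mono₂ (proj₂ (opt x y p) Z) ≤-refl)

      h-attained : ∀ x y p → ∃ λ Z → h x y p + cost M Z p ≤ f (x , y , Z)
      h-attained x y p = proj₁ (opt x y p) , ≤-reflexive (⊖-+ _ _)

      demanded⁺ : ∀ a b p x y Z →
        (∀ x′ y′ → h x′ y′ p + (itemCost x a + (itemCost y b + cost M Z p))
                   ≤ f (x , y , Z) + (itemCost x′ a + itemCost y′ b)) →
        Demanded₂ (a , b , p) (x , y , Z)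
      demanded⁺ a b p x y Z H (x′ , y′ , Z′) =
        linear (h x′ y′ p ∷ f (x , y , Z) ∷ f (x′ , y′ , Z′) ∷ itemCost x a ∷ itemCost y b ∷ cost M Z p
                ∷ itemCost x′ a ∷ itemCost y′ b ∷ cost M Z′ p ∷ [])
          (λ h F F′ ca cb c ca′ cb′ c′ → (h ⊕ (ca ⊕ (cb ⊕ c)) ≼ F ⊕ (ca′ ⊕ cb′)) ∷ (F′ ≼ h ⊕ c′) ∷ []
            ⊢ F′ ⊕ (ca ⊕ (cb ⊕ c)) ≼ F ⊕ (ca′ ⊕ (cb′ ⊕ c′))) refl
          (H x′ y′) (h-bound x′ y′ p Z′)

      demanded⁻ : ∀ a b p x y Z → Demanded₂ (a , b , p) (x , y , Z) →
        ∀ x′ y′ → h x′ y′ p + (itemCost x a + (itemCost y b + cost M Z p))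
                  ≤ f (x , y , Z) + (itemCost x′ a + itemCost y′ b)
      demanded⁻ a b p x y Z dem x′ y′ =
        let Z′ , att = h-attained x′ y′ p in
        linear (h x′ y′ p ∷ f (x , y , Z) ∷ f (x′ , y′ , Z′) ∷ itemCost x a ∷ itemCost y b ∷ cost M Z p
                ∷ itemCost x′ a ∷ itemCost y′ b ∷ cost M Z′ p ∷ [])
          (λ h F F′ ca cb c ca′ cb′ c′ → (F′ ⊕ (ca ⊕ (cb ⊕ c)) ≼ F ⊕ (ca′ ⊕ (cb′ ⊕ c′))) ∷ (h ⊕ c′ ≼ F′) ∷ []
            ⊢ h ⊕ (ca ⊕ (cb ⊕ c)) ≼ F ⊕ (ca′ ⊕ cb′)) refl
          (dem (x′ , y′ , Z′)) att

      -- Otherwise, at prices where all of {a,b}, {a} and ∅ are optimal and {b} is not,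
      -- raising the price of a alone would make the demand drop b.
      h-submodular : ∀ p → h true true p + h false false p ≤ h true false p + h false true p
      h-submodular p with (h true true p + h false false p) ≤? (h true false p + h false true p)
      ... | yes le = le
      ... | no ¬le = result
        where
        htt = h true true p
        htf = h true false p
        hft = h false true p
        hff = h false false p
        ra = htf ⊖ hff
        rb = htt ⊖ htf
        ea : ra + hff ≡ htf
        ea = ⊖-+ htf hff
        eb : rb + htf ≡ htt
        eb = ⊖-+ htt htf
        Z = proj₁ (h-attained true true p)
        F = f (true , true , Z)
        c = cost M Z p
        att : htt + c ≤ F
        att = proj₂ (h-attained true true p)
        start : ∀ x y → h x y p + (ra + (rb + c)) ≤ F + (itemCost x ra + itemCost y rb)
        start true true = linear (ra ∷ rb ∷ htt ∷ c ∷ F ∷ [])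
          (λ a b tt c F → (tt ⊕ c ≼ F) ∷ [] ⊢ tt ⊕ (a ⊕ (b ⊕ c)) ≼ F ⊕ (a ⊕ b)) refl att
        start true false = linear (ra ∷ rb ∷ htt ∷ htf ∷ c ∷ F ∷ [])
          (λ a b tt tf c F → (tt ⊕ c ≼ F) ∷ (b ⊕ tf ≼ tt) ∷ [] ⊢ tf ⊕ (a ⊕ (b ⊕ c)) ≼ F ⊕ (a ⊕ 𝟘)) refl
          att (≤-reflexive eb)
        start false true = linear (ra ∷ rb ∷ htt ∷ htf ∷ hft ∷ hff ∷ c ∷ F ∷ [])
          (λ a b tt tf ft ff c F → (tt ⊕ c ≼ F) ∷ (a ⊕ ff ≼ tf) ∷ (tf ⊕ ft ≼ tt ⊕ ff) ∷ []
            ⊢ ft ⊕ (a ⊕ (b ⊕ c)) ≼ F ⊕ (𝟘 ⊕ b)) refl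
          att (≤-reflexive ea) (≰⇒≥ ¬le)
        start false false = linear (ra ∷ rb ∷ htt ∷ htf ∷ hff ∷ c ∷ F ∷ [])
          (λ a b tt tf ff c F → (tt ⊕ c ≼ F) ∷ (a ⊕ ff ≼ tf) ∷ (b ⊕ tf ≼ tt) ∷ []
            ⊢ ff ⊕ (a ⊕ (b ⊕ c)) ≼ F ⊕ (𝟘 ⊕ 𝟘)) refl
          att (≤-reflexive ea) (≤-reflexive eb)
        result : htt + hff ≤ htf + hft
        result with gs (ra , rb , p) (ra + 1# , rb , p)
                       (linear (ra ∷ 1# ∷ []) (λ a i → (𝟘 ≼ i) ∷ [] ⊢ a ≼ a ⊕ i) refl 0≤1 , ≤-refl , ≤ₚ-refl M p)
                       (true , true , Z) (demanded⁺ ra rb p true true Z start)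
        ... | (x , y , Z′) , dem , _ , keep , _ with keep refl refl
        result | (false , true , Z′) , dem , _ | refl =
          linear (ra ∷ rb ∷ htt ∷ htf ∷ hft ∷ hff ∷ f (false , true , Z′) ∷ cost M Z′ p ∷ [])
            (λ a b tt tf ft ff F c → (ff ⊕ (𝟘 ⊕ (b ⊕ c)) ≼ F ⊕ (𝟘 ⊕ 𝟘)) ∷ (F ≼ ft ⊕ c) ∷ (tt ≼ b ⊕ tf) ∷ []
              ⊢ tt ⊕ ff ≼ tf ⊕ ft) refl
            (demanded⁻ _ _ p _ _ Z′ dem false false) (h-bound _ _ p Z′) (≤-reflexive (sym eb))
        result | (true , true , Z′) , dem , _ | refl = contradiction
          (linear (ra ∷ rb ∷ htt ∷ htf ∷ hff ∷ f (true , true , Z′) ∷ cost M Z′ p ∷ 1# ∷ [])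
            (λ a b tt tf ff F c i → (ff ⊕ ((a ⊕ i) ⊕ (b ⊕ c)) ≼ F ⊕ (𝟘 ⊕ 𝟘)) ∷ (F ≼ tt ⊕ c)
              ∷ (tt ≼ b ⊕ tf) ∷ (tf ≼ a ⊕ ff) ∷ [] ⊢ i ≼ 𝟘) refl
            (demanded⁻ _ _ p _ _ Z′ dem false false) (h-bound _ _ p Z′)
            (≤-reflexive (sym eb)) (≤-reflexive (sym ea))) 1≰0

      aggregated⁺ : ∀ r p x Z →
        h false false p + (itemCost x r + cost M Z p) ≤ g (x , Z) →
        h true false p + (itemCost x r + cost M Z p) ≤ g (x , Z) + r →
        h false true p + (itemCost x r + cost M Z p) ≤ g (x , Z) + r →
        Demanded₁ (r , p) (x , Z)
      aggregated⁺ r p x Z ff tf ft (false , Z′) =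
        linear (h false false p ∷ g (x , Z) ∷ g (false , Z′) ∷ itemCost x r ∷ cost M Z p ∷ cost M Z′ p ∷ [])
          (λ h G G′ cx c c′ → (h ⊕ (cx ⊕ c) ≼ G) ∷ (G′ ≼ h ⊕ c′) ∷ [] ⊢ G′ ⊕ (cx ⊕ c) ≼ G ⊕ (𝟘 ⊕ c′)) refl
          ff (h-bound false false p Z′)
      aggregated⁺ r p x Z ff tf ft (true , Z′)
        with ⊔-sel (f (true , false , Z′)) (f (false , true , Z′))
      ... | inj₁ eq = subst (λ G′ → G′ + (itemCost x r + cost M Z p) ≤ g (x , Z) + (r + cost M Z′ p)) (sym eq)
        (linear (h true false p ∷ g (x , Z) ∷ f (true , false , Z′) ∷ itemCost x r ∷ cost M Z p ∷ cost M Z′ p ∷ r ∷ [])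
          (λ h G F′ cx c c′ r → (h ⊕ (cx ⊕ c) ≼ G ⊕ r) ∷ (F′ ≼ h ⊕ c′) ∷ [] ⊢ F′ ⊕ (cx ⊕ c) ≼ G ⊕ (r ⊕ c′)) refl
          tf (h-bound true false p Z′))
      ... | inj₂ eq = subst (λ G′ → G′ + (itemCost x r + cost M Z p) ≤ g (x , Z) + (r + cost M Z′ p)) (sym eq)
        (linear (h false true p ∷ g (x , Z) ∷ f (false , true , Z′) ∷ itemCost x r ∷ cost M Z p ∷ cost M Z′ p ∷ r ∷ [])
          (λ h G F′ cx c c′ r → (h ⊕ (cx ⊕ c) ≼ G ⊕ r) ∷ (F′ ≼ h ⊕ c′) ∷ [] ⊢ F′ ⊕ (cx ⊕ c) ≼ G ⊕ (r ⊕ c′)) refl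
          ft (h-bound false true p Z′))

      aggregated⁻ : ∀ r p x Z → Demanded₁ (r , p) (x , Z) →
        (h false false p + (itemCost x r + cost M Z p) ≤ g (x , Z)) ×
        (h true false p + (itemCost x r + cost M Z p) ≤ g (x , Z) + r) ×
        (h false true p + (itemCost x r + cost M Z p) ≤ g (x , Z) + r)
      aggregated⁻ r p x Z dem =
        let A , attA = h-attained false false p
            B , attB = h-attained true false p
            C , attC = h-attained false true p
            used : ∀ H {F} Z′ → H + cost M Z′ p ≤ F → F ≤ g (true , Z′) →
                   H + (itemCost x r + cost M Z p) ≤ g (x , Z) + r
            used H {F} Z′ att le =
              linear (H ∷ F ∷ g (true , Z′) ∷ g (x , Z) ∷ itemCost x r ∷ cost M Z p ∷ cost M Z′ p ∷ r ∷ [])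
                (λ H F G′ G cx c c′ r → (H ⊕ c′ ≼ F) ∷ (F ≼ G′) ∷ (G′ ⊕ (cx ⊕ c) ≼ G ⊕ (r ⊕ c′)) ∷ []
                  ⊢ H ⊕ (cx ⊕ c) ≼ G ⊕ r) refl att le (dem (true , Z′))
        in linear (h false false p ∷ g (false , A) ∷ g (x , Z) ∷ itemCost x r ∷ cost M Z p ∷ cost M A p ∷ [])
             (λ H G′ G cx c c′ → (H ⊕ c′ ≼ G′) ∷ (G′ ⊕ (cx ⊕ c) ≼ G ⊕ (𝟘 ⊕ c′)) ∷ []
               ⊢ H ⊕ (cx ⊕ c) ≼ G) refl attA (dem (false , A))
           , used (h true false p) B attB (x≤x⊔y _ _)
           , used (h false true p) C attC (y≤x⊔y _ _)

      -- Both copies are priced at `r`. The joined market already compares holding none or one of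
      -- them; for holding both, `h-submodular` bounds the gain by the sum of the two single gains,
      -- each at most `r`.
      split-unused : ∀ r p Z → Demanded₁ (r , p) (false , Z) → Demanded₂ (r , r , p) (false , false , Z)
      split-unused r p Z dem = demanded⁺ r r p false false Z λ x y →
        subst (λ t → h x y p + t ≤ F + (itemCost x r + itemCost y r)) (sym (+-identityˡ (0# + c))) (H x y)
        where
        F = f (false , false , Z)
        c = cost M Z p
        bounds = aggregated⁻ r p false Z dem
        H : ∀ x y → h x y p + (0# + c) ≤ F + (itemCost x r + itemCost y r)
        H false false = subst (h false false p + (0# + c) ≤_)
          (sym (trans (cong (F +_) (+-identityˡ 0#)) (+-identityʳ F))) (proj₁ bounds)
        H true false = subst (λ t → h true false p + (0# + c) ≤ F + t) (sym (+-identityʳ r)) (proj₁ (proj₂ bounds))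
        H false true = subst (λ t → h false true p + (0# + c) ≤ F + t) (sym (+-identityˡ r)) (proj₂ (proj₂ bounds))
        H true true = linear (h true true p ∷ h true false p ∷ h false true p ∷ h false false p ∷ c ∷ F ∷ r ∷ [])
          (λ tt tf ft ff c F r → (tf ⊕ (𝟘 ⊕ c) ≼ F ⊕ r) ∷ (ft ⊕ (𝟘 ⊕ c) ≼ F ⊕ r) ∷ (F ≼ ff ⊕ c) ∷ (tt ⊕ ff ≼ tf ⊕ ft) ∷ []
            ⊢ tt ⊕ (𝟘 ⊕ c) ≼ F ⊕ (r ⊕ r)) refl
          (proj₁ (proj₂ bounds)) (proj₂ (proj₂ bounds)) (h-bound false false p Z) (h-submodular p)

      -- A used item is a common price s ≥ r of its two copies at which one copy suffices:
      -- s = r unless both copies would be bought at r.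
      split-used : ∀ r p Z → Demanded₁ (r , p) (true , Z) → ∃ λ s → r ≤ s ×
        (Demanded₂ (s , s , p) (true , false , Z) ⊎
         Demanded₂ (s , s , p) (false , true , Z))
      split-used r p Z dem = s , r≤s , choose
        where
        G = g (true , Z)
        c = cost M Z p
        htt = h true true p
        htf = h true false p
        hft = h false true p
        hff = h false false p
        bounds = aggregated⁻ r p true Z dem
        tf≤ : htf + c ≤ G
        tf≤ = linear (htf ∷ c ∷ G ∷ r ∷ [])
          (λ h c G r → (h ⊕ (r ⊕ c) ≼ G ⊕ r) ∷ [] ⊢ h ⊕ c ≼ G) refl (proj₁ (proj₂ bounds))
        ft≤ : hft + c ≤ G
        ft≤ = linear (hft ∷ c ∷ G ∷ r ∷ [])
          (λ h c G r → (h ⊕ (r ⊕ c) ≼ G ⊕ r) ∷ [] ⊢ h ⊕ c ≼ G) refl (proj₂ (proj₂ bounds))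
        -- `t` is the gain from a second copy, so at any price `s ≥ t` two copies do not beat one.
        -- If `s` is `t` rather than `r`, `h-submodular` shows that the first copy gains at least as
        -- much as the second, so having none is not better either.
        t = (htt + c) ⊖ G
        t+G : t + G ≡ htt + c
        t+G = ⊖-+ (htt + c) G
        s = r ⊔ t
        r≤s = x≤x⊔y r t
        tt≤ : htt + c ≤ G + s
        tt≤ = linear (htt ∷ c ∷ G ∷ s ∷ t ∷ [])
          (λ tt c G s t → (tt ⊕ c ≼ t ⊕ G) ∷ (t ≼ s) ∷ [] ⊢ tt ⊕ c ≼ G ⊕ s) refl
          (≤-reflexive (sym t+G)) (y≤x⊔y r t)
        ff≤ : hff + (s + c) ≤ G
        ff≤ with ⊔-sel r t
        ... | inj₁ s≡r = subst (λ s → hff + (s + c) ≤ G) (sym s≡r) (proj₁ bounds)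
        ... | inj₂ s≡t = subst (λ s → hff + (s + c) ≤ G) (sym s≡t)
          (linear (htt ∷ htf ∷ hft ∷ hff ∷ c ∷ G ∷ t ∷ [])
            (λ tt tf ft ff c G t → (tf ⊕ c ≼ G) ∷ (ft ⊕ c ≼ G) ∷ (tt ⊕ ff ≼ tf ⊕ ft) ∷ (t ⊕ G ≼ tt ⊕ c) ∷ []
              ⊢ ff ⊕ (t ⊕ c) ≼ G) refl tf≤ ft≤ (h-submodular p) (≤-reflexive t+G))
        optimal : ∀ {x y} → itemCost x s + itemCost y s ≡ s → f (x , y , Z) ≡ G →
          Demanded₂ (s , s , p) (x , y , Z)
        optimal {x} {y} one-copy F≡G = demanded⁺ s s p x y Z λ x′ y′ →
            linear (h x′ y′ p ∷ itemCost x s ∷ itemCost y s ∷ c ∷ s ∷ G ∷ f (x , y , Z) ∷ itemCost x′ s ∷ itemCost y′ s ∷ [])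
              (λ h cx cy c s G F cx′ cy′ → (h ⊕ (s ⊕ c) ≼ G ⊕ (cx′ ⊕ cy′)) ∷ (cx ⊕ cy ≼ s) ∷ (G ≼ F) ∷ []
                ⊢ h ⊕ (cx ⊕ (cy ⊕ c)) ≼ F ⊕ (cx′ ⊕ cy′)) refl
              (H x′ y′) (≤-reflexive one-copy) (≤-reflexive (sym F≡G))
          where
          H : ∀ x y → h x y p + (s + c) ≤ G + (itemCost x s + itemCost y s)
          H true true = linear (htt ∷ c ∷ G ∷ s ∷ [])
            (λ h c G s → (h ⊕ c ≼ G ⊕ s) ∷ [] ⊢ h ⊕ (s ⊕ c) ≼ G ⊕ (s ⊕ s)) refl tt≤
          H true false = linear (htf ∷ c ∷ G ∷ s ∷ [])
            (λ h c G s → (h ⊕ c ≼ G) ∷ [] ⊢ h ⊕ (s ⊕ c) ≼ G ⊕ (s ⊕ 𝟘)) refl tf≤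
          H false true = linear (hft ∷ c ∷ G ∷ s ∷ [])
            (λ h c G s → (h ⊕ c ≼ G) ∷ [] ⊢ h ⊕ (s ⊕ c) ≼ G ⊕ (𝟘 ⊕ s)) refl ft≤
          H false false = linear (hff ∷ c ∷ G ∷ s ∷ [])
            (λ h c G s → (h ⊕ (s ⊕ c) ≼ G) ∷ [] ⊢ h ⊕ (s ⊕ c) ≼ G ⊕ (𝟘 ⊕ 𝟘)) refl ff≤
        choose : Demanded₂ (s , s , p) (true , false , Z) ⊎
                 Demanded₂ (s , s , p) (false , true , Z)
        choose with ⊔-sel (f (true , false , Z)) (f (false , true , Z))
        ... | inj₁ eq = inj₁ (optimal (+-identityʳ s) (sym eq))
        ... | inj₂ eq = inj₂ (optimal (+-identityˡ s) (sym eq))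

      compare : ∀ {a b q x y Z s} → Demanded₂ (a , b , q) (x , y , Z) →
        itemCost x a + itemCost y b ≡ s → ∀ x′ y′ {s′} → itemCost x′ a + itemCost y′ b ≡ s′ →
        h x′ y′ q + (s + cost M Z q) ≤ f (x , y , Z) + s′
      compare {a} {b} {q} {x} {y} {Z} dem refl x′ y′ refl =
        subst (λ t → h x′ y′ q + t ≤ f (x , y , Z) + (itemCost x′ a + itemCost y′ b)) (sym (+-assoc _ _ _))
          (demanded⁻ a b q x y Z dem x′ y′)

      join-none : ∀ s q Z → Demanded₂ (s , s , q) (false , false , Z) →
        Demanded₁ (s , q) (false , Z)
      join-none s q Z dem = aggregated⁺ s q false Z
        (≤-trans (bound false false (+-identityˡ 0#)) (≤-reflexive (+-identityʳ _)))
        (bound true false (+-identityʳ s)) (bound false true (+-identityˡ s))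
        where bound = compare dem (+-identityˡ 0#)

      -- Bundles that use one unit of the item compare alike at `s` and at `r`, since the price
      -- cancels; against bundles without the item, the lower price only helps.
      join-one : ∀ r s q Z {F} → r ≤ s → F ≤ g (true , Z) → h false false q + (s + cost M Z q) ≤ F + 0# →
        h true false q + (s + cost M Z q) ≤ F + s → h false true q + (s + cost M Z q) ≤ F + s →
        Demanded₁ (r , q) (true , Z)
      join-one r s q Z {F} r≤s F≤G ff tf ft = aggregated⁺ r q true Z
        (linear (h false false q ∷ cost M Z q ∷ F ∷ r ∷ s ∷ g (true , Z) ∷ [])
          (λ h c F r s G → (h ⊕ (s ⊕ c) ≼ F ⊕ 𝟘) ∷ (r ≼ s) ∷ (F ≼ G) ∷ [] ⊢ h ⊕ (r ⊕ c) ≼ G) refl ff r≤s F≤G)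
        (lift tf) (lift ft)
        where
        lift : ∀ {H} → H + (s + cost M Z q) ≤ F + s → H + (r + cost M Z q) ≤ g (true , Z) + r
        lift {H} le = linear (H ∷ cost M Z q ∷ F ∷ r ∷ s ∷ g (true , Z) ∷ [])
          (λ h c F r s G → (h ⊕ (s ⊕ c) ≼ F ⊕ s) ∷ (F ≼ G) ∷ [] ⊢ h ⊕ (r ⊕ c) ≼ G ⊕ r) refl le F≤G

      join-left : ∀ r s q Z → r ≤ s → Demanded₂ (s , s , q) (true , false , Z) →
        Demanded₁ (r , q) (true , Z)
      join-left r s q Z r≤s dem = join-one r s q Z r≤s (x≤x⊔y _ _) (bound false false (+-identityˡ 0#))
        (bound true false (+-identityʳ s)) (bound false true (+-identityˡ s))
        where bound = compare dem (+-identityʳ s)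

      join-right : ∀ r s q Z → r ≤ s → Demanded₂ (s , s , q) (false , true , Z) →
        Demanded₁ (r , q) (true , Z)
      join-right r s q Z r≤s dem = join-one r s q Z r≤s (y≤x⊔y _ _) (bound false false (+-identityˡ 0#))
        (bound true false (+-identityʳ s)) (bound false true (+-identityˡ s))
        where bound = compare dem (+-identityˡ s)

      -- Price the copy with the lower value out of the market: the demand keeps the other copy.
      join-both : ∀ r s q Z → r ≤ s → Demanded₂ (s , s , q) (true , true , Z) →
        ∃ λ Z′ → Demanded₁ (r , q) (true , Z′) × Keeps M q q Z Z′
      join-both r s q Z r≤s dem with total (h true false q) (h false true q)
      ... | inj₁ tf≤ft = keepRight
        where
        htt = h true true q
        hft = h false true q
        -- One more than what the left copy adds to the right one: at this price holding both loses
        -- at least 1 against holding the right copy alone. As `tf≤ft`, the right copy is also the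
        -- better one for the joined item.
        k = (htt + 1#) ⊖ hft
        keepRight : ∃ λ Z′ → Demanded₁ (r , q) (true , Z′) × Keeps M q q Z Z′
        keepRight with gs (s , s , q) (s ⊔ k , s , q) (x≤x⊔y s k , ≤-refl , ≤ₚ-refl M q) (true , true , Z) dem
        ... | (x , y , Z′) , dem′ , _ , keep , keepZ with keep refl refl
        keepRight | (false , true , Z′) , dem′ , _ , _ , keepZ | refl =
          Z′ , join-one r s q Z′ r≤s (y≤x⊔y _ _) (bound false false (+-identityˡ 0#))
                 (≤-trans (+-mono₂ tf≤ft ≤-refl) (bound false true (+-identityˡ s)))
                 (bound false true (+-identityˡ s))
             , keepZ
          where bound = compare dem′ (+-identityˡ s)
        keepRight | (true , true , Z′) , dem′ , _ | refl = contradiction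
          (linear (htt ∷ hft ∷ k ∷ (s ⊔ k) ∷ s ∷ f (true , true , Z′) ∷ cost M Z′ q ∷ 1# ∷ [])
            (λ tt ft k m s F c i → (ft ⊕ ((m ⊕ s) ⊕ c) ≼ F ⊕ s) ∷ (F ≼ tt ⊕ c) ∷ (k ≼ m) ∷ (tt ⊕ i ≼ k ⊕ ft) ∷ []
              ⊢ i ≼ 𝟘) refl
            (compare dem′ refl false true (+-identityˡ s)) (h-bound _ _ q Z′) (y≤x⊔y s k)
            (≤-reflexive (sym (⊖-+ (htt + 1#) hft)))) 1≰0
      ... | inj₂ ft≤tf = keepLeft
        where
        htt = h true true q
        htf = h true false q
        k = (htt + 1#) ⊖ htf
        keepLeft : ∃ λ Z′ → Demanded₁ (r , q) (true , Z′) × Keeps M q q Z Z′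
        keepLeft with gs (s , s , q) (s , s ⊔ k , q) (≤-refl , x≤x⊔y s k , ≤ₚ-refl M q) (true , true , Z) dem
        ... | (x , y , Z′) , dem′ , keep , _ , keepZ with keep refl refl
        keepLeft | (true , false , Z′) , dem′ , _ , _ , keepZ | refl =
          Z′ , join-one r s q Z′ r≤s (x≤x⊔y _ _) (bound false false (+-identityˡ 0#))
                 (bound true false (+-identityʳ s))
                 (≤-trans (+-mono₂ ft≤tf ≤-refl) (bound true false (+-identityʳ s)))
             , keepZ
          where bound = compare dem′ (+-identityʳ s)
        keepLeft | (true , true , Z′) , dem′ , _ | refl = contradiction
          (linear (htt ∷ htf ∷ k ∷ (s ⊔ k) ∷ s ∷ f (true , true , Z′) ∷ cost M Z′ q ∷ 1# ∷ [])
            (λ tt tf k m s F c i → (tf ⊕ ((s ⊕ m) ⊕ c) ≼ F ⊕ s) ∷ (F ≼ tt ⊕ c) ∷ (k ≼ m) ∷ (tt ⊕ i ≼ k ⊕ tf) ∷ []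
              ⊢ i ≼ 𝟘) refl
            (compare dem′ refl true false (+-identityʳ s)) (h-bound _ _ q Z′) (y≤x⊔y s k)
            (≤-reflexive (sym (⊖-+ (htt + 1#) htf)))) 1≰0

    -- If the bundle lacks the item, nothing about the item has to be kept and both copies can be
    -- priced at `r` and then `r′`. Otherwise the copies are priced at the common price from
    -- `split-used`, the hypothesis is applied there, and the answer is joined again.
    GS-aggregate : GS (item ⊗ M) (aggregate M f)
    GS-aggregate (r , p) (r′ , q) (r≤r′ , p≤q) (false , Z) dem
      with gs (r , r , p) (r′ , r′ , q) (r≤r′ , r≤r′ , p≤q) (false , false , Z) (split-unused r p Z dem)
    ... | (false , false , Z′) , dem′ , _ , _ , keepZ = (false , Z′) , join-none r′ q Z′ dem′ , (λ _ ()) , keepZ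
    ... | (true , false , Z′) , dem′ , _ , _ , keepZ = (true , Z′) , join-left r′ r′ q Z′ ≤-refl dem′ , (λ _ ()) , keepZ
    ... | (false , true , Z′) , dem′ , _ , _ , keepZ = (true , Z′) , join-right r′ r′ q Z′ ≤-refl dem′ , (λ _ ()) , keepZ
    ... | (true , true , Z′) , dem′ , _ , _ , keepZ =
      let Z″ , dem″ , keep″ = join-both r′ r′ q Z′ ≤-refl dem′
      in (true , Z″) , dem″ , (λ _ ()) , Keeps-trans M keepZ keep″
    GS-aggregate (r , p) (r′ , q) (r≤r′ , p≤q) (true , Z) dem = result
      where
      s = proj₁ (split-used r p Z dem)
      r≤s = proj₁ (proj₂ (split-used r p Z dem))
      -- At least `s`, so that prices rise and the hypothesis applies; at least `r′`, so that the
      -- join lemmas can come down to the actual new price.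
      s′ = s ⊔ r′
      r′≤s′ = y≤x⊔y s r′
      Result = ∃ λ Y → Demanded₁ (r′ , q) Y × Keeps (item ⊗ M) (r , p) (r′ , q) (true , Z) Y

      -- If the copy in use is dropped then its price s rose, so s′ = r′ and r < r′.
      finish : ∀ x y Z′ → Demanded₂ (s′ , s′ , q) (x , y , Z′) → Keeps M p q Z Z′ →
        (s ≡ s′ → x ≡ true ⊎ y ≡ true) → Result
      finish true false Z′ dem′ keepZ _ = (true , Z′) , join-left r′ s′ q Z′ r′≤s′ dem′ , (λ _ _ → refl) , keepZ
      finish false true Z′ dem′ keepZ _ = (true , Z′) , join-right r′ s′ q Z′ r′≤s′ dem′ , (λ _ _ → refl) , keepZ
      finish true true Z′ dem′ keepZ _ =
        let Z″ , dem″ , keep″ = join-both r′ s′ q Z′ r′≤s′ dem′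
        in (true , Z″) , dem″ , (λ _ _ → refl) , Keeps-trans M keepZ keep″
      finish false false Z′ dem′ keepZ kept = (false , Z′)
        , join-none r′ q Z′ (subst (λ s → Demanded₂ (s , s , q) (false , false , Z′)) s′≡r′ dem′)
        , (λ { refl _ → ⊥-elim (dropped (antisym (x≤x⊔y s r′) (subst (_≤ s) (sym s′≡r′) r≤s))) }) , keepZ
        where
        dropped : ¬ (s ≡ s′)
        dropped eq with kept eq
        ... | inj₁ ()
        ... | inj₂ ()
        s′≡r′ : s′ ≡ r′
        s′≡r′ with ⊔-sel s r′
        ... | inj₁ eq = ⊥-elim (dropped (sym eq))
        ... | inj₂ eq = eq

      result : Result
      result with proj₂ (proj₂ (split-used r p Z dem))
      ... | inj₁ demL =
        let (x , y , Z′) , dem′ , keepX , _ , keepZ =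
              gs (s , s , p) (s′ , s′ , q) (x≤x⊔y s r′ , x≤x⊔y s r′ , p≤q) (true , false , Z) demL
        in finish x y Z′ dem′ keepZ (λ eq → inj₁ (keepX eq refl))
      ... | inj₂ demR =
        let (x , y , Z′) , dem′ , _ , keepY , keepZ =
              gs (s , s , p) (s′ , s′ , q) (x≤x⊔y s r′ , x≤x⊔y s r′ , p≤q) (false , true , Z) demR
        in finish x y Z′ dem′ keepZ (λ eq → inj₂ (keepY eq refl))

  open Aggregation public using (GS-aggregate)

  private
    paired : ∀ n M → (Bundle (subsets (suc n) ⊗ subsets (suc n) ⊗ M) → R) →
             Bundle (item ⊗ item ⊗ subsets n ⊗ subsets n ⊗ M) → R
    paired n M f (x , y , S , T , Z) = f (x ∷ S , y ∷ T , Z)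

    aggregateHead : ∀ n M → (Bundle (subsets (suc n) ⊗ subsets (suc n) ⊗ M) → R) →
                    Bundle (subsets n ⊗ subsets n ⊗ item ⊗ M) → R
    aggregateHead n M f (S , T , x , Z) = aggregate (subsets n ⊗ subsets n ⊗ M) (paired n M f) (x , S , T , Z)

  -- The items of the two copies of [n] are identified one at a time; M carries those already done.
  convolve : ∀ n M → (Bundle (subsets n ⊗ subsets n ⊗ M) → R) → Bundle (subsets n ⊗ M) → R
  convolve zero    M f (S , Z) = f (S , S , Z)
  convolve (suc n) M f (S , Z) = convolve n (item ⊗ M) (aggregateHead n M f) (tail S , head S , Z)

  convolve-bound : ∀ n M f S Z {T} → T ⊆ S → f (T , S ─ T , Z) ≤ convolve n M f (S , Z)
  convolve-bound zero    M f []          Z {[]}        T⊆S = ≤-refl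
  convolve-bound (suc n) M f (x ∷ S)     Z {t ∷ T}     T⊆S =
    ≤-trans (step x t T⊆S) (convolve-bound n (item ⊗ M) (aggregateHead n M f) S (x , Z) (drop-∷-⊆ T⊆S))
    where
    step : ∀ x t → (t ∷ T) ⊆ (x ∷ S) →
           f (t ∷ T , (x ∷ S) ─ (t ∷ T) , Z) ≤ aggregateHead n M f (T , S ─ T , x , Z)
    step true  true  _ = x≤x⊔y _ _
    step true  false _ = y≤x⊔y _ _
    step false false _ = ≤-refl
    step false true  T⊆S = contradiction (T⊆S here) λ ()

  convolve-attained : ∀ n M f S Z → ∃ λ T → T ⊆ S × convolve n M f (S , Z) ≡ f (T , S ─ T , Z)
  convolve-attained zero    M f []      Z = [] , (λ x → x) , refl
  convolve-attained (suc n) M f (x ∷ S) Z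
    with convolve-attained n (item ⊗ M) (aggregateHead n M f) S (x , Z)
  convolve-attained (suc n) M f (false ∷ S) Z | T , T⊆S , eq = false ∷ T , s⊆s T⊆S , eq
  convolve-attained (suc n) M f (true ∷ S) Z | T , T⊆S , eq
    with ⊔-sel (f (true ∷ T , false ∷ (S ─ T) , Z)) (f (false ∷ T , true ∷ (S ─ T) , Z))
  ... | inj₁ sel = true ∷ T , s⊆s T⊆S , trans eq sel
  ... | inj₂ sel = false ∷ T , out⊆ T⊆S , trans eq sel

  sumOver-∷ : ∀ {n} x (S : Subset n) p → sumOver (x ∷ S) p ≡ itemCost x (p fzero) + sumOver S (λ i → p (fsuc i))
  sumOver-∷ true  S p = refl
  sumOver-∷ false S p = sym (+-identityˡ _)

  private
    Keeps-tail : ∀ {n} {p q : Fin (suc n) → R} {x y S T} → Keeps (subsets (suc n)) p q (x ∷ S) (y ∷ T) →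
      Keeps (subsets n) (λ i → p (fsuc i)) (λ i → q (fsuc i)) S T
    Keeps-tail keep i i∈S eq = drop-there (keep (fsuc i) (there i∈S) eq)

    Keeps-head : ∀ {n} {p q : Fin (suc n) → R} {x y S T} → Keeps (subsets (suc n)) p q (x ∷ S) (y ∷ T) →
      Keeps item (p fzero) (q fzero) x y
    Keeps-head {x = true} {true}  keep eq _ = refl
    Keeps-head {x = true} {false} keep eq _ = contradiction (keep fzero here eq) λ ()

    Keeps-∷ : ∀ {n} {p q : Fin (suc n) → R} {x y S T} → Keeps item (p fzero) (q fzero) x y →
      Keeps (subsets n) (λ i → p (fsuc i)) (λ i → q (fsuc i)) S T → Keeps (subsets (suc n)) p q (x ∷ S) (y ∷ T)
    Keeps-∷ keep₀ keep fzero    here        eq with keep₀ eq refl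
    ... | refl = here
    Keeps-∷ keep₀ keep (fsuc i) (there i∈S) eq = there (keep i i∈S eq)

    ≤-∷ : ∀ {n r s} {p q : Fin n → R} → r ≤ s → (∀ i → p i ≤ q i) → ∀ i → (r F.∷ p) i ≤ (s F.∷ q) i
    ≤-∷ r≤s p≤q fzero    = r≤s
    ≤-∷ r≤s p≤q (fsuc i) = p≤q i

  -- Induction along the recursion of `convolve`. In the base case both copies are empty; in the
  -- inductive step three transports regroup products and price vectors around one use of
  -- `GS-aggregate`.
  GS-convolve : ∀ n M {f} → GS (subsets n ⊗ subsets n ⊗ M) f → GS (subsets n ⊗ M) (convolve n M f)
  GS-convolve zero M {f} gs = GS-transport (subsets 0 ⊗ M) (subsets 0 ⊗ subsets 0 ⊗ M)
    (λ { (S , Z) → S , S , Z }) (λ { (S , T , Z) → S , Z }) (λ { (p , q) → p , p , q })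
    (λ { ([] , [] , Z) → refl }) (λ { ([] , Z) p → +-identityˡ _ })
    (λ { (p≤ , q≤) → p≤ , p≤ , q≤ }) (λ { (kS , _ , kZ) → kS , kZ }) {f} gs
  GS-convolve (suc n) M {f} gs =
    GS-transport (subsets (suc n) ⊗ M) (subsets n ⊗ item ⊗ M)
      (λ { (S , Z) → tail S , head S , Z }) (λ { (S , x , Z) → x ∷ S , Z })
      (λ { (p , q) → (λ i → p (fsuc i)) , p fzero , q })
      (λ _ → refl) (λ { (x ∷ S , Z) (p , q) → cost-out x S Z p q }) (λ { (p≤ , q≤) → (λ i → p≤ (fsuc i)) , p≤ fzero , q≤ })
      (λ { {X = _ ∷ _ , _} {_ ∷ _ , _} (kS , kx , kZ) → Keeps-∷ kx kS , kZ }) (GS-convolve n (item ⊗ M)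
        (GS-transport (subsets n ⊗ subsets n ⊗ item ⊗ M) (item ⊗ subsets n ⊗ subsets n ⊗ M)
          (λ { (S , T , x , Z) → x , S , T , Z }) (λ { (x , S , T , Z) → S , T , x , Z })
          (λ { (p , q , r , o) → r , p , q , o }) (λ _ → refl)
          (λ { (S , T , x , Z) (p , q , r , o) → cost-mid x S T Z p q r o })
          (λ { (p≤ , q≤ , r≤ , o≤) → r≤ , p≤ , q≤ , o≤ }) (λ { (kx , kS , kT , kZ) → kS , kT , kx , kZ })
          (GS-aggregate (subsets n ⊗ subsets n ⊗ M) (paired n M f)
            (GS-transport (item ⊗ item ⊗ subsets n ⊗ subsets n ⊗ M) (subsets (suc n) ⊗ subsets (suc n) ⊗ M)
              (λ { (x , y , S , T , Z) → x ∷ S , y ∷ T , Z })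
              (λ { (S , T , Z) → head S , head T , tail S , tail T , Z })
              (λ { (a , b , p , q , r) → (a F.∷ p) , (b F.∷ q) , r })
              (λ { (_ ∷ _ , _ ∷ _ , _) → refl })
              (λ { (x , y , S , T , Z) (a , b , p , q , r) → cost-in x y S T Z a b p q r })
              (λ { (a≤ , b≤ , p≤ , q≤ , r≤) → ≤-∷ a≤ p≤ , ≤-∷ b≤ q≤ , r≤ })
              (λ { (kS , kT , kZ) → Keeps-head kS , Keeps-head kT , Keeps-tail kS , Keeps-tail kT , kZ })
              {f} gs))))
    where
    cost-out : ∀ x (S : Subset n) Z p q → sumOver S (λ i → p (fsuc i)) + (itemCost x (p fzero) + cost M Z q)
                                          ≡ sumOver (x ∷ S) p + cost M Z q
    cost-out x S Z p q = trans (rearrange ρ (λ a b c → a ⊕ (b ⊕ c) , (b ⊕ a) ⊕ c) refl)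
      (cong (_+ cost M Z q) (sym (sumOver-∷ x S p)))
      where ρ = sumOver S (λ i → p (fsuc i)) ∷ itemCost x (p fzero) ∷ cost M Z q ∷ []
    cost-mid : ∀ x (S T : Subset n) Z p q r o → itemCost x r + (sumOver S p + (sumOver T q + cost M Z o))
                                                ≡ sumOver S p + (sumOver T q + (itemCost x r + cost M Z o))
    cost-mid x S T Z p q r o = rearrange (itemCost x r ∷ sumOver S p ∷ sumOver T q ∷ cost M Z o ∷ [])
      (λ a b c d → a ⊕ (b ⊕ (c ⊕ d)) , b ⊕ (c ⊕ (a ⊕ d))) refl
    cost-in : ∀ x y (S T : Subset n) Z a b p q r →
      sumOver (x ∷ S) (a F.∷ p) + (sumOver (y ∷ T) (b F.∷ q) + cost M Z r)
      ≡ itemCost x a + (itemCost y b + (sumOver S p + (sumOver T q + cost M Z r)))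
    cost-in x y S T Z a b p q r = trans
      (cong₂ (λ u v → u + (v + cost M Z r)) (sumOver-∷ x S (a F.∷ p)) (sumOver-∷ y T (b F.∷ q)))
      (rearrange ρ (λ a b c d e → (a ⊕ c) ⊕ ((b ⊕ d) ⊕ e) , a ⊕ (b ⊕ (c ⊕ (d ⊕ e)))) refl)
      where ρ = itemCost x a ∷ itemCost y b ∷ sumOver S p ∷ sumOver T q ∷ cost M Z r ∷ []

  infixl 7 _✶_
  -- The max-convolution over all splits of a set into two parts, in a form that inherits gross
  -- substitutability; `✶-bound` and `✶-attained` recover the description as a maximum.
  _✶_ : ∀ {n} → (Subset n → R) → (Subset n → R) → Subset n → R
  (f ✶ g) S = convolve _ trivial (λ { (X , Y , _) → f X + g Y }) (S , tt)

  ✶-bound : ∀ {n} (f g : Subset n → R) {S T} → T ⊆ S → f T + g (S ─ T) ≤ (f ✶ g) S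
  ✶-bound f g {S} T⊆S = convolve-bound _ trivial _ S tt T⊆S

  ✶-attained : ∀ {n} (f g : Subset n → R) S → ∃ λ T → T ⊆ S × (f ✶ g) S ≡ f T + g (S ─ T)
  ✶-attained f g S = convolve-attained _ trivial _ S tt

  GS-✶ : ∀ {n} {f g : Subset n → R} → GS (subsets n) f → GS (subsets n) g → GS (subsets n) (f ✶ g)
  GS-✶ {n} {f} {g} gsf gsg = GS-transport (subsets n) (subsets n ⊗ trivial)
    (_, tt) proj₁ (_, tt) (λ _ → refl) (λ S p → +-identityʳ _) (λ p≤q → p≤q , tt) proj₁
    (GS-convolve n trivial (GS-transport (subsets n ⊗ subsets n ⊗ trivial) (subsets n ⊗ subsets n)
      (λ { (S , T , _) → S , T }) (λ { (S , T) → S , T , tt }) (λ { (p , q , _) → p , q })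
      (λ _ → refl) (λ { (S , T , _) (p , q , _) → cong (sumOver S p +_) (sym (+-identityʳ _)) })
      (λ { (p≤ , q≤ , _) → p≤ , q≤ }) (λ { (kS , kT) → kS , kT , tt })
      (GS-⊗ (subsets n) (subsets n) gsf gsg)))

-- Gross substitutes valuations: exchange, change of ground set, endowment and merging.

module GrossSubstitutes (ℝ : CompleteOrderedField) where
  open CompleteOrderedField ℝ renaming (Carrier to R)
  open Valuations ℝ
  open OrderedField ℝ
  open Markets ℝ
  open Subsets

  sumOver-⊞ : ∀ {n} {S : Subset n} i p → i ∉ S → sumOver (S ⊞ i) p ≡ p i + sumOver S p
  sumOver-⊞ {S = true ∷ S}  fzero    p i∉S = contradiction here i∉S
  sumOver-⊞ {S = false ∷ S} fzero    p i∉S = refl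
  sumOver-⊞ {S = false ∷ S} (fsuc i) p i∉S = sumOver-⊞ i (λ k → p (fsuc k)) (λ i∈S → i∉S (there i∈S))
  sumOver-⊞ {S = true ∷ S}  (fsuc i) p i∉S =
    trans (cong (p fzero +_) (sumOver-⊞ i (λ k → p (fsuc k)) (λ i∈S → i∉S (there i∈S))))
      (rearrange ρ (λ a b c → a ⊕ (b ⊕ c) , b ⊕ (a ⊕ c)) refl)
    where ρ = p fzero ∷ p (fsuc i) ∷ sumOver S (λ k → p (fsuc k)) ∷ []

  sumOver-⊟ : ∀ {n} {S : Subset n} i p → i ∈ S → sumOver S p ≡ p i + sumOver (S ⊟ i) p
  sumOver-⊟ {S = true ∷ S}  fzero    p here        = refl
  sumOver-⊟ {S = false ∷ S} (fsuc i) p (there i∈S) = sumOver-⊟ i (λ k → p (fsuc k)) i∈S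
  sumOver-⊟ {S = true ∷ S}  (fsuc i) p (there i∈S) =
    trans (cong (p fzero +_) (sumOver-⊟ i (λ k → p (fsuc k)) i∈S))
      (rearrange ρ (λ a b c → a ⊕ (b ⊕ c) , b ⊕ (a ⊕ c)) refl)
    where ρ = p fzero ∷ p (fsuc i) ∷ sumOver (S ⊟ i) (λ k → p (fsuc k)) ∷ []

  sumOver-split : ∀ {n} (E S : Subset n) p → sumOver S p ≡ sumOver (S ∩ E) p + sumOver (S ─ E) p
  sumOver-split []          []          p = sym (+-identityˡ 0#)
  sumOver-split (true ∷ E)  (false ∷ S) p = sumOver-split E S _
  sumOver-split (false ∷ E) (false ∷ S) p = sumOver-split E S _
  sumOver-split (true ∷ E)  (true ∷ S)  p =
    trans (cong (p fzero +_) (sumOver-split E S _)) (sym (+-assoc _ _ _))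
  sumOver-split (false ∷ E) (true ∷ S)  p =
    trans (cong (p fzero +_) (sumOver-split E S _))
      (rearrange ρ (λ a b c → a ⊕ (b ⊕ c) , b ⊕ (a ⊕ c)) refl)
    where ρ = p fzero ∷ sumOver (S ∩ E) (λ k → p (fsuc k)) ∷ sumOver (S ─ E) (λ k → p (fsuc k)) ∷ []

  Exchange : ∀ {n} → (Subset n → R) → Set
  Exchange f = ∀ S T i → i ∈ S → i ∉ T →
    f S + f T ≤ f (S ⊟ i) + f (T ⊞ i)
    ⊎ ∃ λ j → j ∈ T × j ∉ S × f S + f T ≤ f (S ⊟ i ⊞ j) + f (T ⊞ i ⊟ j)

  -- Starting from any optimum `T` at `q`, the items of `S` with unchanged price are inserted one by
  -- one. Exchanging `i` between `S` and `T` cannot improve `S` at `p`; as `p i ≡ q i`, and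
  -- `p j ≤ q j` for the item `j` given back, the changed `T` is no worse at `q`. Since `j` lies
  -- outside `S`, no item inserted earlier is lost.
  exchange⇒GS : ∀ {n} {f : Subset n → R} → Exchange f → GS (subsets n) f
  exchange⇒GS {n} {f} exch p q p≤q S demS =
    let T , demT , kept = build n ℕₚ.≤-refl in T , demT , λ i i∈S eq → kept i (Finₚ.toℕ<n i) i∈S eq
    where
    Optimal = Demanded (subsets n) f q

    insert : ∀ T i → Optimal T → i ∈ S → p i ≡ q i →
             ∃ λ T′ → Optimal T′ × i ∈ T′ × (∀ k → k ∈ S → k ∈ T → k ∈ T′)
    insert T i demT i∈S pi≡qi with i ∈? T
    ... | yes i∈T = T , demT , i∈T , λ _ _ k∈T → k∈T
    ... | no i∉T with exch S T i i∈S i∉T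
    ... | inj₁ le = T ⊞ i
        , (λ Y → linear (f S ∷ f T ∷ f (S ⊟ i) ∷ f (T ⊞ i) ∷ f Y ∷ sumOver S p ∷ sumOver (S ⊟ i) p ∷ p i ∷ q i
                         ∷ sumOver T q ∷ sumOver (T ⊞ i) q ∷ sumOver Y q ∷ [])
            (λ fS fT fS′ fT′ fY pS pS′ pi qi qT qT′ qY →
              (fS ⊕ fT ≼ fS′ ⊕ fT′) ∷ (fS′ ⊕ pS ≼ fS ⊕ pS′) ∷ (pi ⊕ pS′ ≼ pS) ∷ (qi ≼ pi)
              ∷ (qT′ ≼ qi ⊕ qT) ∷ (fY ⊕ qT ≼ fT ⊕ qY) ∷ [] ⊢ fY ⊕ qT′ ≼ fT′ ⊕ qY) refl
            le (demS (S ⊟ i)) (≤-reflexive (sym (sumOver-⊟ i p i∈S))) (≤-reflexive (sym pi≡qi))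
            (≤-reflexive (sumOver-⊞ i q i∉T)) (demT Y))
        , i∈S⊞i i , λ _ _ → ∈-⊞⁺ i
    ... | inj₂ (j , j∈T , j∉S , le) = T ⊞ i ⊟ j
        , (λ Y → linear (f S ∷ f T ∷ f (S ⊟ i ⊞ j) ∷ f (T ⊞ i ⊟ j) ∷ f Y ∷ sumOver S p ∷ sumOver (S ⊟ i) p
                         ∷ sumOver (S ⊟ i ⊞ j) p ∷ p i ∷ q i ∷ p j ∷ q j
                         ∷ sumOver T q ∷ sumOver (T ⊞ i) q ∷ sumOver (T ⊞ i ⊟ j) q ∷ sumOver Y q ∷ [])
            (λ fS fT fS″ fT″ fY pS pS′ pS″ pi qi pj qj qT qT′ qT″ qY →
              (fS ⊕ fT ≼ fS″ ⊕ fT″) ∷ (fS″ ⊕ pS ≼ fS ⊕ pS″) ∷ (pi ⊕ pS′ ≼ pS) ∷ (pS″ ≼ pj ⊕ pS′) ∷ (qi ≼ pi) ∷ (pj ≼ qj)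
              ∷ (qT′ ≼ qi ⊕ qT) ∷ (qj ⊕ qT″ ≼ qT′) ∷ (fY ⊕ qT ≼ fT ⊕ qY) ∷ [] ⊢ fY ⊕ qT″ ≼ fT″ ⊕ qY) refl
            le (demS (S ⊟ i ⊞ j)) (≤-reflexive (sym (sumOver-⊟ i p i∈S)))
            (≤-reflexive (sumOver-⊞ j p (λ j∈ → j∉S (proj₁ (∈-⊟⁻ i j∈)))))
            (≤-reflexive (sym pi≡qi)) (p≤q j) (≤-reflexive (sumOver-⊞ i q i∉T))
            (≤-reflexive (sym (sumOver-⊟ j q (∈-⊞⁺ i j∈T)))) (demT Y))
        , ∈-⊟⁺ j (i∈S⊞i i) (λ { refl → j∉S i∈S })
        , λ k k∈S k∈T → ∈-⊟⁺ j (∈-⊞⁺ i k∈T) (λ { refl → j∉S k∈S })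

    below-or-at : ∀ {k} (k<n : k ℕ.< n) i → toℕ i ℕ.< suc k → toℕ i ℕ.< k ⊎ i ≡ fromℕ< k<n
    below-or-at k<n i i≤k with ℕₚ.m≤n⇒m<n∨m≡n (ℕ.s≤s⁻¹ i≤k)
    ... | inj₁ i<k = inj₁ i<k
    ... | inj₂ i≡k = inj₂ (Finₚ.toℕ-injective (trans i≡k (sym (Finₚ.toℕ-fromℕ< k<n))))

    build : ∀ k → k ℕ.≤ n → ∃ λ T → Optimal T × (∀ i → toℕ i ℕ.< k → i ∈ S → p i ≡ q i → i ∈ T)
    build zero _ = let T , T-max = argmax (λ T → f T ⊖ sumOver T q) in T , (λ Y → ⊖-≤⁻ (T-max Y)) , λ _ ()
    build (suc k) k<n with build k (ℕₚ.<⇒≤ k<n)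
    ... | T , demT , kept with fromℕ< k<n ∈? S | p (fromℕ< k<n) ≟ q (fromℕ< k<n)
    ... | yes i∈S | yes eq = let T′ , demT′ , i∈T′ , keep = insert T (fromℕ< k<n) demT i∈S eq in
      T′ , demT′ , λ i i≤k i∈S eq → [ (λ i<k → keep i i∈S (kept i i<k i∈S eq)) , (λ { refl → i∈T′ }) ]′ (below-or-at k<n i i≤k)
    ... | no i∉S | _ = T , demT , λ i i≤k i∈S eq →
      [ (λ i<k → kept i i<k i∈S eq) , (λ { refl → contradiction i∈S i∉S }) ]′ (below-or-at k<n i i≤k)
    ... | yes _ | no neq = T , demT , λ i i≤k i∈S eq →
      [ (λ i<k → kept i i<k i∈S eq) , (λ { refl → contradiction eq neq }) ]′ (below-or-at k<n i i≤k)

  -- Items outside the ground set become worthless.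
  extend : ∀ {n} → Valuation n → Subset n → R
  extend u S = val u (S ∩ ground u)

  extend-⊆ : ∀ {n} (u : Valuation n) {S} → S ⊆ ground u → extend u S ≡ val u S
  extend-⊆ u S⊆ = cong (val u) (∩-absorb S⊆)

  extend-mono : ∀ {n} (u : Valuation n) {S T} → S ⊆ T → extend u S ≤ extend u T
  extend-mono u {S} {T} S⊆T = val-mono u _ _
    (λ k∈ → let k∈S , k∈E = x∈p∩q⁻ S (ground u) k∈ in x∈p∩q⁺ (S⊆T k∈S , k∈E)) (p∩q⊆q T (ground u))

  extend-⊥ : ∀ {n} (u : Valuation n) → extend u ⊥ ≡ 0#
  extend-⊥ u = trans (extend-⊆ u ⊥⊆) (val-∅ u)

  private
    within : ∀ {n} → Subset n → (Fin n → R) → Fin n → R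
    within E p i = if lookup E i then p i else 0#

    sumOver-within : ∀ {n} (E S : Subset n) p → sumOver S (within E p) ≡ sumOver (S ∩ E) p
    sumOver-within []          []          p = refl
    sumOver-within (true ∷ E)  (true ∷ S)  p = cong (p fzero +_) (sumOver-within E S _)
    sumOver-within (false ∷ E) (true ∷ S)  p = trans (+-identityˡ _) (sumOver-within E S _)
    sumOver-within (true ∷ E)  (false ∷ S) p = sumOver-within E S _
    sumOver-within (false ∷ E) (false ∷ S) p = sumOver-within E S _

    outwith : ∀ {n} → Subset n → (Fin n → R) → Fin n → R
    outwith E p i = if lookup E i then 0# else p i

    sumOver-outwith : ∀ {n} (E S : Subset n) p → sumOver S (outwith E p) ≡ sumOver (S ─ E) p
    sumOver-outwith []          []          p = refl
    sumOver-outwith (true ∷ E)  (true ∷ S)  p = trans (+-identityˡ _) (sumOver-outwith E S _)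
    sumOver-outwith (false ∷ E) (true ∷ S)  p = cong (p fzero +_) (sumOver-outwith E S _)
    sumOver-outwith (true ∷ E)  (false ∷ S) p = sumOver-outwith E S _
    sumOver-outwith (false ∷ E) (false ∷ S) p = sumOver-outwith E S _

    -- Off the ground set items are worthless, so taking all those with nonpositive price is optimal
    -- there. Price 0 is included on purpose: a demanded bundle may hold such an item, which then
    -- has to be kept.
    cheap : ∀ {n} → (Fin n → R) → Subset n
    cheap {zero}  p = []
    cheap {suc n} p = does (p fzero ≤? 0#) ∷ cheap (λ i → p (fsuc i))

    ∈-cheap : ∀ {n} (p : Fin n → R) {i} → p i ≤ 0# → i ∈ cheap p
    ∈-cheap p {fsuc i} le = there (∈-cheap (λ k → p (fsuc k)) le)
    ∈-cheap p {fzero}  le with p fzero ≤? 0#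
    ... | yes _  = here
    ... | no ¬le = contradiction le ¬le

    cheap-min : ∀ {n} (E S : Subset n) p → sumOver (cheap p ─ E) p ≤ sumOver (S ─ E) p
    cheap-min []         []        p = ≤-refl
    cheap-min (true ∷ E) (_ ∷ S)   p = cheap-min E S (λ i → p (fsuc i))
    cheap-min (false ∷ E) (x ∷ S)  p with p fzero ≤? 0# | x
    ... | yes _ | true  = +-mono₂ ≤-refl (cheap-min E S (λ i → p (fsuc i)))
    ... | no _  | false = cheap-min E S (λ i → p (fsuc i))
    ... | yes le | false = linear (p fzero ∷ _ ∷ _ ∷ [])
      (λ r a b → (r ≼ 𝟘) ∷ (a ≼ b) ∷ [] ⊢ r ⊕ a ≼ b) refl le (cheap-min E S (λ i → p (fsuc i)))
    ... | no ¬le | true = linear (p fzero ∷ _ ∷ _ ∷ [])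
      (λ r a b → (𝟘 ≼ r) ∷ (a ≼ b) ∷ [] ⊢ a ≼ r ⊕ b) refl (≰⇒≥ ¬le) (cheap-min E S (λ i → p (fsuc i)))

  -- The problem separates: on the ground set the hypothesis answers, and off it the sign of the
  -- price decides. A demanded bundle holds an item off the ground set only at nonpositive price, so
  -- if the price is unchanged the item is `cheap` at `q` as well.
  IsGS⇒GS : ∀ {n} (u : Valuation n) → IsGS u → GS (subsets n) (extend u)
  IsGS⇒GS {n} u gs p q p≤q S demS = finish (gs p q (λ i _ → p≤q i) (S ∩ E) (p∩q⊆q S E , demE))
    where
    E = ground u
    demE : ∀ T → T ⊆ E → val u T ⊖ sumOver T p ≤ val u (S ∩ E) ⊖ sumOver (S ∩ E) p
    demE T T⊆E = ⊖-≤⁺ (linear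
      (val u T ∷ val u (S ∩ E) ∷ extend u X ∷ sumOver T p ∷ sumOver (S ∩ E) p ∷ sumOver (S ─ E) p ∷ sumOver S p ∷ sumOver X p ∷ [])
      (λ uT uS uX pT pS∩ pS─ pS pX → (uT ≼ uX) ∷ (uX ⊕ pS ≼ uS ⊕ pX) ∷ (pX ≼ pT ⊕ pS─) ∷ (pS∩ ⊕ pS─ ≼ pS) ∷ []
        ⊢ uT ⊕ pS∩ ≼ uS ⊕ pT) refl
      (≤-reflexive (cong (val u) (sym X∩E≡T))) (demS X)
      (≤-reflexive (trans (sumOver-split E X p)
        (cong₂ (λ A B → sumOver A p + sumOver B p) X∩E≡T (splice-─ E T S))))
      (≤-reflexive (sym (sumOver-split E S p))))
      where
      X = splice E T S
      X∩E≡T = trans (splice-∩ E T S) (∩-absorb T⊆E)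
    unpriced : ∀ i → i ∈ S → i ∉ E → p i ≤ 0#
    unpriced i i∈S i∉E = linear (p i ∷ extend u S ∷ extend u (S ⊟ i) ∷ sumOver S p ∷ sumOver (S ⊟ i) p ∷ [])
      (λ pi uS uS′ pS pS′ → (uS ≼ uS′) ∷ (uS′ ⊕ pS ≼ uS ⊕ pS′) ∷ (pi ⊕ pS′ ≼ pS) ∷ [] ⊢ pi ≼ 𝟘) refl
      (val-mono u _ _ (λ {k} k∈ → let k∈S , k∈E = x∈p∩q⁻ S E k∈ in
        x∈p∩q⁺ (∈-⊟⁺ i k∈S (λ { refl → i∉E k∈E }) , k∈E)) (p∩q⊆q (S ⊟ i) E))
      (demS (S ⊟ i)) (≤-reflexive (sym (sumOver-⊟ i p i∈S)))
    finish : (∃ λ T → Demand u q T × (∀ i → i ∈ S ∩ E → p i ≡ q i → i ∈ T)) →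
             ∃ λ T → Demanded (subsets n) (extend u) q T × (∀ i → i ∈ S → p i ≡ q i → i ∈ T)
    finish (T , (T⊆E , demT) , keep) = X , demX , keepX
      where
      X = splice E T (cheap q)
      X∩E≡T = trans (splice-∩ E T (cheap q)) (∩-absorb T⊆E)
      demX : Demanded (subsets n) (extend u) q X
      demX Y = linear
        (val u T ∷ extend u X ∷ extend u Y ∷ sumOver T q ∷ sumOver X q ∷ sumOver Y q ∷ sumOver (Y ∩ E) q ∷ sumOver (Y ─ E) q
         ∷ sumOver (cheap q ─ E) q ∷ [])
        (λ uT uX uY qT qX qY qY∩ qY─ qC → (uT ≼ uX) ∷ (uY ⊕ qT ≼ uT ⊕ qY∩) ∷ (qC ≼ qY─) ∷ (qX ≼ qT ⊕ qC) ∷ (qY∩ ⊕ qY─ ≼ qY) ∷ []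
          ⊢ uY ⊕ qX ≼ uX ⊕ qY) refl
        (≤-reflexive (cong (val u) (sym X∩E≡T))) (⊖-≤⁻ (demT (Y ∩ E) (p∩q⊆q Y E))) (cheap-min E Y q)
        (≤-reflexive (trans (sumOver-split E X q)
          (cong₂ (λ A B → sumOver A q + sumOver B q) X∩E≡T (splice-─ E T (cheap q)))))
        (≤-reflexive (sym (sumOver-split E Y q)))
      keepX : ∀ i → i ∈ S → p i ≡ q i → i ∈ X
      keepX i i∈S eq with i ∈? E
      ... | yes i∈E = x∈p∪q⁺ (inj₁ (x∈p∩q⁺ (keep i (x∈p∩q⁺ (i∈S , i∈E)) eq , i∈E)))
      ... | no i∉E = x∈p∪q⁺ (inj₂ (x∈p∧x∉q⇒x∈p─q (∈-cheap q (subst (_≤ 0#) eq (unpriced i i∈S i∉E))) i∉E))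

  -- Prices are reset to 0 off the ground set: there `p ≤ q` is not given, and zero prices make the
  -- bundles `X` and `X ∩ E` equally good.
  GS⇒IsGS : ∀ {n} (u : Valuation n) → GS (subsets n) (extend u) → IsGS u
  GS⇒IsGS {n} u gs p q p≤q S (S⊆E , demS) =
    let T , demT , keep = gs (within E p) (within E q) within-≤ S demanded
    in T ∩ E , (p∩q⊆q T E , λ X X⊆E → ⊖-≤⁺ (subst₂ _≤_
         (cong₂ _+_ (extend-⊆ u X⊆E) (sumOver-within E T q))
         (cong (extend u T +_) (trans (sumOver-within E X q) (cong (λ A → sumOver A q) (∩-absorb X⊆E)))) (demT X)))
       , λ i i∈S eq → x∈p∩q⁺ (keep i i∈S (within-≡ eq) , S⊆E i∈S)
    where
    E = ground u
    within-≤ : ∀ i → within E p i ≤ within E q i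
    within-≤ i with lookup E i in eq
    ... | true  = p≤q i (lookup⇒[]= i E eq)
    ... | false = ≤-refl
    within-≡ : ∀ {i} → p i ≡ q i → within E p i ≡ within E q i
    within-≡ {i} eq with lookup E i
    ... | true  = eq
    ... | false = refl
    demanded : Demanded (subsets n) (extend u) (within E p) S
    demanded X = subst₂ _≤_
      (cong (extend u X +_) (sym (trans (sumOver-within E S p) (cong (λ A → sumOver A p) (∩-absorb S⊆E)))))
      (cong₂ _+_ (sym (extend-⊆ u S⊆E)) (sym (sumOver-within E X p)))
      (⊖-≤⁻ (demS (X ∩ E) (p∩q⊆q X E)))

  -- With `T` free, monotonicity lets every bundle be completed by `T` at no cost, so the utilities
  -- for `u` on sets containing `T` differ from those for `w` by the constant `val u T`.
  endow-GS : ∀ {n} {u w : Valuation n} {T} → T ⊆ ground u → IsEndow u T w → IsGS u → IsGS w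
  endow-GS {u = u} {w} {T} T⊆E (refl , w≡) gs p q p≤q S (S⊆ , demS) =
    let Y , (Y⊆E , demY) , keep = gs (outwith T p) (outwith T q) outwith-≤ (S ∪ T) demanded
    in Y ─ T
       , ((λ k∈ → let k∈Y , k∉T = ∈-─⁻ Y T k∈ in x∈p∧x∉q⇒x∈p─q (Y⊆E k∈Y) k∉T)
         , λ X X⊆ → ⊖-≤⁺ (linear
             (val w X ∷ val w (Y ─ T) ∷ val u Y ∷ val u (X ∪ T) ∷ val u ((Y ─ T) ∪ T) ∷ val u T
              ∷ sumOver X q ∷ sumOver (Y ─ T) q ∷ [])
             (λ wX wY uY uX uY′ uT qX qY → (wX ⊕ uT ≼ uX) ∷ (uY′ ≼ wY ⊕ uT) ∷ (uY ≼ uY′) ∷ (uX ⊕ qY ≼ uY ⊕ qX) ∷ []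
               ⊢ wX ⊕ qY ≼ wY ⊕ qX) refl
             (≤-reflexive (value X⊆))
             (≤-reflexive (sym (value (λ k∈ → let k∈Y , k∉T = ∈-─⁻ Y T k∈ in x∈p∧x∉q⇒x∈p─q (Y⊆E k∈Y) k∉T))))
             (val-mono u _ _ (⊆-─-∪ Y T) (∪-lub (λ k∈ → Y⊆E (p─q⊆p Y T k∈)) T⊆E))
             (subst₂ _≤_ (cong (val u (X ∪ T) +_) (sumOver-outwith T Y q))
               (cong (val u Y +_) (trans (sumOver-outwith T (X ∪ T) q) (cong (λ A → sumOver A q) (∪-─-cancel λ k∈ → proj₂ (∈-─⁻ E T (X⊆ k∈))))))
               (⊖-≤⁻ (demY (X ∪ T) (∪-lub (λ k∈ → p─q⊆p E T (X⊆ k∈)) T⊆E))))))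
       , λ i i∈S eq → x∈p∧x∉q⇒x∈p─q
           (keep i (x∈p∪q⁺ (inj₁ i∈S)) (cong (λ x → if lookup T i then 0# else x) eq)) (proj₂ (∈-─⁻ E T (S⊆ i∈S)))
    where
    E = ground u
    value : ∀ {X} → X ⊆ E ─ T → val w X + val u T ≡ val u (X ∪ T)
    value {X} X⊆ = trans (cong (_+ val u T) (w≡ X X⊆)) (⊖-+ _ _)
    outwith-≤ : ∀ i → i ∈ E → outwith T p i ≤ outwith T q i
    outwith-≤ i i∈E with lookup T i in eq
    ... | true  = ≤-refl
    ... | false = p≤q i (x∈p∧x∉q⇒x∈p─q i∈E λ i∈T → contradiction (trans (sym eq) ([]=⇒lookup i∈T)) λ ())
    demanded : Demand u (outwith T p) (S ∪ T)
    demanded = ∪-lub (λ k∈ → p─q⊆p E T (S⊆ k∈)) T⊆E , λ X X⊆E →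
      let X─T⊆ : X ─ T ⊆ E ─ T
          X─T⊆ k∈ = let k∈X , k∉T = ∈-─⁻ X T k∈ in x∈p∧x∉q⇒x∈p─q (X⊆E k∈X) k∉T
      in ⊖-≤⁺ (linear
        (val u X ∷ val u (S ∪ T) ∷ val u ((X ─ T) ∪ T) ∷ val u T ∷ val w S ∷ val w (X ─ T)
         ∷ sumOver (S ∪ T) (outwith T p) ∷ sumOver S p ∷ sumOver X (outwith T p) ∷ sumOver (X ─ T) p ∷ [])
        (λ uX uS uX′ uT wS wX p′S pS p′X pX → (uX ≼ uX′) ∷ (uX′ ≼ wX ⊕ uT) ∷ (wS ⊕ uT ≼ uS) ∷ (wX ⊕ pS ≼ wS ⊕ pX)
          ∷ (p′S ≼ pS) ∷ (pX ≼ p′X) ∷ [] ⊢ uX ⊕ p′S ≼ uS ⊕ p′X) refl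
        (val-mono u _ _ (⊆-─-∪ X T) (∪-lub (λ k∈ → X⊆E (p─q⊆p X T k∈)) T⊆E))
        (≤-reflexive (sym (value X─T⊆))) (≤-reflexive (value S⊆)) (⊖-≤⁻ (demS (X ─ T) X─T⊆))
        (≤-reflexive (trans (sumOver-outwith T (S ∪ T) p) (cong (λ A → sumOver A p) (∪-─-cancel λ k∈ → proj₂ (∈-─⁻ E T (S⊆ k∈))))))
        (≤-reflexive (sym (sumOver-outwith T X p))))

  -- A merge gives every item to a valuation that has it in its ground set, while convolving the
  -- extensions also allows wasteful splits. Handing wasted items to the other side never lowers the
  -- value, by monotonicity.
  merge-extend : ∀ {n} (u₁ u₂ w : Valuation n) → IsMerge u₁ u₂ w → ∀ S → (extend u₁ ✶ extend u₂) S ≡ extend w S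
  merge-extend u₁ u₂ w (refl , isMax) S = antisym upper lower
    where
    E₁ = ground u₁
    E₂ = ground u₂
    S′ = S ∩ (E₁ ∪ E₂)
    lower : extend w S ≤ (extend u₁ ✶ extend u₂) S
    lower with proj₁ (isMax S′ (p∩q⊆q S _))
    ... | T , (T⊆ , rest⊆) , eq = ≤-trans (≤-reflexive (sym eq)) (≤-trans
      (+-mono₂ (≤-reflexive (sym (extend-⊆ u₁ (λ k∈ → p∩q⊆q S′ E₁ (T⊆ k∈)))))
               (val-mono u₂ _ _ (λ k∈ → let k∈S′ , k∉T = ∈-─⁻ S′ T k∈ in
                   x∈p∩q⁺ (x∈p∧x∉q⇒x∈p─q (p∩q⊆p S _ k∈S′) k∉T , rest⊆ k∈)) (p∩q⊆q (S ─ T) E₂)))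
      (✶-bound (extend u₁) (extend u₂) (λ k∈ → p∩q⊆p S _ (p∩q⊆p S′ E₁ (T⊆ k∈)))))
    upper : (extend u₁ ✶ extend u₂) S ≤ extend w S
    upper with ✶-attained (extend u₁) (extend u₂) S
    ... | T , T⊆S , eq = ≤-trans (≤-reflexive eq) (≤-trans
        (+-mono₂ (val-mono u₁ _ _ T⊆A (λ k∈ → p∩q⊆q S′ E₁ (A⊆ k∈)))
                 (val-mono u₂ _ _ rest⊆ rest⊆E₂))
        (proj₂ (isMax S′ (p∩q⊆q S _)) A (A⊆ , rest⊆E₂)))
      where
      -- u₁ also takes the items that u₂ was given without having them in its ground set
      A = (S′ ∩ E₁) ∩ (T ∪ ∁ E₂)
      A⊆ : A ⊆ S′ ∩ E₁
      A⊆ = p∩q⊆p (S′ ∩ E₁) _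
      T⊆A : T ∩ E₁ ⊆ A
      T⊆A k∈ = let k∈T , k∈E₁ = x∈p∩q⁻ T E₁ k∈ in
        x∈p∩q⁺ (x∈p∩q⁺ (x∈p∩q⁺ (T⊆S k∈T , x∈p∪q⁺ (inj₁ k∈E₁)) , k∈E₁) , x∈p∪q⁺ (inj₁ k∈T))
      rest⊆E₂ : S′ ─ A ⊆ E₂
      rest⊆E₂ {k} k∈ with k ∈? E₂ | ∈-─⁻ S′ A k∈
      ... | yes k∈E₂ | _ = k∈E₂
      ... | no k∉E₂ | k∈S′ , k∉A with x∈p∪q⁻ E₁ E₂ (p∩q⊆q S _ k∈S′)
      ... | inj₁ k∈E₁ = contradiction (x∈p∩q⁺ (x∈p∩q⁺ (k∈S′ , k∈E₁) , x∈p∪q⁺ (inj₂ (x∉p⇒x∈∁p k∉E₂)))) k∉A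
      ... | inj₂ k∈E₂ = k∈E₂
      rest⊆ : (S ─ T) ∩ E₂ ⊆ S′ ─ A
      rest⊆ {k} k∈ with x∈p∩q⁻ (S ─ T) E₂ k∈
      ... | k∈S─T , k∈E₂ with ∈-─⁻ S T k∈S─T
      ... | k∈S , k∉T = x∈p∧x∉q⇒x∈p─q (x∈p∩q⁺ (k∈S , x∈p∪q⁺ (inj₂ k∈E₂))) k∉A
        where
        k∉A : k ∉ A
        k∉A k∈A with x∈p∪q⁻ T (∁ E₂) (p∩q⊆q (S′ ∩ E₁) _ k∈A)
        ... | inj₁ k∈T   = k∉T k∈T
        ... | inj₂ k∈∁E₂ = x∈∁p⇒x∉p k∈∁E₂ k∈E₂

  merge-GS : ∀ {n} {u₁ u₂ w : Valuation n} → IsMerge u₁ u₂ w → IsGS u₁ → IsGS u₂ → IsGS w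
  merge-GS {n} {u₁} {u₂} {w} isMerge gs₁ gs₂ = GS⇒IsGS w
    (GS-cong (subsets n) (merge-extend u₁ u₂ w isMerge) (GS-✶ (IsGS⇒GS u₁ gs₁) (IsGS⇒GS u₂ gs₂)))

-- Symmetric exchange in matroids, and the inclusion of the generated class in gross substitutes.

module WeightedRanks (ℝ : CompleteOrderedField) where
  open CompleteOrderedField ℝ renaming (Carrier to R)
  open Valuations ℝ
  open OrderedField ℝ
  open Markets ℝ
  open GrossSubstitutes ℝ
  open Subsets

  module SymmetricExchange {n} (M : Matroid n) (indep? : ∀ S → Dec (Matroid.Indep M S)) where
    open Matroid M

    -- Repeated exchange; `k` bounds the number of items still to be added.
    augment : ∀ k A B → Indep A → Indep B → ∣ B ∣ ℕ.≤ k ℕ.+ ∣ A ∣ →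
      ∃ λ Y → Indep Y × A ⊆ Y × Y ⊆ A ∪ B × ∣ B ∣ ℕ.≤ ∣ Y ∣
    augment zero    A B iA iB le = A , iA , (λ x → x) , p⊆p∪q B , le
    augment (suc k) A B iA iB le with ∣ B ∣ ℕ.≤? ∣ A ∣
    ... | yes B≤A = A , iA , (λ x → x) , p⊆p∪q B , B≤A
    ... | no B≰A with exchange A B iA iB (ℕₚ.≰⇒> B≰A)
    ... | j , j∈B , j∉A , iA+j
      with augment k (A ⊞ j) B (subst Indep (sym (⊞≡∪⁅⁆ A j)) iA+j) iB
             (subst (∣ B ∣ ℕ.≤_) (sym (trans (cong (k ℕ.+_) (∣⊞∣ j j∉A)) (ℕₚ.+-suc k ∣ A ∣))) le)
    ... | Y , iY , A+j⊆Y , Y⊆ , B≤Y = Y , iY , (λ x → A+j⊆Y (∈-⊞⁺ j x))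
        , (λ x → ∪-lub (⊞-⊆ j (p⊆p∪q B) (q⊆p∪q A B j∈B)) (q⊆p∪q A B) (Y⊆ x)) , B≤Y

    -- Items are deleted while dependence persists. For independent `X` what remains, together with
    -- `i`, is the fundamental circuit of `i`.
    minimalSpanning : ∀ k X i → ∣ X ∣ ℕ.≤ k → ¬ Indep (X ⊞ i) →
      ∃ λ Y → Y ⊆ X × ¬ Indep (Y ⊞ i) × (∀ j → j ∈ Y → Indep (Y ⊟ j ⊞ i))
    minimalSpanning k X i X≤k dep with Finₚ.any? (λ j → (j ∈? X) ×-dec ¬? (indep? (X ⊟ j ⊞ i)))
    ... | no none = X , (λ x → x) , dep , λ j j∈X → decidable-stable (indep? _) λ ¬ind → none (j , j∈X , ¬ind)
    ... | yes (j , j∈X , dep′) with k | subst (ℕ._≤ k) (sym (∣⊟∣ j j∈X)) X≤k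
    ... | suc k | ℕ.s≤s le =
      let Y , Y⊆ , rest = minimalSpanning k (X ⊟ j) i le dep′ in Y , (λ y → proj₁ (∈-⊟⁻ j (Y⊆ y))) , rest

    -- If `J ⊞ i` is dependent, let `Y ⊞ i` be its circuit. Extend `Y` inside `Y ∪ I` to an
    -- independent `W` of size at least that of `I`; then `i` is not in `W`. Exchange from `I ⊟ i`
    -- into `W` yields `j` outside `I`, hence in `Y`, with `I ⊟ i ⊞ j` independent. Next extend
    -- `Y ⊟ j ⊞ i` by items of `J` to size at least that of `J`. The result cannot contain `j`, or
    -- it would contain the circuit, so by cardinality it is all of `J ⊞ i ⊟ j`.
    symmetricExchange : ∀ I J i → Indep I → Indep J → i ∈ I → i ∉ J →
      Indep (J ⊞ i) ⊎ ∃ λ j → j ∈ J × j ∉ I × Indep (I ⊟ i ⊞ j) × Indep (J ⊞ i ⊟ j)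
    symmetricExchange I J i iI iJ i∈I i∉J with indep? (J ⊞ i)
    ... | yes ind = inj₁ ind
    ... | no dep = inj₂ (j , Y⊆J (proj₁ (proj₂ found)) , proj₁ (proj₂ (proj₂ found))
                       , proj₂ (proj₂ (proj₂ found)) , indep-down X _ swapped⊆X iX)
      where
      circuit = minimalSpanning ∣ J ∣ J i ℕₚ.≤-refl dep
      Y = proj₁ circuit
      Y⊆J = proj₁ (proj₂ circuit)
      Y+i-dep = proj₁ (proj₂ (proj₂ circuit))
      Y-minimal = proj₂ (proj₂ (proj₂ circuit))

      found : ∃ λ j → j ∈ Y × j ∉ I × Indep (I ⊟ i ⊞ j)
      found with augment ∣ I ∣ Y I (indep-down J Y Y⊆J iJ) iI (ℕₚ.m≤m+n ∣ I ∣ ∣ Y ∣)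
      ... | W , iW , Y⊆W , W⊆ , I≤W
        with exchange (I ⊟ i) W (indep-down I _ (λ k∈ → proj₁ (∈-⊟⁻ i k∈)) iI) iW
               (subst (ℕ._≤ ∣ W ∣) (sym (∣⊟∣ i i∈I)) I≤W)
      ... | j , j∈W , j∉I-i , ind = j
          , [ (λ j∈Y → j∈Y) , (λ j∈I → contradiction j∈I j∉I) ]′ (x∈p∪q⁻ Y I (W⊆ j∈W))
          , j∉I , subst Indep (sym (⊞≡∪⁅⁆ (I ⊟ i) j)) ind
        where
        j∉I : j ∉ I
        j∉I j∈I = j∉I-i (∈-⊟⁺ i j∈I λ { refl → Y+i-dep (indep-down W _ (⊞-⊆ i Y⊆W j∈W) iW) })

      j = proj₁ found
      j∈Y = proj₁ (proj₂ found)
      extension = augment ∣ J ∣ (Y ⊟ j ⊞ i) J (Y-minimal j j∈Y) iJ (ℕₚ.m≤m+n ∣ J ∣ ∣ Y ⊟ j ⊞ i ∣)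
      X = proj₁ extension
      iX = proj₁ (proj₂ extension)
      Y-j+i⊆X = proj₁ (proj₂ (proj₂ extension))
      X⊆ = proj₁ (proj₂ (proj₂ (proj₂ extension)))
      J≤X = proj₂ (proj₂ (proj₂ (proj₂ extension)))

      j∉X : j ∉ X
      j∉X j∈X = Y+i-dep (indep-down X _ (⊞-⊆ i Y⊆X (Y-j+i⊆X (i∈S⊞i i))) iX)
        where
        Y⊆X : Y ⊆ X
        Y⊆X {k} k∈Y with k Finₚ.≟ j
        ... | yes refl = j∈X
        ... | no k≢j   = Y-j+i⊆X (∈-⊞⁺ i (∈-⊟⁺ j k∈Y k≢j))

      X⊆swapped : X ⊆ J ⊞ i ⊟ j
      X⊆swapped k∈X = ∈-⊟⁺ j
        (∪-lub (⊞-⊆ i (λ y → ∈-⊞⁺ i (Y⊆J (proj₁ (∈-⊟⁻ j y)))) (i∈S⊞i i)) (∈-⊞⁺ i) (X⊆ k∈X))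
        λ { refl → j∉X k∈X }

      ∣swapped∣ : ∣ J ⊞ i ⊟ j ∣ ≡ ∣ J ∣
      ∣swapped∣ = ℕₚ.suc-injective (trans (∣⊟∣ j (∈-⊞⁺ i (Y⊆J j∈Y))) (∣⊞∣ i i∉J))

      swapped⊆X : J ⊞ i ⊟ j ⊆ X
      swapped⊆X {k} k∈ with k ∈? X
      ... | yes k∈X = k∈X
      ... | no k∉X = contradiction
        (ℕₚ.<-≤-trans (subst (∣ X ∣ ℕ.<_) ∣swapped∣ (p⊂q⇒∣p∣<∣q∣ (X⊆swapped , k , k∈ , k∉X))) J≤X)
        (ℕₚ.<-irrefl refl)

  -- Symmetric exchange is applied to independent sets `I` and `J` attaining the values of `S` and
  -- `T`. It only moves weights between them, so the total is unchanged and the new sets bound the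
  -- new values from below.
  rank-exchange : ∀ {n} (M : Matroid n) w u → (∀ S → Dec (Matroid.Indep M S)) →
    IsWeightedRank M w u → Exchange (extend u)
  rank-exchange M w u indep? (refl , isMax) S T i i∈S i∉T =
    let I , iI , I⊆S , wI = attained S
        J , iJ , J⊆T , wJ = attained T
    in cases I J iI iJ I⊆S J⊆T wI wJ
    where
    open Matroid M
    open SymmetricExchange M indep?
    f = extend u
    bound : ∀ {I S} → Indep I → I ⊆ S → sumOver I w ≤ f S
    bound {I} {S} iI I⊆S = proj₂ (isMax (S ∩ E) (p∩q⊆q S E)) I (iI , λ k∈I → x∈p∩q⁺ (I⊆S k∈I , indep⊆E I iI k∈I))
    attained : ∀ S → ∃ λ I → Indep I × I ⊆ S × f S ≤ sumOver I w
    attained S = let I , (iI , I⊆) , eq = proj₁ (isMax (S ∩ E) (p∩q⊆q S E))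
                 in I , iI , (λ k∈I → p∩q⊆p S E (I⊆ k∈I)) , ≤-reflexive (sym eq)

    cases : ∀ I J → Indep I → Indep J → I ⊆ S → J ⊆ T → f S ≤ sumOver I w → f T ≤ sumOver J w →
      f S + f T ≤ f (S ⊟ i) + f (T ⊞ i) ⊎
      ∃ λ j → j ∈ T × j ∉ S × f S + f T ≤ f (S ⊟ i ⊞ j) + f (T ⊞ i ⊟ j)
    cases I J iI iJ I⊆S J⊆T wI wJ with i ∈? I
    ... | no i∉I = inj₁ (+-mono₂
      (≤-trans wI (bound iI λ k∈I → ∈-⊟⁺ i (I⊆S k∈I) λ { refl → i∉I k∈I }))
      (≤-trans wJ (bound iJ λ k∈J → ∈-⊞⁺ i (J⊆T k∈J))))
    ... | yes i∈I = swap (symmetricExchange I J i iI iJ i∈I i∉J)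
      where
      i∉J : i ∉ J
      i∉J i∈J = i∉T (J⊆T i∈J)
      ρ = f S ∷ f T ∷ sumOver I w ∷ sumOver J w ∷ sumOver (I ⊟ i) w ∷ sumOver (J ⊞ i) w ∷ w i ∷ []
      moved : Indep (J ⊞ i) → f S + f T ≤ sumOver (I ⊟ i) w + sumOver (J ⊞ i) w
      moved ind = linear ρ (λ fS fT I J I′ J′ wi → (fS ≼ I) ∷ (fT ≼ J) ∷ (I ≼ wi ⊕ I′) ∷ (wi ⊕ J ≼ J′) ∷ [] ⊢ fS ⊕ fT ≼ I′ ⊕ J′) refl
        wI wJ (≤-reflexive (sumOver-⊟ i w i∈I)) (≤-reflexive (sym (sumOver-⊞ i w i∉J)))
      swapped : ∀ j → j ∈ J → j ∉ I → f S + f T ≤ sumOver (I ⊟ i ⊞ j) w + sumOver (J ⊞ i ⊟ j) w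
      swapped j j∈J j∉I = linear
        (f S ∷ f T ∷ sumOver I w ∷ sumOver J w ∷ sumOver (I ⊟ i) w ∷ sumOver (J ⊞ i) w ∷ w i ∷ w j
         ∷ sumOver (I ⊟ i ⊞ j) w ∷ sumOver (J ⊞ i ⊟ j) w ∷ [])
        (λ fS fT I J I′ J′ wi wj I″ J″ → (fS ≼ I) ∷ (fT ≼ J) ∷ (I ≼ wi ⊕ I′) ∷ (wi ⊕ J ≼ J′) ∷ (wj ⊕ I′ ≼ I″) ∷ (J′ ≼ wj ⊕ J″) ∷ []
          ⊢ fS ⊕ fT ≼ I″ ⊕ J″) refl
        wI wJ (≤-reflexive (sumOver-⊟ i w i∈I)) (≤-reflexive (sym (sumOver-⊞ i w i∉J)))
        (≤-reflexive (sym (sumOver-⊞ j w λ j∈ → j∉I (proj₁ (∈-⊟⁻ i j∈)))))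
        (≤-reflexive (sumOver-⊟ j w (∈-⊞⁺ i j∈J)))
      I-i⊆ : I ⊟ i ⊆ S ⊟ i
      I-i⊆ k∈ = let k∈I , k≢i = ∈-⊟⁻ i k∈ in ∈-⊟⁺ i (I⊆S k∈I) k≢i
      J+i⊆ : J ⊞ i ⊆ T ⊞ i
      J+i⊆ = ⊞-⊆ i (λ k∈J → ∈-⊞⁺ i (J⊆T k∈J)) (i∈S⊞i i)
      swap : Indep (J ⊞ i) ⊎ (∃ λ j → j ∈ J × j ∉ I × Indep (I ⊟ i ⊞ j) × Indep (J ⊞ i ⊟ j)) →
        f S + f T ≤ f (S ⊟ i) + f (T ⊞ i) ⊎
        ∃ λ j → j ∈ T × j ∉ S × f S + f T ≤ f (S ⊟ i ⊞ j) + f (T ⊞ i ⊟ j)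
      swap (inj₁ iJ+i) = inj₁ (≤-trans (moved iJ+i)
        (+-mono₂ (bound (indep-down I _ (λ k∈ → proj₁ (∈-⊟⁻ i k∈)) iI) I-i⊆) (bound iJ+i J+i⊆)))
      swap (inj₂ (j , j∈J , j∉I , iI′ , iJ′)) with j ∈? S
      -- The item returned already belongs to `S`, so `I ⊟ i ⊞ j` still fits into `S ⊟ i`, and `S`
      -- and `T` need no exchange beyond moving `i`.
      ... | yes j∈S = inj₁ (≤-trans (swapped j j∈J j∉I)
        (+-mono₂ (bound iI′ (⊞-⊆ j I-i⊆ (∈-⊟⁺ i j∈S λ { refl → i∉J j∈J })))
                 (bound iJ′ λ k∈ → J+i⊆ (proj₁ (∈-⊟⁻ j k∈)))))
      ... | no j∉S = inj₂ (j , J⊆T j∈J , j∉S , ≤-trans (swapped j j∈J j∉I)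
        (+-mono₂ (bound iI′ (⊞-⊆ j (λ k∈ → ∈-⊞⁺ j (I-i⊆ k∈)) (i∈S⊞i j)))
                 (bound iJ′ λ k∈ → let k∈J+i , k≢j = ∈-⊟⁻ j k∈ in ∈-⊟⁺ j (J+i⊆ k∈J+i) k≢j)))

  -- Excluded middle holds up to double negation at each subset, and double negation commutes with
  -- finite conjunctions.
  ¬¬-decide-subsets : ∀ {n} (P : Subset n → Set) → ¬ ¬ (∀ S → Dec (P S))
  ¬¬-decide-subsets {zero}  P ¬dec = ¬dec λ { [] → no λ p → ¬dec λ { [] → yes p } }
  ¬¬-decide-subsets {suc n} P ¬dec =
    ¬¬-decide-subsets (λ S → P (true ∷ S)) λ t →
    ¬¬-decide-subsets (λ S → P (false ∷ S)) λ f →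
    ¬dec λ { (true ∷ S) → t S ; (false ∷ S) → f S }

  demand? : ∀ {n} (u : Valuation n) q T → Dec (Demand u q T)
  demand? u q T = (T ⊆? ground u) ×-dec
    map′ to from (¬? (anySubset? λ X → (X ⊆? ground u) ×-dec ¬? (le? X)))
    where
    Le : _ → Set
    Le X = val u X ⊖ sumOver X q ≤ val u T ⊖ sumOver T q
    le? : ∀ X → Dec (Le X)
    le? X = (val u X ⊖ sumOver X q) ≤? (val u T ⊖ sumOver T q)
    to : ¬ (∃ λ X → X ⊆ ground u × ¬ Le X) → ∀ X → X ⊆ ground u → Le X
    to none X X⊆E = decidable-stable (le? X) λ ¬le → none (X , X⊆E , ¬le)
    from : (∀ X → X ⊆ ground u → Le X) → ¬ (∃ λ X → X ⊆ ground u × ¬ Le X)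
    from all (X , X⊆E , ¬le) = ¬le (all X X⊆E)

  -- Independence need not be decidable, but the conclusion of gross substitutability is.
  rank-GS : ∀ {n} (M : Matroid n) w u → IsWeightedRank M w u → IsGS u
  rank-GS M w u isRank p q p≤q S dem = decidable-stable
    (anySubset? λ T → demand? u q T ×-dec Finₚ.all? λ i → (i ∈? S) →-dec ((p i ≟ q i) →-dec (i ∈? T)))
    λ none → ¬¬-decide-subsets (Matroid.Indep M) λ indep? → none
      (GS⇒IsGS u (exchange⇒GS (rank-exchange M w u indep? isRank)) p q p≤q S dem)

  MBV⇒GS : ∀ {n} {u : Valuation n} → MBVgen n u → IsGS u
  MBV⇒GS (rank M w _ u isRank)              = rank-GS M w u isRank
  MBV⇒GS (merge u₁ u₂ w mbv₁ mbv₂ isMerge)  = merge-GS {u₁ = u₁} {u₂} {w} isMerge (MBV⇒GS mbv₁) (MBV⇒GS mbv₂)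
  MBV⇒GS (endow u T w mbv T⊆E isEndow)      = endow-GS {u = u} {w} T⊆E isEndow (MBV⇒GS mbv)

-- Local inequalities extracted from gross substitutability by special prices.

module LocalExchange (ℝ : CompleteOrderedField) where
  open CompleteOrderedField ℝ renaming (Carrier to R)
  open Valuations ℝ
  open OrderedField ℝ
  open Markets ℝ
  open GrossSubstitutes ℝ
  open Subsets

  sumOver-nonneg : ∀ {m} (S : Subset m) {p : Fin m → R} → (∀ i → 0# ≤ p i) → 0# ≤ sumOver S p
  sumOver-nonneg []          p≥0 = ≤-refl
  sumOver-nonneg (false ∷ S) p≥0 = sumOver-nonneg S (λ i → p≥0 (fsuc i))
  sumOver-nonneg (true ∷ S) {p} p≥0 = linear (p fzero ∷ _ ∷ []) (λ a b → (𝟘 ≼ a) ∷ (𝟘 ≼ b) ∷ [] ⊢ 𝟘 ≼ a ⊕ b) refl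
    (p≥0 fzero) (sumOver-nonneg S (λ i → p≥0 (fsuc i)))

  module _ {n} {p : Fin n → R} (p≥0 : ∀ i → 0# ≤ p i) where

    pays₁ : ∀ {T i} → i ∈ T → p i ≤ sumOver T p
    pays₁ {T} {i} i∈T = linear (p i ∷ sumOver (T ⊟ i) p ∷ sumOver T p ∷ [])
      (λ a b c → (𝟘 ≼ b) ∷ (a ⊕ b ≼ c) ∷ [] ⊢ a ≼ c) refl
      (sumOver-nonneg (T ⊟ i) p≥0) (≤-reflexive (sym (sumOver-⊟ i p i∈T)))

    pays₂ : ∀ {T i j} → i ≢ j → i ∈ T → j ∈ T → p i + p j ≤ sumOver T p
    pays₂ {T} {i} {j} i≢j i∈T j∈T = linear (p i ∷ p j ∷ sumOver (T ⊟ j) p ∷ sumOver T p ∷ [])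
      (λ a b c d → (a ≼ c) ∷ (b ⊕ c ≼ d) ∷ [] ⊢ a ⊕ b ≼ d) refl
      (pays₁ (∈-⊟⁺ j i∈T i≢j)) (≤-reflexive (sym (sumOver-⊟ j p j∈T)))

    pays₃ : ∀ {T i j k} → i ≢ j → i ≢ k → j ≢ k → i ∈ T → j ∈ T → k ∈ T → p i + p j + p k ≤ sumOver T p
    pays₃ {T} {i} {j} {k} i≢j i≢k j≢k i∈T j∈T k∈T = linear (p i ∷ p j ∷ p k ∷ sumOver (T ⊟ k) p ∷ sumOver T p ∷ [])
      (λ a b c d e → (a ⊕ b ≼ d) ∷ (c ⊕ d ≼ e) ∷ [] ⊢ (a ⊕ b) ⊕ c ≼ e) refl
      (pays₂ i≢j (∈-⊟⁺ k i∈T i≢k) (∈-⊟⁺ k j∈T j≢k)) (≤-reflexive (sym (sumOver-⊟ k p k∈T)))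

  sumOver-zero : ∀ {n} (S : Subset n) {p} → (∀ k → k ∈ S → p k ≡ 0#) → sumOver S p ≡ 0#
  sumOver-zero []          p≡0 = refl
  sumOver-zero (false ∷ S) p≡0 = sumOver-zero S λ k k∈S → p≡0 (fsuc k) (there k∈S)
  sumOver-zero (true ∷ S)  p≡0 = trans (cong₂ _+_ (p≡0 fzero here) (sumOver-zero S λ k k∈S → p≡0 (fsuc k) (there k∈S)))
    (+-identityˡ 0#)

  -- S is free, i, j and k cost a, b and c, and everything else costs m (the first match counts).
  module Prices {n} (S : Subset n) (i j k : Fin n) (m : R) where

    price : R → R → R → Fin n → R
    price a b c x with x ∈? S | x Finₚ.≟ i | x Finₚ.≟ j | x Finₚ.≟ k
    ... | yes _ | _     | _     | _     = 0#
    ... | no _  | yes _ | _     | _     = a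
    ... | no _  | no _  | yes _ | _     = b
    ... | no _  | no _  | no _  | yes _ = c
    ... | no _  | no _  | no _  | no _  = m

    Outsider : Subset n → Set
    Outsider T = ∃ λ x → x ∈ T × x ∉ S × x ≢ i × x ≢ j × x ≢ k

    outsider? : ∀ T → Dec (Outsider T)
    outsider? T = Finₚ.any? λ x → (x ∈? T) ×-dec ¬? (x ∈? S) ×-dec ¬? (x Finₚ.≟ i) ×-dec ¬? (x Finₚ.≟ j) ×-dec ¬? (x Finₚ.≟ k)

    insiders : ∀ {T U} → ¬ Outsider T → S ⊆ U → (i ∈ T → i ∈ U) → (j ∈ T → j ∈ U) → (k ∈ T → k ∈ U) → T ⊆ U
    insiders {T} none S⊆U iU jU kU {x} x∈T with x ∈? S | x Finₚ.≟ i | x Finₚ.≟ j | x Finₚ.≟ k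
    ... | yes x∈S | _        | _        | _        = S⊆U x∈S
    ... | no _    | yes refl | _        | _        = iU x∈T
    ... | no _    | no _     | yes refl | _        = jU x∈T
    ... | no _    | no _     | no _     | yes refl = kU x∈T
    ... | no x∉S  | no x≢i   | no x≢j   | no x≢k   = contradiction (x , x∈T , x∉S , x≢i , x≢j , x≢k) none

    module _ {a b c : R} where

      price-S : ∀ x → x ∈ S → price a b c x ≡ 0#
      price-S x x∈S with x ∈? S | x Finₚ.≟ i | x Finₚ.≟ j | x Finₚ.≟ k
      ... | yes _  | _ | _ | _ = refl
      ... | no x∉S | _ | _ | _ = contradiction x∈S x∉S

      price-i : i ∉ S → price a b c i ≡ a
      price-i i∉S with i ∈? S | i Finₚ.≟ i | i Finₚ.≟ j | i Finₚ.≟ k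
      ... | yes i∈S | _      | _ | _ = contradiction i∈S i∉S
      ... | no _    | yes _  | _ | _ = refl
      ... | no _    | no i≢i | _ | _ = contradiction refl i≢i

      price-j : j ∉ S → i ≢ j → price a b c j ≡ b
      price-j j∉S i≢j with j ∈? S | j Finₚ.≟ i | j Finₚ.≟ j | j Finₚ.≟ k
      ... | yes j∈S | _       | _      | _ = contradiction j∈S j∉S
      ... | no _    | yes j≡i | _      | _ = contradiction (sym j≡i) i≢j
      ... | no _    | no _    | yes _  | _ = refl
      ... | no _    | no _    | no j≢j | _ = contradiction refl j≢j

      price-k : k ∉ S → i ≢ k → j ≢ k → price a b c k ≡ c
      price-k k∉S i≢k j≢k with k ∈? S | k Finₚ.≟ i | k Finₚ.≟ j | k Finₚ.≟ k
      ... | yes k∈S | _       | _       | _      = contradiction k∈S k∉S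
      ... | no _    | yes k≡i | _       | _      = contradiction (sym k≡i) i≢k
      ... | no _    | no _    | yes k≡j | _      = contradiction (sym k≡j) j≢k
      ... | no _    | no _    | no _    | yes _  = refl
      ... | no _    | no _    | no _    | no k≢k = contradiction refl k≢k

      price-outsider : ∀ x → x ∉ S → x ≢ i → x ≢ j → x ≢ k → price a b c x ≡ m
      price-outsider x x∉S x≢i x≢j x≢k with x ∈? S | x Finₚ.≟ i | x Finₚ.≟ j | x Finₚ.≟ k
      ... | yes x∈S | _       | _       | _       = contradiction x∈S x∉S
      ... | no _    | yes x≡i | _       | _       = contradiction x≡i x≢i
      ... | no _    | no _    | yes x≡j | _       = contradiction x≡j x≢j
      ... | no _    | no _    | no _    | yes x≡k = contradiction x≡k x≢k
      ... | no _    | no _    | no _    | no _    = refl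

      price-nonneg : 0# ≤ a → 0# ≤ b → 0# ≤ c → 0# ≤ m → ∀ x → 0# ≤ price a b c x
      price-nonneg a≥0 b≥0 c≥0 m≥0 x with x ∈? S | x Finₚ.≟ i | x Finₚ.≟ j | x Finₚ.≟ k
      ... | yes _ | _     | _     | _     = ≤-refl
      ... | no _  | yes _ | _     | _     = a≥0
      ... | no _  | no _  | yes _ | _     = b≥0
      ... | no _  | no _  | no _  | yes _ = c≥0
      ... | no _  | no _  | no _  | no _  = m≥0

    raise : ∀ {a a′} b c → a ≤ a′ → ∀ x → price a b c x ≤ price a′ b c x
    raise b c a≤a′ x with x ∈? S | x Finₚ.≟ i | x Finₚ.≟ j | x Finₚ.≟ k
    ... | yes _ | _     | _     | _     = ≤-refl
    ... | no _  | yes _ | _     | _     = a≤a′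
    ... | no _  | no _  | yes _ | _     = ≤-refl
    ... | no _  | no _  | no _  | yes _ = ≤-refl
    ... | no _  | no _  | no _  | no _  = ≤-refl

    module Costs (i∉S : i ∉ S) (j∉S : j ∉ S) (i≢j : i ≢ j) {a b c : R} (p≥0 : ∀ x → 0# ≤ price a b c x) where

      cost-ij : sumOver (S ⊞ i ⊞ j) (price a b c) ≡ b + (a + 0#)
      cost-ij = trans (sumOver-⊞ j _ λ j∈ → [ (λ j≡i → i≢j (sym j≡i)) , j∉S ]′ (∈-⊞⁻ i j∈))
        (cong₂ _+_ (price-j j∉S i≢j) (trans (sumOver-⊞ i _ i∉S) (cong₂ _+_ (price-i i∉S) (sumOver-zero S price-S))))

      module _ {T : Subset n} where
        private p = sumOver T (price a b c)

        pi : i ∈ T → a ≤ p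
        pi i∈T = subst (_≤ p) (price-i i∉S) (pays₁ p≥0 i∈T)

        pj : j ∈ T → b ≤ p
        pj j∈T = subst (_≤ p) (price-j j∉S i≢j) (pays₁ p≥0 j∈T)

        pij : i ∈ T → j ∈ T → a + b ≤ p
        pij i∈T j∈T = subst₂ (λ a b → a + b ≤ p) (price-i i∉S) (price-j j∉S i≢j) (pays₂ p≥0 i≢j i∈T j∈T)

        pm : Outsider T → m ≤ p
        pm (x , x∈T , x∉S , x≢i , x≢j , x≢k) =
          subst (_≤ p) (price-outsider x x∉S x≢i x≢j x≢k) (pays₁ p≥0 x∈T)

        module _ (k∉S : k ∉ S) (i≢k : i ≢ k) (j≢k : j ≢ k) where

          pk : k ∈ T → c ≤ p
          pk k∈T = subst (_≤ p) (price-k k∉S i≢k j≢k) (pays₁ p≥0 k∈T)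

          pik : i ∈ T → k ∈ T → a + c ≤ p
          pik i∈T k∈T = subst₂ (λ a c → a + c ≤ p) (price-i i∉S) (price-k k∉S i≢k j≢k) (pays₂ p≥0 i≢k i∈T k∈T)

          pjk : j ∈ T → k ∈ T → b + c ≤ p
          pjk j∈T k∈T = subst₂ (λ b c → b + c ≤ p) (price-j j∉S i≢j) (price-k k∉S i≢k j≢k) (pays₂ p≥0 j≢k j∈T k∈T)

          pijk : i ∈ T → j ∈ T → k ∈ T → a + b + c ≤ p
          pijk i∈T j∈T k∈T = subst (λ c → a + b + c ≤ p) (price-k k∉S i≢k j≢k)
            (subst₂ (λ x y → x + y + price a b c k ≤ p) (price-i i∉S) (price-j j∉S i≢j)
              (pays₃ p≥0 i≢j i≢k j≢k i∈T j∈T k∈T))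

  module _ {n} {f : Subset n → R} (f≥0 : ∀ S → 0# ≤ f S) (mono : ∀ {S T} → S ⊆ T → f S ≤ f T)
           (gs : GS (subsets n) f) where

    private
      below : ∀ {x y} z → z + x ≡ y → x ≤ y → 0# ≤ z
      below {x} {y} z eq = linear (x ∷ y ∷ z ∷ []) (λ x y z → (y ≼ z ⊕ x) ∷ (x ≼ y) ∷ [] ⊢ 𝟘 ≼ z) refl (≤-reflexive (sym eq))

    -- If the inequality fails, there are prices at which `S`, `S ⊞ i` and `S ⊞ i ⊞ j` are all
    -- optimal. When only the price of `i` rises, demand must keep `j` and has to give up `i`, so it
    -- is at best `S ⊞ j`; that this is no worse than the free set `S` is the inequality.
    submodular : ∀ S {i j} → i ∉ S → j ∉ S → i ≢ j → f (S ⊞ i ⊞ j) + f S ≤ f (S ⊞ i) + f (S ⊞ j)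
    submodular S {i} {j} i∉S j∉S i≢j with (f (S ⊞ i ⊞ j) + f S) ≤? (f (S ⊞ i) + f (S ⊞ j))
    ... | yes le = le
    ... | no ¬le = result
      where
      Si = S ⊞ i
      Sj = S ⊞ j
      Sij = S ⊞ i ⊞ j
      -- More than any bundle is worth, so a demanded bundle contains no outsider.
      m = f ⊤ + 1#
      a = f Si ⊖ f S
      b = f Sij ⊖ f Si
      a≡ : a + f S ≡ f Si
      a≡ = ⊖-+ _ _
      b≡ : b + f Si ≡ f Sij
      b≡ = ⊖-+ _ _
      a≥0 : 0# ≤ a
      a≥0 = below a a≡ (mono (∈-⊞⁺ i))
      b≥0 : 0# ≤ b
      b≥0 = below b b≡ (mono (∈-⊞⁺ j))
      m≥0 : 0# ≤ m
      m≥0 = linear (f ⊤ ∷ 1# ∷ []) (λ a b → (𝟘 ≼ a) ∷ (𝟘 ≼ b) ∷ [] ⊢ 𝟘 ≼ a ⊕ b) refl (f≥0 ⊤) 0≤1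
      a+1≥0 : 0# ≤ a + 1#
      a+1≥0 = linear (a ∷ 1# ∷ []) (λ a b → (𝟘 ≼ a) ∷ (𝟘 ≼ b) ∷ [] ⊢ 𝟘 ≼ a ⊕ b) refl a≥0 0≤1
      -- There is no third item: `k` is set to `j`, whose own price takes precedence.
      open Prices S i j j m
      p = price a b m
      q = price (a + 1#) b m
      p≥0 = price-nonneg {a} {b} {m} a≥0 b≥0 m≥0 m≥0
      q≥0 = price-nonneg {a + 1#} {b} {m} a+1≥0 b≥0 m≥0 m≥0
      module P = Costs i∉S j∉S i≢j {a} {b} {m} p≥0
      module Q = Costs i∉S j∉S i≢j {a + 1#} {b} {m} q≥0

      affordable : ∀ T → f T ≤ f S + sumOver T p
      affordable T with outsider? T
      ... | yes out =
        linear (f T ∷ f ⊤ ∷ f S ∷ sumOver T p ∷ 1# ∷ [])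
          (λ fT top fS pT o → (fT ≼ top) ∷ (𝟘 ≼ fS) ∷ (top ⊕ o ≼ pT) ∷ (𝟘 ≼ o) ∷ [] ⊢ fT ≼ fS ⊕ pT) refl
          (mono ⊆⊤) (f≥0 S) (P.pm out) 0≤1
      ... | no none with i ∈? T | j ∈? T
      ... | yes i∈T | yes j∈T =
        linear (f T ∷ f S ∷ f Si ∷ f Sij ∷ sumOver T p ∷ a ∷ b ∷ [])
          (λ fT fS fSi fSij pT a b → (fT ≼ fSij) ∷ (fSij ≼ b ⊕ fSi) ∷ (fSi ≼ a ⊕ fS) ∷ (a ⊕ b ≼ pT) ∷ [] ⊢ fT ≼ fS ⊕ pT) refl
          (mono (insiders none (λ x → ∈-⊞⁺ j (∈-⊞⁺ i x)) (λ _ → ∈-⊞⁺ j (i∈S⊞i i)) (λ _ → i∈S⊞i j) (λ _ → i∈S⊞i j)))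
          (≤-reflexive (sym b≡)) (≤-reflexive (sym a≡))
          (P.pij i∈T j∈T)
      ... | yes i∈T | no j∉T =
        linear (f T ∷ f S ∷ f Si ∷ sumOver T p ∷ a ∷ [])
          (λ fT fS fSi pT a → (fT ≼ fSi) ∷ (fSi ≼ a ⊕ fS) ∷ (a ≼ pT) ∷ [] ⊢ fT ≼ fS ⊕ pT) refl
          (mono (insiders none (∈-⊞⁺ i) (λ _ → i∈S⊞i i) (⊥-elim ∘ j∉T) (⊥-elim ∘ j∉T)))
          (≤-reflexive (sym a≡)) (P.pi i∈T)
      ... | no i∉T | yes j∈T =
        linear (f T ∷ f S ∷ f Si ∷ f Sj ∷ f Sij ∷ sumOver T p ∷ b ∷ [])
          (λ fT fS fSi fSj fSij pT b → (fT ≼ fSj) ∷ (fSij ≼ b ⊕ fSi) ∷ (b ≼ pT) ∷ (fSi ⊕ fSj ≼ fSij ⊕ fS) ∷ [] ⊢ fT ≼ fS ⊕ pT) refl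
          (mono (insiders none (∈-⊞⁺ j) (⊥-elim ∘ i∉T) (λ _ → i∈S⊞i j) (λ _ → i∈S⊞i j)))
          (≤-reflexive (sym b≡)) (P.pj j∈T) (≰⇒≥ ¬le)
      ... | no i∉T | no j∉T =
        linear (f T ∷ f S ∷ sumOver T p ∷ []) (λ fT fS pT → (fT ≼ fS) ∷ (𝟘 ≼ pT) ∷ [] ⊢ fT ≼ fS ⊕ pT) refl
          (mono (insiders none (λ x → x) (⊥-elim ∘ i∉T) (⊥-elim ∘ j∉T) (⊥-elim ∘ j∉T)))
          (sumOver-nonneg T p≥0)

      demanded : Demanded (subsets n) f p Sij
      demanded T = linear (f T ∷ f S ∷ f Si ∷ f Sij ∷ sumOver T p ∷ sumOver Sij p ∷ a ∷ b ∷ [])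
        (λ fT fS fSi fSij pT pSij a b → (fT ≼ fS ⊕ pT) ∷ (pSij ≼ b ⊕ (a ⊕ 𝟘)) ∷ (b ⊕ fSi ≼ fSij) ∷ (a ⊕ fS ≼ fSi) ∷ []
          ⊢ fT ⊕ pSij ≼ fSij ⊕ pT) refl
        (affordable T) (≤-reflexive P.cost-ij) (≤-reflexive b≡) (≤-reflexive a≡)

      result : f Sij + f S ≤ f Si + f Sj
      result with gs p q (raise b m (linear (a ∷ 1# ∷ []) (λ a o → (𝟘 ≼ o) ∷ [] ⊢ a ≼ a ⊕ o) refl 0≤1)) Sij demanded
      ... | T , demT , keep = cases
        where
        j∈T : j ∈ T
        j∈T = keep j (i∈S⊞i j) (trans (price-j j∉S i≢j) (sym (price-j j∉S i≢j)))
        optimal : f S + sumOver T q ≤ f T + 0#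
        optimal = subst (λ x → f S + sumOver T q ≤ f T + x) (sumOver-zero S price-S) (demT S)
        cases : f Sij + f S ≤ f Si + f Sj
        cases with outsider? T
        ... | yes out = contradiction
          (linear (f T ∷ f ⊤ ∷ f S ∷ sumOver T q ∷ 1# ∷ [])
            (λ fT top fS qT o → (fT ≼ top) ∷ (𝟘 ≼ fS) ∷ (top ⊕ o ≼ qT) ∷ (fS ⊕ qT ≼ fT ⊕ 𝟘) ∷ [] ⊢ o ≼ 𝟘) refl
            (mono ⊆⊤) (f≥0 S) (Q.pm out) optimal) 1≰0
        ... | no none with i ∈? T
        ... | yes i∈T = contradiction
          (linear (f T ∷ f S ∷ f Si ∷ f Sij ∷ sumOver T q ∷ a ∷ b ∷ 1# ∷ [])
            (λ fT fS fSi fSij qT a b o → (fT ≼ fSij) ∷ (fSij ≼ b ⊕ fSi) ∷ (fSi ≼ a ⊕ fS) ∷ ((a ⊕ o) ⊕ b ≼ qT) ∷ (fS ⊕ qT ≼ fT ⊕ 𝟘) ∷ []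
              ⊢ o ≼ 𝟘) refl
            (mono (insiders none (λ x → ∈-⊞⁺ j (∈-⊞⁺ i x)) (λ _ → ∈-⊞⁺ j (i∈S⊞i i)) (λ _ → i∈S⊞i j) (λ _ → i∈S⊞i j)))
            (≤-reflexive (sym b≡)) (≤-reflexive (sym a≡))
            (Q.pij i∈T j∈T) optimal) 1≰0
        ... | no i∉T =
          linear (f T ∷ f S ∷ f Si ∷ f Sj ∷ f Sij ∷ sumOver T q ∷ b ∷ [])
            (λ fT fS fSi fSj fSij qT b → (fT ≼ fSj) ∷ (fSij ≼ b ⊕ fSi) ∷ (b ≼ qT) ∷ (fS ⊕ qT ≼ fT ⊕ 𝟘) ∷ []
              ⊢ fSij ⊕ fS ≼ fSi ⊕ fSj) refl
            (mono (insiders none (∈-⊞⁺ j) (⊥-elim ∘ i∉T) (λ _ → i∈S⊞i j) (λ _ → i∈S⊞i j)))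
            (≤-reflexive (sym b≡)) (Q.pj j∈T) optimal

    -- The three-term, or tropical Plücker, relation: of the three ways to divide `i`, `j`, `k` over
    -- `S` into a pair and a single, the best value is attained at least twice.
    tripleExchange : ∀ S {i j k} → i ∉ S → j ∉ S → k ∉ S → i ≢ j → i ≢ k → j ≢ k →
      f (S ⊞ i ⊞ j) + f (S ⊞ k) ≤ f (S ⊞ i ⊞ k) + f (S ⊞ j) ⊎
      f (S ⊞ i ⊞ j) + f (S ⊞ k) ≤ f (S ⊞ j ⊞ k) + f (S ⊞ i)
    tripleExchange S {i} {j} {k} i∉S j∉S k∉S i≢j i≢k j≢k
      with (f (S ⊞ i ⊞ j) + f (S ⊞ k)) ≤? (f (S ⊞ i ⊞ k) + f (S ⊞ j))
         | (f (S ⊞ i ⊞ j) + f (S ⊞ k)) ≤? (f (S ⊞ j ⊞ k) + f (S ⊞ i))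
    ... | yes le | _      = inj₁ le
    ... | no _   | yes le = inj₂ le
    ... | no ¬le₁ | no ¬le₂ = result
      where
      Si = S ⊞ i
      Sj = S ⊞ j
      Sk = S ⊞ k
      Sij = S ⊞ i ⊞ j
      Sik = S ⊞ i ⊞ k
      Sjk = S ⊞ j ⊞ k
      Sijk = S ⊞ i ⊞ j ⊞ k
      sub₀ : f Sik + f S ≤ f Si + f Sk
      sub₀ = submodular S i∉S k∉S i≢k
      sub₁ : f Sijk + f Si ≤ f Sij + f Sik
      sub₁ = submodular Si (λ j∈ → [ (λ j≡i → i≢j (sym j≡i)) , j∉S ]′ (∈-⊞⁻ i j∈))
                           (λ k∈ → [ (λ k≡i → i≢k (sym k≡i)) , k∉S ]′ (∈-⊞⁻ i k∈)) j≢k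
      -- Prices at which `Si`, `Sk`, `Sij` and `Sik` all have utility `f Si - a`. Failure of both
      -- alternatives keeps `Sj` and `Sjk` from doing better, so `Sij` is demanded.
      a = f Sik ⊖ f Sk
      b = f Sij ⊖ f Si
      c = f Sik ⊖ f Si
      -- The bundles compared with are no longer free, `Si` costing `a` and `Sk` costing `c`; the
      -- prohibitive price makes up for both.
      m = f ⊤ + (a + (c + 1#))
      a≡ : a + f Sk ≡ f Sik
      a≡ = ⊖-+ _ _
      b≡ : b + f Si ≡ f Sij
      b≡ = ⊖-+ _ _
      c≡ : c + f Si ≡ f Sik
      c≡ = ⊖-+ _ _
      a≥0 : 0# ≤ a
      a≥0 = below a a≡ (mono (⊞-⊆ k (λ x → ∈-⊞⁺ k (∈-⊞⁺ i x)) (i∈S⊞i k)))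
      b≥0 : 0# ≤ b
      b≥0 = below b b≡ (mono (∈-⊞⁺ j))
      c≥0 : 0# ≤ c
      c≥0 = below c c≡ (mono (∈-⊞⁺ k))
      a+1≥0 : 0# ≤ a + 1#
      a+1≥0 = linear (a ∷ 1# ∷ []) (λ a o → (𝟘 ≼ a) ∷ (𝟘 ≼ o) ∷ [] ⊢ 𝟘 ≼ a ⊕ o) refl a≥0 0≤1
      m≥0 : 0# ≤ m
      m≥0 = linear (f ⊤ ∷ a ∷ c ∷ 1# ∷ [])
        (λ t a c o → (𝟘 ≼ t) ∷ (𝟘 ≼ a) ∷ (𝟘 ≼ c) ∷ (𝟘 ≼ o) ∷ [] ⊢ 𝟘 ≼ t ⊕ (a ⊕ (c ⊕ o))) refl
        (f≥0 ⊤) a≥0 c≥0 0≤1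
      open Prices S i j k m
      p = price a b c
      q = price (a + 1#) b c
      p≥0 = price-nonneg {a} {b} {c} a≥0 b≥0 c≥0 m≥0
      q≥0 = price-nonneg {a + 1#} {b} {c} a+1≥0 b≥0 c≥0 m≥0

      module P = Costs i∉S j∉S i≢j {a} {b} {c} p≥0
      module Q = Costs i∉S j∉S i≢j {a + 1#} {b} {c} q≥0

      i⊆ : ∀ {T} → ¬ Outsider T → j ∉ T → k ∉ T → f T ≤ f Si
      i⊆ none j∉T k∉T = mono (insiders none (∈-⊞⁺ i) (λ _ → i∈S⊞i i) (⊥-elim ∘ j∉T) (⊥-elim ∘ k∉T))
      j⊆ : ∀ {T} → ¬ Outsider T → i ∉ T → k ∉ T → f T ≤ f Sj
      j⊆ none i∉T k∉T = mono (insiders none (∈-⊞⁺ j) (⊥-elim ∘ i∉T) (λ _ → i∈S⊞i j) (⊥-elim ∘ k∉T))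
      k⊆ : ∀ {T} → ¬ Outsider T → i ∉ T → j ∉ T → f T ≤ f Sk
      k⊆ none i∉T j∉T = mono (insiders none (∈-⊞⁺ k) (⊥-elim ∘ i∉T) (⊥-elim ∘ j∉T) (λ _ → i∈S⊞i k))
      ij⊆ : ∀ {T} → ¬ Outsider T → k ∉ T → f T ≤ f Sij
      ij⊆ none k∉T = mono (insiders none (λ x → ∈-⊞⁺ j (∈-⊞⁺ i x)) (λ _ → ∈-⊞⁺ j (i∈S⊞i i)) (λ _ → i∈S⊞i j) (⊥-elim ∘ k∉T))
      ik⊆ : ∀ {T} → ¬ Outsider T → j ∉ T → f T ≤ f Sik
      ik⊆ none j∉T = mono (insiders none (λ x → ∈-⊞⁺ k (∈-⊞⁺ i x)) (λ _ → ∈-⊞⁺ k (i∈S⊞i i)) (⊥-elim ∘ j∉T) (λ _ → i∈S⊞i k))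
      jk⊆ : ∀ {T} → ¬ Outsider T → i ∉ T → f T ≤ f Sjk
      jk⊆ none i∉T = mono (insiders none (λ x → ∈-⊞⁺ k (∈-⊞⁺ j x)) (⊥-elim ∘ i∉T) (λ _ → ∈-⊞⁺ k (i∈S⊞i j)) (λ _ → i∈S⊞i k))
      ijk⊆ : ∀ {T} → ¬ Outsider T → f T ≤ f Sijk
      ijk⊆ none = mono (insiders none (λ x → ∈-⊞⁺ k (∈-⊞⁺ j (∈-⊞⁺ i x))) (λ _ → ∈-⊞⁺ k (∈-⊞⁺ j (i∈S⊞i i)))
        (λ _ → ∈-⊞⁺ k (i∈S⊞i j)) (λ _ → i∈S⊞i k))

      affordable : ∀ T → f T + a ≤ f Si + sumOver T p
      affordable T with outsider? T
      ... | yes out = linear (f T ∷ f ⊤ ∷ f Si ∷ sumOver T p ∷ a ∷ c ∷ 1# ∷ [])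
          (λ fT t fSi pT a c o → (fT ≼ t) ∷ (𝟘 ≼ fSi) ∷ (t ⊕ (a ⊕ (c ⊕ o)) ≼ pT) ∷ (𝟘 ≼ c) ∷ (𝟘 ≼ o) ∷ [] ⊢ fT ⊕ a ≼ fSi ⊕ pT) refl
          (mono ⊆⊤) (f≥0 Si) (P.pm out) c≥0 0≤1
      ... | no none with i ∈? T | j ∈? T | k ∈? T
      ... | no i∉T | no j∉T | no k∉T = linear (f T ∷ f S ∷ f Si ∷ f Sk ∷ f Sik ∷ sumOver T p ∷ a ∷ [])
          (λ fT fS fSi fSk fSik pT a → (fT ≼ fS) ∷ (a ⊕ fSk ≼ fSik) ∷ (fSik ⊕ fS ≼ fSi ⊕ fSk) ∷ (𝟘 ≼ pT) ∷ [] ⊢ fT ⊕ a ≼ fSi ⊕ pT) refl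
          (mono (insiders none (λ x → x) (⊥-elim ∘ i∉T) (⊥-elim ∘ j∉T) (⊥-elim ∘ k∉T)))
          (≤-reflexive a≡) sub₀ (sumOver-nonneg T p≥0)
      ... | yes i∈T | no j∉T | no k∉T = linear (f T ∷ f Si ∷ sumOver T p ∷ a ∷ [])
          (λ fT fSi pT a → (fT ≼ fSi) ∷ (a ≼ pT) ∷ [] ⊢ fT ⊕ a ≼ fSi ⊕ pT) refl
          (i⊆ none j∉T k∉T) (P.pi i∈T)
      ... | no i∉T | yes j∈T | no k∉T = linear (f T ∷ f Si ∷ f Sj ∷ f Sk ∷ f Sij ∷ f Sik ∷ sumOver T p ∷ a ∷ b ∷ [])
          (λ fT fSi fSj fSk fSij fSik pT a b → (fT ≼ fSj) ∷ (a ⊕ fSk ≼ fSik) ∷ (fSij ≼ b ⊕ fSi) ∷ (fSik ⊕ fSj ≼ fSij ⊕ fSk) ∷ (b ≼ pT) ∷ []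
            ⊢ fT ⊕ a ≼ fSi ⊕ pT) refl
          (j⊆ none i∉T k∉T) (≤-reflexive a≡) (≤-reflexive (sym b≡)) (≰⇒≥ ¬le₁) (P.pj j∈T)
      ... | no i∉T | no j∉T | yes k∈T = linear (f T ∷ f Si ∷ f Sk ∷ f Sik ∷ sumOver T p ∷ a ∷ c ∷ [])
          (λ fT fSi fSk fSik pT a c → (fT ≼ fSk) ∷ (a ⊕ fSk ≼ fSik) ∷ (fSik ≼ c ⊕ fSi) ∷ (c ≼ pT) ∷ [] ⊢ fT ⊕ a ≼ fSi ⊕ pT) refl
          (k⊆ none i∉T j∉T) (≤-reflexive a≡) (≤-reflexive (sym c≡)) (P.pk k∉S i≢k j≢k k∈T)
      ... | yes i∈T | yes j∈T | no k∉T = linear (f T ∷ f Si ∷ f Sij ∷ sumOver T p ∷ a ∷ b ∷ [])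
          (λ fT fSi fSij pT a b → (fT ≼ fSij) ∷ (fSij ≼ b ⊕ fSi) ∷ (a ⊕ b ≼ pT) ∷ [] ⊢ fT ⊕ a ≼ fSi ⊕ pT) refl
          (ij⊆ none k∉T) (≤-reflexive (sym b≡)) (P.pij i∈T j∈T)
      ... | yes i∈T | no j∉T | yes k∈T = linear (f T ∷ f Si ∷ f Sik ∷ sumOver T p ∷ a ∷ c ∷ [])
          (λ fT fSi fSik pT a c → (fT ≼ fSik) ∷ (fSik ≼ c ⊕ fSi) ∷ (a ⊕ c ≼ pT) ∷ [] ⊢ fT ⊕ a ≼ fSi ⊕ pT) refl
          (ik⊆ none j∉T) (≤-reflexive (sym c≡)) (P.pik k∉S i≢k j≢k i∈T k∈T)
      ... | no i∉T | yes j∈T | yes k∈T = linear (f T ∷ f Si ∷ f Sk ∷ f Sij ∷ f Sik ∷ f Sjk ∷ sumOver T p ∷ a ∷ b ∷ c ∷ [])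
          (λ fT fSi fSk fSij fSik fSjk pT a b c → (fT ≼ fSjk) ∷ (a ⊕ fSk ≼ fSik) ∷ (fSij ≼ b ⊕ fSi) ∷ (fSik ≼ c ⊕ fSi)
            ∷ (fSjk ⊕ fSi ≼ fSij ⊕ fSk) ∷ (b ⊕ c ≼ pT) ∷ [] ⊢ fT ⊕ a ≼ fSi ⊕ pT) refl
          (jk⊆ none i∉T) (≤-reflexive a≡) (≤-reflexive (sym b≡)) (≤-reflexive (sym c≡)) (≰⇒≥ ¬le₂) (P.pjk k∉S i≢k j≢k j∈T k∈T)
      ... | yes i∈T | yes j∈T | yes k∈T = linear (f T ∷ f Si ∷ f Sij ∷ f Sik ∷ f Sijk ∷ sumOver T p ∷ a ∷ b ∷ c ∷ [])
          (λ fT fSi fSij fSik fSijk pT a b c → (fT ≼ fSijk) ∷ (fSij ≼ b ⊕ fSi) ∷ (fSik ≼ c ⊕ fSi)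
            ∷ (fSijk ⊕ fSi ≼ fSij ⊕ fSik) ∷ ((a ⊕ b) ⊕ c ≼ pT) ∷ [] ⊢ fT ⊕ a ≼ fSi ⊕ pT) refl
          (ijk⊆ none) (≤-reflexive (sym b≡)) (≤-reflexive (sym c≡)) sub₁ (P.pijk k∉S i≢k j≢k i∈T j∈T k∈T)

      demanded : Demanded (subsets n) f p Sij
      demanded T = linear (f T ∷ f Si ∷ f Sij ∷ sumOver T p ∷ sumOver Sij p ∷ a ∷ b ∷ [])
        (λ fT fSi fSij pT pSij a b → (fT ⊕ a ≼ fSi ⊕ pT) ∷ (pSij ≼ b ⊕ (a ⊕ 𝟘)) ∷ (b ⊕ fSi ≼ fSij) ∷ []
          ⊢ fT ⊕ pSij ≼ fSij ⊕ pT) refl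
        (affordable T) (≤-reflexive P.cost-ij) (≤-reflexive b≡)

      -- {k} stays optimal when the price of i rises, so some bundle containing j matches it.
      result : f Sij + f Sk ≤ f Sik + f Sj ⊎ f Sij + f Sk ≤ f Sjk + f Si
      result with gs p q (raise b c (linear (a ∷ 1# ∷ []) (λ a o → (𝟘 ≼ o) ∷ [] ⊢ a ≼ a ⊕ o) refl 0≤1)) Sij demanded
      ... | T , demT , keep = cases
        where
        j∈T : j ∈ T
        j∈T = keep j (i∈S⊞i j) (trans (price-j j∉S i≢j) (sym (price-j j∉S i≢j)))
        optimal : f Sk + sumOver T q ≤ f T + (c + 0#)
        optimal = subst (λ x → f Sk + sumOver T q ≤ f T + x)
          (trans (sumOver-⊞ k q k∉S) (cong₂ _+_ (price-k k∉S i≢k j≢k) (sumOver-zero S price-S))) (demT Sk)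
        cases : f Sij + f Sk ≤ f Sik + f Sj ⊎ f Sij + f Sk ≤ f Sjk + f Si
        cases with outsider? T
        ... | yes out = contradiction
          (linear (f T ∷ f ⊤ ∷ f Sk ∷ sumOver T q ∷ a ∷ c ∷ 1# ∷ [])
            (λ fT t fSk qT a c o → (fT ≼ t) ∷ (𝟘 ≼ fSk) ∷ (t ⊕ (a ⊕ (c ⊕ o)) ≼ qT) ∷ (𝟘 ≼ a) ∷ (fSk ⊕ qT ≼ fT ⊕ (c ⊕ 𝟘)) ∷ []
              ⊢ o ≼ 𝟘) refl
            (mono ⊆⊤) (f≥0 Sk) (Q.pm out) a≥0 optimal) 1≰0
        ... | no none with i ∈? T | k ∈? T
        ... | yes i∈T | no k∉T = contradiction
          (linear (f T ∷ f Si ∷ f Sk ∷ f Sij ∷ f Sik ∷ sumOver T q ∷ a ∷ b ∷ c ∷ 1# ∷ [])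
            (λ fT fSi fSk fSij fSik qT a b c o → (fT ≼ fSij) ∷ (fSij ≼ b ⊕ fSi) ∷ (fSik ≼ a ⊕ fSk) ∷ (c ⊕ fSi ≼ fSik)
              ∷ ((a ⊕ o) ⊕ b ≼ qT) ∷ (fSk ⊕ qT ≼ fT ⊕ (c ⊕ 𝟘)) ∷ [] ⊢ o ≼ 𝟘) refl
            (ij⊆ none k∉T) (≤-reflexive (sym b≡)) (≤-reflexive (sym a≡)) (≤-reflexive c≡) (Q.pij i∈T j∈T) optimal) 1≰0
        ... | yes i∈T | yes k∈T = contradiction
          (linear (f T ∷ f Si ∷ f Sk ∷ f Sij ∷ f Sik ∷ f Sijk ∷ sumOver T q ∷ a ∷ b ∷ c ∷ 1# ∷ [])
            (λ fT fSi fSk fSij fSik fSijk qT a b c o → (fT ≼ fSijk) ∷ (fSij ≼ b ⊕ fSi) ∷ (fSik ≼ a ⊕ fSk)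
              ∷ (fSijk ⊕ fSi ≼ fSij ⊕ fSik) ∷ (((a ⊕ o) ⊕ b) ⊕ c ≼ qT) ∷ (fSk ⊕ qT ≼ fT ⊕ (c ⊕ 𝟘)) ∷ [] ⊢ o ≼ 𝟘) refl
            (ijk⊆ none) (≤-reflexive (sym b≡)) (≤-reflexive (sym a≡)) sub₁ (Q.pijk k∉S i≢k j≢k i∈T j∈T k∈T) optimal) 1≰0
        ... | no i∉T | no k∉T = inj₁
          (linear (f T ∷ f Si ∷ f Sj ∷ f Sk ∷ f Sij ∷ f Sik ∷ sumOver T q ∷ b ∷ c ∷ [])
            (λ fT fSi fSj fSk fSij fSik qT b c → (fT ≼ fSj) ∷ (fSij ≼ b ⊕ fSi) ∷ (c ⊕ fSi ≼ fSik) ∷ (b ≼ qT) ∷ (fSk ⊕ qT ≼ fT ⊕ (c ⊕ 𝟘)) ∷ []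
              ⊢ fSij ⊕ fSk ≼ fSik ⊕ fSj) refl
            (j⊆ none i∉T k∉T) (≤-reflexive (sym b≡)) (≤-reflexive c≡) (Q.pj j∈T) optimal)
        ... | no i∉T | yes k∈T = inj₂
          (linear (f T ∷ f Si ∷ f Sk ∷ f Sij ∷ f Sjk ∷ sumOver T q ∷ b ∷ c ∷ [])
            (λ fT fSi fSk fSij fSjk qT b c → (fT ≼ fSjk) ∷ (fSij ≼ b ⊕ fSi) ∷ (b ⊕ c ≼ qT) ∷ (fSk ⊕ qT ≼ fT ⊕ (c ⊕ 𝟘)) ∷ []
              ⊢ fSij ⊕ fSk ≼ fSjk ⊕ fSi) refl
            (jk⊆ none i∉T) (≤-reflexive (sym b≡)) (Q.pjk k∉S i≢k j≢k j∈T k∈T) optimal)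

-- At most three items: gross substitutes valuations as optimal assignments.

module UnitDemand (ℝ : CompleteOrderedField) where
  open CompleteOrderedField ℝ renaming (Carrier to R)
  open Valuations ℝ
  open OrderedField ℝ
  open Markets ℝ
  open GrossSubstitutes ℝ
  open LocalExchange ℝ
  open Subsets

  unit : ∀ {n} → (Fin n → R) → Subset n → R
  unit w []          = 0#
  unit w (false ∷ S) = unit (λ i → w (fsuc i)) S
  unit w (true ∷ S)  = w fzero ⊔ unit (λ i → w (fsuc i)) S

  unit-bound : ∀ {n} (w : Fin n → R) {S i} → i ∈ S → w i ≤ unit w S
  unit-bound w {true ∷ S}  here        = x≤x⊔y _ _
  unit-bound w {true ∷ S}  (there i∈S) = ≤-trans (unit-bound (λ i → w (fsuc i)) i∈S) (y≤x⊔y _ _)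
  unit-bound w {false ∷ S} (there i∈S) = unit-bound (λ i → w (fsuc i)) i∈S

  unit-nonneg : ∀ {n} (w : Fin n → R) S → 0# ≤ unit w S
  unit-nonneg w []          = ≤-refl
  unit-nonneg w (false ∷ S) = unit-nonneg (λ i → w (fsuc i)) S
  unit-nonneg w (true ∷ S)  = ≤-trans (unit-nonneg (λ i → w (fsuc i)) S) (y≤x⊔y _ _)

  unit-attained : ∀ {n} (w : Fin n → R) S → unit w S ≡ 0# ⊎ ∃ λ i → i ∈ S × unit w S ≡ w i
  unit-attained w []          = inj₁ refl
  unit-attained w (false ∷ S) with unit-attained (λ i → w (fsuc i)) S
  ... | inj₁ eq             = inj₁ eq
  ... | inj₂ (i , i∈S , eq) = inj₂ (fsuc i , there i∈S , eq)
  unit-attained w (true ∷ S) with ⊔-sel (w fzero) (unit (λ i → w (fsuc i)) S)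
  ... | inj₁ sel = inj₂ (fzero , here , sel)
  ... | inj₂ sel with unit-attained (λ i → w (fsuc i)) S
  ... | inj₁ eq             = inj₁ (trans sel eq)
  ... | inj₂ (i , i∈S , eq) = inj₂ (fsuc i , there i∈S , trans sel eq)

  unit-mono : ∀ {n} (w : Fin n → R) {S T} → S ⊆ T → unit w S ≤ unit w T
  unit-mono w {S} {T} S⊆T with unit-attained w S
  ... | inj₁ eq             = subst (_≤ unit w T) (sym eq) (unit-nonneg w T)
  ... | inj₂ (i , i∈S , eq) = subst (_≤ unit w T) (sym eq) (unit-bound w (S⊆T i∈S))

  unit-⊥ : ∀ {n} (w : Fin n → R) → unit w ⊥ ≡ 0#
  unit-⊥ w with unit-attained w ⊥
  ... | inj₁ eq           = eq
  ... | inj₂ (i , i∈⊥ , _) = contradiction i∈⊥ ∉⊥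

  ∣S∣≡0⇒∉ : ∀ {n} {S : Subset n} {k} → ∣ S ∣ ≡ 0 → k ∉ S
  ∣S∣≡0⇒∉ {k = k} eq k∈S = contradiction (trans (∣⊟∣ k k∈S) eq) λ ()

  sumOver-⊥ : ∀ {n} (w : Fin n → R) → sumOver ⊥ w ≡ 0#
  sumOver-⊥ w = sumOver-zero ⊥ {w} λ k k∈⊥ → contradiction k∈⊥ ∉⊥

  rankOne : ∀ {n} → Subset n → Matroid n
  rankOne {n} E = record
    { E = E ; Indep = λ I → I ⊆ E × ∣ I ∣ ℕ.≤ 1
    ; indep⊆E = λ I ind → proj₁ ind
    ; indep-∅ = ⊥⊆ , subst (ℕ._≤ 1) (sym (∣⊥∣≡0 n)) ℕ.z≤n
    ; indep-down = λ I J J⊆I ind → (λ k∈J → proj₁ ind (J⊆I k∈J)) , ℕₚ.≤-trans (p⊆q⇒∣p∣≤∣q∣ J⊆I) (proj₂ ind)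
    ; exchange = exchange }
    where
    exchange : ∀ I J → I ⊆ E × ∣ I ∣ ℕ.≤ 1 → J ⊆ E × ∣ J ∣ ℕ.≤ 1 → ∣ I ∣ ℕ.< ∣ J ∣ →
      ∃ λ j → j ∈ J × ¬ (j ∈ I) × (I ∪ ⁅ j ⁆ ⊆ E × ∣ I ∪ ⁅ j ⁆ ∣ ℕ.≤ 1)
    exchange I J (I⊆E , _) (J⊆E , J≤1) I<J with nonempty? J
    ... | no empty = contradiction (subst (∣ I ∣ ℕ.<_) (trans (cong ∣_∣ (Empty-unique empty)) (∣⊥∣≡0 n)) I<J) λ ()
    ... | yes (j , j∈J) = j , j∈J , j∉I
        , subst (λ S → S ⊆ E × ∣ S ∣ ℕ.≤ 1) (⊞≡∪⁅⁆ I j)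
            (⊞-⊆ j I⊆E (J⊆E j∈J) , subst (ℕ._≤ 1) (sym (∣⊞∣ j j∉I)) (ℕₚ.≤-trans I<J J≤1))
      where
      j∉I : j ∉ I
      j∉I = ∣S∣≡0⇒∉ (ℕₚ.n≤0⇒n≡0 (ℕ.s≤s⁻¹ (ℕₚ.≤-trans I<J J≤1)))

  unitDemand : ∀ {n} → Subset n → (Fin n → R) → Valuation n
  unitDemand E w = record
    { ground = E ; val = unit w ; val-∅ = unit-⊥ w
    ; val-nonneg = λ S _ → unit-nonneg w S
    ; val-mono = λ S T S⊆T _ → unit-mono w S⊆T }

  unitDemand-MBV : ∀ {n} E (w : Fin n → R) → (∀ i → 0# ≤ w i) → MBVgen n (unitDemand E w)
  unitDemand-MBV {n} E w w≥0 = rank (rankOne E) w (λ i _ → w≥0 i) _ (refl , λ T T⊆E → attained T T⊆E , bound T)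
    where
    attained : ∀ T → T ⊆ E → ∃ λ I → ((I ⊆ E × ∣ I ∣ ℕ.≤ 1) × I ⊆ T) × sumOver I w ≡ unit w T
    attained T T⊆E with unit-attained w T
    ... | inj₁ eq = ⊥ , (Matroid.indep-∅ (rankOne E) , ⊥⊆) , trans (sumOver-⊥ w) (sym eq)
    ... | inj₂ (i , i∈T , eq) = ⊥ ⊞ i
        , ((⊞-⊆ i ⊥⊆ (T⊆E i∈T) , ℕₚ.≤-reflexive (trans (∣⊞∣ i ∉⊥) (cong suc (∣⊥∣≡0 n)))) , ⊞-⊆ i ⊥⊆ i∈T)
        , trans (sumOver-⊞ i w ∉⊥) (trans (cong (w i +_) (sumOver-⊥ w)) (trans (+-identityʳ _) (sym eq)))
    bound : ∀ T I → (I ⊆ E × ∣ I ∣ ℕ.≤ 1) × I ⊆ T → sumOver I w ≤ unit w T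
    bound T I ((_ , I≤1) , I⊆T) with nonempty? I
    ... | no empty = subst (_≤ unit w T) (sym (trans (cong (λ S → sumOver S w) (Empty-unique empty)) (sumOver-⊥ w))) (unit-nonneg w T)
    ... | yes (i , i∈I) = subst (_≤ unit w T) (sym single) (unit-bound w (I⊆T i∈I))
      where
      single : sumOver I w ≡ w i
      single = trans (sumOver-⊟ i w i∈I) (trans (cong (w i +_) (sumOver-zero (I ⊟ i) λ k k∈ → contradiction k∈
        (∣S∣≡0⇒∉ (ℕₚ.n≤0⇒n≡0 (ℕ.s≤s⁻¹ (subst (ℕ._≤ 1) (sym (∣⊟∣ i i∈I)) I≤1)))))) (+-identityʳ _))

  convolution : ∀ {n} (u v : Valuation n) → (∀ S → 0# ≤ val v S) → (∀ {S T} → S ⊆ T → val v S ≤ val v T) → Valuation n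
  convolution u v v≥0 v-mono = record
    { ground = ground u ; val = val u ✶ val v
    ; val-∅ = empty
    ; val-nonneg = λ S _ → nonneg S
    ; val-mono = λ S T S⊆T _ → mono S⊆T }
    where
    empty : (val u ✶ val v) ⊥ ≡ 0#
    empty with ✶-attained (val u) (val v) ⊥
    ... | T , T⊆⊥ , eq with ⊆-antisym T⊆⊥ ⊥⊆
    ... | refl = trans eq (trans (cong₂ _+_ (val-∅ u) (trans (cong (val v) (p─⊥≡p ⊥)) (val-∅ v))) (+-identityˡ 0#))
    nonneg : ∀ S → 0# ≤ (val u ✶ val v) S
    nonneg S = ≤-trans (subst (0# ≤_) (sym (trans (cong (_+ val v (S ─ ⊥)) (val-∅ u)) (+-identityˡ _))) (v≥0 (S ─ ⊥)))
      (✶-bound (val u) (val v) {S} {⊥} ⊥⊆)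
    mono : ∀ {S T} → S ⊆ T → (val u ✶ val v) S ≤ (val u ✶ val v) T
    mono {S} {T} S⊆T with ✶-attained (val u) (val v) S
    ... | X , X⊆S , eq = ≤-trans (≤-reflexive eq) (≤-trans
      (+-mono₂ ≤-refl (v-mono λ k∈ → let k∈S , k∉X = ∈-─⁻ S X k∈ in x∈p∧x∉q⇒x∈p─q (S⊆T k∈S) k∉X))
      (✶-bound (val u) (val v) (λ k∈X → S⊆T (X⊆S k∈X))))

  ✶-isMerge : ∀ {n} (u v w : Valuation n) → ground u ≡ ground w → ground v ≡ ground w →
    (∀ S → S ⊆ ground w → val w S ≡ (val u ✶ val v) S) → IsMerge u v w
  ✶-isMerge u v w refl refl w≡ = sym (∪-idem (ground w)) , λ S S⊆E →
    let T , T⊆S , eq = ✶-attained (val u) (val v) S in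
    (T , ((λ k∈T → x∈p∩q⁺ (T⊆S k∈T , S⊆E (T⊆S k∈T))) , (λ k∈ → S⊆E (p─q⊆p S T k∈))) , trans (sym eq) (sym (w≡ S S⊆E)))
    , λ X X-ok → ≤-trans (✶-bound (val u) (val v) (λ k∈X → p∩q⊆p S _ (proj₁ X-ok k∈X))) (≤-reflexive (sym (w≡ S S⊆E)))

  -- The alternatives serve the first zero, one, two or three agents. With decreasing weights some
  -- optimal assignment serves the agents in this order.
  Attained : ∀ {n} → (x y z : Fin n → R) → Subset n → R → Set
  Attained x y z S v = v ≤ 0#
    ⊎ (∃ λ i → i ∈ S × v ≤ x i)
    ⊎ (∃ λ i → ∃ λ j → i ∈ S × j ∈ S × i ≢ j × v ≤ x i + y j)
    ⊎ (∃ λ i → ∃ λ j → ∃ λ k → i ∈ S × j ∈ S × k ∈ S × i ≢ j × i ≢ k × j ≢ k × v ≤ x i + y j + z k)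

  -- weights x, y, z of three unit-demand agents whose optimal assignment has value f
  record Assignment {n} (f : Subset n → R) : Set where
    field
      x y z : Fin n → R
      z≥0   : ∀ i → 0# ≤ z i
      z≤y   : ∀ i → z i ≤ y i
      y≤x   : ∀ i → y i ≤ x i
      one   : ∀ i → x i ≤ f (⊥ ⊞ i)
      two   : ∀ i j → i ≢ j → x i + y j ≤ f (⊥ ⊞ i ⊞ j)
      three : ∀ i j k → i ≢ j → i ≢ k → j ≢ k → z k + f (⊥ ⊞ i ⊞ j) ≤ f (⊥ ⊞ i ⊞ j ⊞ k)
      attained : ∀ S → Attained x y z S (f S)

  module _ {n} {f : Subset n → R} (f≥0 : ∀ S → 0# ≤ f S) (mono : ∀ {S T} → S ⊆ T → f S ≤ f T) (A : Assignment f) where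
    open Assignment A

    -- For the upper bound, `z≤y` and `y≤x` let an item pass to an earlier agent who is idle; this
    -- reduces the eight patterns of idle agents to the bounds `one`, `two` and `three`. For the
    -- lower bound, `attained` names an assignment.
    assignment-value : ∀ S → ((unit x ✶ unit y) ✶ unit z) S ≡ f S
    assignment-value S = antisym upper lower
      where
      upper : ((unit x ✶ unit y) ✶ unit z) S ≤ f S
      upper with ✶-attained (unit x ✶ unit y) (unit z) S
      ... | T , T⊆S , eq with ✶-attained (unit x) (unit y) T
      ... | U , U⊆T , eq′ = subst (_≤ f S) (sym (trans eq (cong (_+ unit z (S ─ T)) eq′))) bound
        where
        F = f S
        x≤ : ∀ {i} → i ∈ S → x i ≤ F
        x≤ {i} i∈S = ≤-trans (one i) (mono (⊞-⊆ i ⊥⊆ i∈S))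
        xy≤ : ∀ {i j} → i ∈ S → j ∈ S → i ≢ j → x i + y j ≤ F
        xy≤ {i} {j} i∈S j∈S i≢j = ≤-trans (two i j i≢j) (mono (⊞-⊆ j (⊞-⊆ i ⊥⊆ i∈S) j∈S))
        U⊆S : U ⊆ S
        U⊆S k∈U = T⊆S (U⊆T k∈U)
        apart : ∀ {V i j} → i ∈ V → j ∉ V → i ≢ j
        apart i∈V j∉V refl = j∉V i∈V
        of-values : ∀ {a b c} → unit x U ≡ a → unit y (T ─ U) ≡ b → unit z (S ─ T) ≡ c → a + b + c ≤ F →
                    unit x U + unit y (T ─ U) + unit z (S ─ T) ≤ F
        of-values refl refl refl le = le
        bound : unit x U + unit y (T ─ U) + unit z (S ─ T) ≤ F
        bound with unit-attained x U | unit-attained y (T ─ U) | unit-attained z (S ─ T)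
        ... | inj₁ ex | inj₁ ey | inj₁ ez = of-values ex ey ez
          (linear (F ∷ []) (λ F → (𝟘 ≼ F) ∷ [] ⊢ (𝟘 ⊕ 𝟘) ⊕ 𝟘 ≼ F) refl (f≥0 S))
        ... | inj₂ (i , i∈U , ex) | inj₁ ey | inj₁ ez = of-values ex ey ez
          (linear (F ∷ x i ∷ []) (λ F x → (x ≼ F) ∷ [] ⊢ (x ⊕ 𝟘) ⊕ 𝟘 ≼ F) refl (x≤ (U⊆S i∈U)))
        ... | inj₁ ex | inj₂ (j , j∈ , ey) | inj₁ ez = of-values ex ey ez
          (linear (F ∷ x j ∷ y j ∷ []) (λ F x y → (x ≼ F) ∷ (y ≼ x) ∷ [] ⊢ (𝟘 ⊕ y) ⊕ 𝟘 ≼ F) refl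
            (x≤ (T⊆S (p─q⊆p T U j∈))) (y≤x j))
        ... | inj₁ ex | inj₁ ey | inj₂ (k , k∈ , ez) = of-values ex ey ez
          (linear (F ∷ x k ∷ y k ∷ z k ∷ []) (λ F x y z → (x ≼ F) ∷ (y ≼ x) ∷ (z ≼ y) ∷ [] ⊢ (𝟘 ⊕ 𝟘) ⊕ z ≼ F) refl
            (x≤ (p─q⊆p S T k∈)) (y≤x k) (z≤y k))
        ... | inj₂ (i , i∈U , ex) | inj₂ (j , j∈ , ey) | inj₁ ez = of-values ex ey ez
          (linear (F ∷ x i ∷ y j ∷ []) (λ F x y → (x ⊕ y ≼ F) ∷ [] ⊢ (x ⊕ y) ⊕ 𝟘 ≼ F) refl
            (xy≤ (U⊆S i∈U) (T⊆S (p─q⊆p T U j∈)) (apart i∈U (proj₂ (∈-─⁻ T U j∈)))))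
        ... | inj₂ (i , i∈U , ex) | inj₁ ey | inj₂ (k , k∈ , ez) = of-values ex ey ez
          (linear (F ∷ x i ∷ y k ∷ z k ∷ []) (λ F x y z → (x ⊕ y ≼ F) ∷ (z ≼ y) ∷ [] ⊢ (x ⊕ 𝟘) ⊕ z ≼ F) refl
            (xy≤ (U⊆S i∈U) (p─q⊆p S T k∈) (apart (U⊆T i∈U) (proj₂ (∈-─⁻ S T k∈)))) (z≤y k))
        ... | inj₁ ex | inj₂ (j , j∈ , ey) | inj₂ (k , k∈ , ez) = of-values ex ey ez
          (linear (F ∷ x j ∷ y j ∷ y k ∷ z k ∷ []) (λ F xj yj yk zk → (xj ⊕ yk ≼ F) ∷ (yj ≼ xj) ∷ (zk ≼ yk) ∷ [] ⊢ (𝟘 ⊕ yj) ⊕ zk ≼ F) refl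
            (xy≤ (T⊆S (p─q⊆p T U j∈)) (p─q⊆p S T k∈) (apart (p─q⊆p T U j∈) (proj₂ (∈-─⁻ S T k∈)))) (y≤x j) (z≤y k))
        ... | inj₂ (i , i∈U , ex) | inj₂ (j , j∈ , ey) | inj₂ (k , k∈ , ez) = of-values ex ey ez
          (linear (F ∷ x i ∷ y j ∷ z k ∷ f (⊥ ⊞ i ⊞ j) ∷ f (⊥ ⊞ i ⊞ j ⊞ k) ∷ [])
            (λ F x y z fij fijk → (x ⊕ y ≼ fij) ∷ (z ⊕ fij ≼ fijk) ∷ (fijk ≼ F) ∷ [] ⊢ (x ⊕ y) ⊕ z ≼ F) refl
            (two i j i≢j) (three i j k i≢j i≢k j≢k)
            (mono (⊞-⊆ k (⊞-⊆ j (⊞-⊆ i ⊥⊆ (U⊆S i∈U)) (T⊆S (p─q⊆p T U j∈))) (p─q⊆p S T k∈))))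
          where
          i≢j = apart i∈U (proj₂ (∈-─⁻ T U j∈))
          i≢k = apart (U⊆T i∈U) (proj₂ (∈-─⁻ S T k∈))
          j≢k = apart (p─q⊆p T U j∈) (proj₂ (∈-─⁻ S T k∈))

      assign : ∀ {T U} → T ⊆ S → U ⊆ T → unit x U + unit y (T ─ U) + unit z (S ─ T) ≤ ((unit x ✶ unit y) ✶ unit z) S
      assign T⊆S U⊆T = ≤-trans (+-mono₂ (✶-bound (unit x) (unit y) U⊆T) ≤-refl) (✶-bound (unit x ✶ unit y) (unit z) T⊆S)

      lower : f S ≤ ((unit x ✶ unit y) ✶ unit z) S
      lower with attained S
      ... | inj₁ f≤0 = ≤-trans f≤0 (≤-trans
        (linear (unit x S ∷ unit y (S ─ S) ∷ unit z (S ─ S) ∷ [])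
          (λ a b c → (𝟘 ≼ a) ∷ (𝟘 ≼ b) ∷ (𝟘 ≼ c) ∷ [] ⊢ 𝟘 ≼ (a ⊕ b) ⊕ c) refl
          (unit-nonneg x S) (unit-nonneg y (S ─ S)) (unit-nonneg z (S ─ S)))
        (assign (λ k → k) (λ k → k)))
      ... | inj₂ (inj₁ (i , i∈S , le)) = ≤-trans le (≤-trans
        (linear (x i ∷ unit x S ∷ unit y (S ─ S) ∷ unit z (S ─ S) ∷ [])
          (λ x a b c → (x ≼ a) ∷ (𝟘 ≼ b) ∷ (𝟘 ≼ c) ∷ [] ⊢ x ≼ (a ⊕ b) ⊕ c) refl
          (unit-bound x i∈S) (unit-nonneg y (S ─ S)) (unit-nonneg z (S ─ S)))
        (assign (λ k → k) (λ k → k)))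
      ... | inj₂ (inj₂ (inj₁ (i , j , i∈S , j∈S , i≢j , le))) = ≤-trans le (≤-trans
        (linear (x i ∷ y j ∷ unit x (⊥ ⊞ i) ∷ unit y (S ─ (⊥ ⊞ i)) ∷ unit z (S ─ S) ∷ [])
          (λ x y a b c → (x ≼ a) ∷ (y ≼ b) ∷ (𝟘 ≼ c) ∷ [] ⊢ x ⊕ y ≼ (a ⊕ b) ⊕ c) refl
          (unit-bound x {⊥ ⊞ i} (i∈S⊞i i)) (unit-bound y (x∈p∧x∉q⇒x∈p─q j∈S (∉⊥⊞ i≢j))) (unit-nonneg z (S ─ S)))
        (assign (λ k → k) (⊞-⊆ i ⊥⊆ i∈S)))
      ... | inj₂ (inj₂ (inj₂ (i , j , k , i∈S , j∈S , k∈S , i≢j , i≢k , j≢k , le))) = ≤-trans le (≤-trans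
        (+-mono₂ (+-mono₂ (unit-bound x {⊥ ⊞ i} (i∈S⊞i i)) (unit-bound y {(⊥ ⊞ i ⊞ j) ─ (⊥ ⊞ i)} (x∈p∧x∉q⇒x∈p─q (i∈S⊞i j) (∉⊥⊞ i≢j))))
          (unit-bound z (x∈p∧x∉q⇒x∈p─q k∈S λ k∈ → [ (λ k≡j → j≢k (sym k≡j)) , ∉⊥⊞ i≢k ]′ (∈-⊞⁻ j k∈))))
        (assign {⊥ ⊞ i ⊞ j} {⊥ ⊞ i} (⊞-⊆ j (⊞-⊆ i ⊥⊆ i∈S) j∈S) (∈-⊞⁺ j)))

  assignment⇒MBV : ∀ {n} (u : Valuation n) → Assignment (extend u) → MBVgen n u
  assignment⇒MBV u A = merge xy (unitDemand E z) u
    (merge (unitDemand E x) (unitDemand E y) xy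
      (unitDemand-MBV E x λ i → ≤-trans (y≥0 i) (y≤x i)) (unitDemand-MBV E y y≥0)
      (✶-isMerge (unitDemand E x) (unitDemand E y) xy refl refl λ S _ → refl))
    (unitDemand-MBV E z z≥0)
    (✶-isMerge xy (unitDemand E z) u refl refl λ S S⊆E → sym (trans
      (assignment-value (λ S → val-nonneg u _ (p∩q⊆q S E)) (extend-mono u) A S) (extend-⊆ u S⊆E)))
    where
    open Assignment A
    E = ground u
    y≥0 : ∀ i → 0# ≤ y i
    y≥0 i = ≤-trans (z≥0 i) (z≤y i)
    xy = convolution (unitDemand E x) (unitDemand E y) (unit-nonneg y) (unit-mono y)

  pattern 0′ = fzero
  pattern 1′ = fsuc fzero
  pattern 2′ = fsuc (fsuc fzero)

  private
    ⊖-nonneg : ∀ {a b} → b ≤ a → 0# ≤ a ⊖ b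
    ⊖-nonneg {a} {b} = linear (a ∷ b ∷ (a ⊖ b) ∷ []) (λ a b c → (a ≼ c ⊕ b) ∷ (b ≼ a) ∷ [] ⊢ 𝟘 ≼ c) refl (≤-reflexive (sym (⊖-+ a b)))

    ⊖-≤ : ∀ {a b c} → a ≤ c + b → a ⊖ b ≤ c
    ⊖-≤ {a} {b} {c} = linear (a ∷ b ∷ c ∷ (a ⊖ b) ∷ []) (λ a b c d → (d ⊕ b ≼ a) ∷ (a ≼ c ⊕ b) ∷ [] ⊢ d ≼ c) refl (≤-reflexive (⊖-+ a b))

  module _ {f : Subset 1 → R} (f≥0 : ∀ S → 0# ≤ f S) (f⊥ : f ⊥ ≡ 0#) where

    assignment₁ : Assignment f
    assignment₁ = record
      { x = λ _ → f ⊤ ; y = λ _ → 0# ; z = λ _ → 0#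
      ; z≥0 = λ _ → ≤-refl ; z≤y = λ _ → ≤-refl ; y≤x = λ _ → f≥0 ⊤
      ; one = λ { 0′ → ≤-refl }
      ; two = λ { 0′ 0′ i≢j → contradiction refl i≢j }
      ; three = λ { 0′ 0′ _ i≢j → contradiction refl i≢j }
      ; attained = λ { (false ∷ []) → inj₁ (≤-reflexive f⊥) ; (true ∷ []) → inj₂ (inj₁ (0′ , here , ≤-refl)) } }

  module _ {f : Subset 2 → R} (f≥0 : ∀ S → 0# ≤ f S) (f⊥ : f ⊥ ≡ 0#) (mono : ∀ {S T} → S ⊆ T → f S ≤ f T)
           (gs : GS (subsets 2) f) where

    assignment₂ : Assignment f
    assignment₂ = record
      { x = λ i → f (⊥ ⊞ i) ; y = y ; z = λ _ → 0#
      ; z≥0 = λ _ → ≤-refl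
      ; z≤y = λ { 0′ → ⊖-nonneg (mono ⊆⊤) ; 1′ → ⊖-nonneg (mono ⊆⊤) }
      ; y≤x = λ { 0′ → ⊖-≤ f⊤≤ ; 1′ → ⊖-≤ (≤-trans f⊤≤ (≤-reflexive (+-comm _ _))) }
      ; one = λ _ → ≤-refl
      ; two = two
      ; three = three
      ; attained = attained }
      where
      -- Marginal values over the other item: the pair then has its exact value whichever item goes
      -- to the second agent.
      y : Fin 2 → R
      y 0′ = f ⊤ ⊖ f (⊥ ⊞ 1′)
      y 1′ = f ⊤ ⊖ f (⊥ ⊞ 0′)
      f⊤≤ : f ⊤ ≤ f (⊥ ⊞ 0′) + f (⊥ ⊞ 1′)
      f⊤≤ = linear (f ⊤ ∷ f ⊥ ∷ f (⊥ ⊞ 0′) ∷ f (⊥ ⊞ 1′) ∷ [])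
        (λ t e a b → (t ⊕ e ≼ a ⊕ b) ∷ (𝟘 ≼ e) ∷ [] ⊢ t ≼ a ⊕ b) refl
        (submodular f≥0 mono gs ⊥ {0′} {1′} ∉⊥ ∉⊥ λ ()) (f≥0 ⊥)
      two : ∀ i j → i ≢ j → f (⊥ ⊞ i) + y j ≤ f (⊥ ⊞ i ⊞ j)
      two 0′ 0′ i≢j = contradiction refl i≢j
      two 0′ 1′ _   = ≤-reflexive (trans (+-comm _ _) (⊖-+ _ _))
      two 1′ 0′ _   = ≤-reflexive (trans (+-comm _ _) (⊖-+ _ _))
      two 1′ 1′ i≢j = contradiction refl i≢j
      three : ∀ i j k → i ≢ j → i ≢ k → j ≢ k → 0# + f (⊥ ⊞ i ⊞ j) ≤ f (⊥ ⊞ i ⊞ j ⊞ k)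
      three i j k _ _ _ = ≤-trans (≤-reflexive (+-identityˡ _)) (mono (∈-⊞⁺ k))
      attained : ∀ S → Attained (λ i → f (⊥ ⊞ i)) y (λ _ → 0#) S (f S)
      attained (false ∷ false ∷ []) = inj₁ (≤-reflexive f⊥)
      attained (true ∷ false ∷ [])  = inj₂ (inj₁ (0′ , here , ≤-refl))
      attained (false ∷ true ∷ [])  = inj₂ (inj₁ (1′ , there here , ≤-refl))
      attained (true ∷ true ∷ [])   = inj₂ (inj₂ (inj₁ (0′ , 1′ , here , there here , (λ ())
        , ≤-reflexive (sym (trans (+-comm _ _) (⊖-+ _ _))))))

  module _ {f : Subset 3 → R} (f≥0 : ∀ S → 0# ≤ f S) (f⊥ : f ⊥ ≡ 0#) (mono : ∀ {S T} → S ⊆ T → f S ≤ f T)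
           (gs : GS (subsets 3) f) where

    -- The j-th item is worth its least marginal value beyond one (beyond two)
    -- other items to the second (third) agent.
    assignment₃ : Assignment f
    assignment₃ = record
      { x = x ; y = y ; z = z
      ; z≥0 = λ { 0′ → ⊖-nonneg (mono ⊆⊤) ; 1′ → ⊖-nonneg (mono ⊆⊤) ; 2′ → ⊖-nonneg (mono ⊆⊤) }
      ; z≤y = λ { 0′ → ⊓-glb (⊖-≤⁺ (sub 1′ 0′ 2′ (λ ()) (λ ()) λ ())) (⊖-≤⁺ (sub 2′ 0′ 1′ (λ ()) (λ ()) λ ()))
                ; 1′ → ⊓-glb (⊖-≤⁺ (sub 0′ 1′ 2′ (λ ()) (λ ()) λ ())) (⊖-≤⁺ (sub 2′ 1′ 0′ (λ ()) (λ ()) λ ()))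
                ; 2′ → ⊓-glb (⊖-≤⁺ (sub 0′ 2′ 1′ (λ ()) (λ ()) λ ())) (⊖-≤⁺ (sub 1′ 2′ 0′ (λ ()) (λ ()) λ ())) }
      ; y≤x = λ { 0′ → ≤-trans (x⊓y≤x _ _) (⊖-≤ (sub⊥ 0′ 1′ λ ()))
                ; 1′ → ≤-trans (x⊓y≤x _ _) (⊖-≤ (sub⊥ 1′ 0′ λ ()))
                ; 2′ → ≤-trans (x⊓y≤x _ _) (⊖-≤ (sub⊥ 2′ 0′ λ ())) }
      ; one = λ _ → ≤-refl
      ; two = two ; three = three ; attained = attained }
      where
      c₀₁ = f (⊥ ⊞ 0′ ⊞ 1′)
      c₀₂ = f (⊥ ⊞ 0′ ⊞ 2′)
      c₁₂ = f (⊥ ⊞ 1′ ⊞ 2′)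
      x y z : Fin 3 → R
      x i = f (⊥ ⊞ i)
      y 0′ = (c₀₁ ⊖ x 1′) ⊓ (c₀₂ ⊖ x 2′)
      y 1′ = (c₀₁ ⊖ x 0′) ⊓ (c₁₂ ⊖ x 2′)
      y 2′ = (c₀₂ ⊖ x 0′) ⊓ (c₁₂ ⊖ x 1′)
      z 0′ = f ⊤ ⊖ c₁₂
      z 1′ = f ⊤ ⊖ c₀₂
      z 2′ = f ⊤ ⊖ c₀₁
      sub : ∀ k i j → k ≢ i → k ≢ j → i ≢ j → f (⊥ ⊞ k ⊞ i ⊞ j) + f (⊥ ⊞ k) ≤ f (⊥ ⊞ k ⊞ i) + f (⊥ ⊞ k ⊞ j)
      sub k i j k≢i k≢j = submodular f≥0 mono gs (⊥ ⊞ k) (∉⊥⊞ k≢i) (∉⊥⊞ k≢j)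
      sub⊥ : ∀ i j → i ≢ j → f (⊥ ⊞ i ⊞ j) ≤ x i + x j
      sub⊥ i j i≢j = linear (f (⊥ ⊞ i ⊞ j) ∷ f ⊥ ∷ x i ∷ x j ∷ [])
        (λ t e a b → (t ⊕ e ≼ a ⊕ b) ∷ (𝟘 ≼ e) ∷ [] ⊢ t ≼ a ⊕ b) refl (submodular f≥0 mono gs ⊥ ∉⊥ ∉⊥ i≢j) (f≥0 ⊥)
      pay : ∀ {a b} c → c ≤ b ⊖ a → a + c ≤ b
      pay {a} {b} c = linear (a ∷ b ∷ c ∷ (b ⊖ a) ∷ []) (λ a b c d → (d ⊕ a ≼ b) ∷ (c ≼ d) ∷ [] ⊢ a ⊕ c ≼ b) refl
        (≤-reflexive (⊖-+ b a))
      get : ∀ {a b} c → b ⊖ a ≤ c → b ≤ a + c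
      get {a} {b} c = linear (a ∷ b ∷ c ∷ (b ⊖ a) ∷ []) (λ a b c d → (b ≼ d ⊕ a) ∷ (d ≼ c) ∷ [] ⊢ b ≼ a ⊕ c) refl
        (≤-reflexive (sym (⊖-+ b a)))
      two : ∀ i j → i ≢ j → x i + y j ≤ f (⊥ ⊞ i ⊞ j)
      two 0′ 0′ i≢j = contradiction refl i≢j
      two 1′ 1′ i≢j = contradiction refl i≢j
      two 2′ 2′ i≢j = contradiction refl i≢j
      two 0′ 1′ _ = pay (y 1′) (x⊓y≤x _ _)
      two 0′ 2′ _ = pay (y 2′) (x⊓y≤x _ _)
      two 1′ 0′ _ = pay (y 0′) (x⊓y≤x _ _)
      two 1′ 2′ _ = pay (y 2′) (x⊓y≤y _ _)
      two 2′ 0′ _ = pay (y 0′) (x⊓y≤y _ _)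
      two 2′ 1′ _ = pay (y 1′) (x⊓y≤y _ _)
      three : ∀ i j k → i ≢ j → i ≢ k → j ≢ k → z k + f (⊥ ⊞ i ⊞ j) ≤ f (⊥ ⊞ i ⊞ j ⊞ k)
      three 0′ 0′ _  i≢j _ _ = contradiction refl i≢j
      three 1′ 1′ _  i≢j _ _ = contradiction refl i≢j
      three 2′ 2′ _  i≢j _ _ = contradiction refl i≢j
      three 0′ 1′ 0′ _ i≢k _ = contradiction refl i≢k
      three 0′ 1′ 1′ _ _ j≢k = contradiction refl j≢k
      three 0′ 2′ 0′ _ i≢k _ = contradiction refl i≢k
      three 0′ 2′ 2′ _ _ j≢k = contradiction refl j≢k
      three 1′ 0′ 1′ _ i≢k _ = contradiction refl i≢k
      three 1′ 0′ 0′ _ _ j≢k = contradiction refl j≢k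
      three 1′ 2′ 1′ _ i≢k _ = contradiction refl i≢k
      three 1′ 2′ 2′ _ _ j≢k = contradiction refl j≢k
      three 2′ 0′ 2′ _ i≢k _ = contradiction refl i≢k
      three 2′ 0′ 0′ _ _ j≢k = contradiction refl j≢k
      three 2′ 1′ 2′ _ i≢k _ = contradiction refl i≢k
      three 2′ 1′ 1′ _ _ j≢k = contradiction refl j≢k
      three 0′ 1′ 2′ _ _ _ = ≤-reflexive (⊖-+ _ _)
      three 1′ 0′ 2′ _ _ _ = ≤-reflexive (⊖-+ _ _)
      three 0′ 2′ 1′ _ _ _ = ≤-reflexive (⊖-+ _ _)
      three 2′ 0′ 1′ _ _ _ = ≤-reflexive (⊖-+ _ _)
      three 1′ 2′ 0′ _ _ _ = ≤-reflexive (⊖-+ _ _)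
      three 2′ 1′ 0′ _ _ _ = ≤-reflexive (⊖-+ _ _)
      -- Each alternative of `tripleExchange` says that, for one of the two items, its marginal over
      -- the other item is the smaller of the two marginals defining its `y`; giving that item to
      -- the second agent accounts for the whole pair.
      pair₀₁ : c₀₁ ≤ x 1′ + y 0′ ⊎ c₀₁ ≤ x 0′ + y 1′
      pair₀₁ with tripleExchange f≥0 mono gs ⊥ {0′} {1′} {2′} ∉⊥ ∉⊥ ∉⊥ (λ ()) (λ ()) (λ ())
      ... | inj₁ le = inj₁ (get (y 0′) (⊓-glb ≤-refl (⊖-≤⁺ le)))
      ... | inj₂ le = inj₂ (get (y 1′) (⊓-glb ≤-refl (⊖-≤⁺ le)))
      pair₀₂ : c₀₂ ≤ x 2′ + y 0′ ⊎ c₀₂ ≤ x 0′ + y 2′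
      pair₀₂ with tripleExchange f≥0 mono gs ⊥ {0′} {2′} {1′} ∉⊥ ∉⊥ ∉⊥ (λ ()) (λ ()) (λ ())
      ... | inj₁ le = inj₁ (get (y 0′) (⊓-glb (⊖-≤⁺ le) ≤-refl))
      ... | inj₂ le = inj₂ (get (y 2′) (⊓-glb ≤-refl (⊖-≤⁺ le)))
      pair₁₂ : c₁₂ ≤ x 2′ + y 1′ ⊎ c₁₂ ≤ x 1′ + y 2′
      pair₁₂ with tripleExchange f≥0 mono gs ⊥ {1′} {2′} {0′} ∉⊥ ∉⊥ ∉⊥ (λ ()) (λ ()) (λ ())
      ... | inj₁ le = inj₁ (get (y 1′) (⊓-glb (⊖-≤⁺ le) ≤-refl))
      ... | inj₂ le = inj₂ (get (y 2′) (⊓-glb (⊖-≤⁺ le) ≤-refl))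
      all-three : ∀ {s} → c₀₁ ≤ s → f ⊤ ≤ s + z 2′
      all-three {s} le = linear (f ⊤ ∷ s ∷ c₀₁ ∷ z 2′ ∷ []) (λ t s c z → (t ≼ z ⊕ c) ∷ (c ≼ s) ∷ [] ⊢ t ≼ s ⊕ z) refl
        (≤-reflexive (sym (⊖-+ _ _))) le
      attained : ∀ S → Attained x y z S (f S)
      attained (false ∷ false ∷ false ∷ []) = inj₁ (≤-reflexive f⊥)
      attained (true ∷ false ∷ false ∷ [])  = inj₂ (inj₁ (0′ , here , ≤-refl))
      attained (false ∷ true ∷ false ∷ [])  = inj₂ (inj₁ (1′ , there here , ≤-refl))
      attained (false ∷ false ∷ true ∷ [])  = inj₂ (inj₁ (2′ , there (there here) , ≤-refl))
      attained (true ∷ true ∷ false ∷ []) with pair₀₁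
      ... | inj₁ le = inj₂ (inj₂ (inj₁ (1′ , 0′ , there here , here , (λ ()) , le)))
      ... | inj₂ le = inj₂ (inj₂ (inj₁ (0′ , 1′ , here , there here , (λ ()) , le)))
      attained (true ∷ false ∷ true ∷ []) with pair₀₂
      ... | inj₁ le = inj₂ (inj₂ (inj₁ (2′ , 0′ , there (there here) , here , (λ ()) , le)))
      ... | inj₂ le = inj₂ (inj₂ (inj₁ (0′ , 2′ , here , there (there here) , (λ ()) , le)))
      attained (false ∷ true ∷ true ∷ []) with pair₁₂
      ... | inj₁ le = inj₂ (inj₂ (inj₁ (2′ , 1′ , there (there here) , there here , (λ ()) , le)))
      ... | inj₂ le = inj₂ (inj₂ (inj₁ (1′ , 2′ , there here , there (there here) , (λ ()) , le)))
      attained (true ∷ true ∷ true ∷ []) with pair₀₁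
      ... | inj₁ le = inj₂ (inj₂ (inj₂ (1′ , 0′ , 2′ , there here , here , there (there here) , (λ ()) , (λ ()) , (λ ()) , all-three le)))
      ... | inj₂ le = inj₂ (inj₂ (inj₂ (0′ , 1′ , 2′ , here , there here , there (there here) , (λ ()) , (λ ()) , (λ ()) , all-three le)))

  GS⇒MBV : ∀ n → 1 ℕ.≤ n → n ℕ.≤ 3 → (u : Valuation n) → IsGS u → MBVgen n u
  GS⇒MBV n 1≤n n≤3 u gs = assignment⇒MBV u (assignment n 1≤n n≤3 u gs)
    where
    extend≥0 : ∀ {n} (u : Valuation n) S → 0# ≤ extend u S
    extend≥0 u S = val-nonneg u _ (p∩q⊆q S (ground u))
    assignment : ∀ n → 1 ℕ.≤ n → n ℕ.≤ 3 → (u : Valuation n) → IsGS u → Assignment (extend u)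
    assignment 1 _ _ u _  = assignment₁ (extend≥0 u) (extend-⊥ u)
    assignment 2 _ _ u gs = assignment₂ (extend≥0 u) (extend-⊥ u) (extend-mono u) (IsGS⇒GS u gs)
    assignment 3 _ _ u gs = assignment₃ (extend≥0 u) (extend-⊥ u) (extend-mono u) (IsGS⇒GS u gs)
    assignment (suc (suc (suc (suc _)))) _ (ℕ.s≤s (ℕ.s≤s (ℕ.s≤s ())))

-- The two-class function on natural numbers and its exchange property.

module TwoClasses where
  open Subsets
  open import Data.Nat using (_+_; _≤_; _<_; _≤?_; z≤n; s≤s)

  -- `φ` is applied to the total number of items and `s` to the number in each class: a single item
  -- yields 2 + 1 = 3, several items of one class 3 + 1 = 4, and items of both classes 3 + 1 + 1 =
  -- 5.
  φ s : ℕ → ℕ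
  φ 0             = 0
  φ 1             = 2
  φ (suc (suc _)) = 3
  s 0       = 0
  s (suc _) = 1

  φ-mono : ∀ {k l} → k ≤ l → φ k ≤ φ l
  φ-mono {0}           {l}           _ = z≤n
  φ-mono {1}           {1}           _ = ℕₚ.≤-refl
  φ-mono {1}           {suc (suc l)} _ = ℕₚ.n≤1+n 2
  φ-mono {suc (suc k)} {suc (suc l)} _ = ℕₚ.≤-refl
  φ-mono {suc (suc k)} {1} (s≤s ())

  φ≤3 : ∀ k → φ k ≤ 3
  φ≤3 0             = z≤n
  φ≤3 1             = ℕₚ.n≤1+n 2
  φ≤3 (suc (suc _)) = ℕₚ.≤-refl

  φ-concave : ∀ {k l} → k ≤ l → φ (suc l) + φ k ≤ φ l + φ (suc k)
  φ-concave {0}           {0}           _ = ℕₚ.≤-refl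
  φ-concave {0}           {1}           _ = ℕₚ.n≤1+n 3
  φ-concave {0}           {suc (suc l)} _ = ℕₚ.m≤m+n 3 2
  φ-concave {1}           {1}           _ = ℕₚ.≤-refl
  φ-concave {1}           {suc (suc l)} _ = ℕₚ.n≤1+n 5
  φ-concave {suc (suc k)} {1} (s≤s ())
  φ-concave {suc (suc k)} {suc (suc l)} _ = ℕₚ.≤-refl

  s-mono : ∀ {k l} → k ≤ l → s k ≤ s l
  s-mono {0}             _ = z≤n
  s-mono {suc k} {suc l} _ = ℕₚ.≤-refl

  s≤1 : ∀ k → s k ≤ 1
  s≤1 0       = z≤n
  s≤1 (suc _) = ℕₚ.≤-refl

  s-concave : ∀ {k l} → k ≤ l → s (suc l) + s k ≤ s l + s (suc k)
  s-concave {k} {l} k≤l = subst (_≤ s l + 1) (ℕₚ.+-comm (s k) 1) (ℕₚ.+-monoˡ-≤ 1 (s-mono k≤l))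

  -- The worth of a items of one class and b of the other: a laminar sum of concave functions,
  -- so that exchange reduces to concavity.
  g : ℕ → ℕ → ℕ
  g a b = φ (a + b) + (s a + s b)

  g-comm : ∀ a b → g a b ≡ g b a
  g-comm a b = cong₂ _+_ (cong φ (ℕₚ.+-comm a b)) (ℕₚ.+-comm (s a) (s b))

  g-mono : ∀ {a a′ b b′} → a ≤ a′ → b ≤ b′ → g a b ≤ g a′ b′
  g-mono a≤ b≤ = ℕₚ.+-mono-≤ (φ-mono (ℕₚ.+-mono-≤ a≤ b≤)) (ℕₚ.+-mono-≤ (s-mono a≤) (s-mono b≤))

  g≤5 : ∀ a b → g a b ≤ 5
  g≤5 a b = ℕₚ.+-mono-≤ (φ≤3 (a + b)) (ℕₚ.+-mono-≤ (s≤1 a) (s≤1 b))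

  private
    interleave : ∀ {a a′ b b′ c c′ d d′ e e′ h h′} → a + a′ ≤ b + b′ → c + c′ ≤ d + d′ → e + e′ ≤ h + h′ →
      (a + (c + e)) + (a′ + (c′ + e′)) ≤ (b + (d + h)) + (b′ + (d′ + h′))
    interleave {a} {a′} {b} {b′} {c} {c′} {d} {d′} {e} {e′} {h} {h′} p q r =
      subst₂ _≤_ (shuffle a a′ c c′ e e′) (shuffle b b′ d d′ h h′) (ℕₚ.+-mono-≤ p (ℕₚ.+-mono-≤ q r))
      where
      shuffle : ∀ a a′ c c′ e e′ → (a + a′) + ((c + c′) + (e + e′)) ≡ (a + (c + e)) + (a′ + (c′ + e′))
      shuffle = solve-∀

  -- The receiving side is no larger, in this class and in total, than what the giving side keeps,
  -- so by concavity neither affected summand loses.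
  g-move : ∀ {a a′} b b′ → a′ ≤ a → a′ + b′ ≤ a + b → g (suc a) b + g a′ b′ ≤ g a b + g (suc a′) b′
  g-move {a} {a′} b b′ a′≤a le = interleave {φ (suc a + b)} {φ (a′ + b′)} {φ (a + b)} {φ (suc a′ + b′)}
    {s (suc a)} {s a′} {s a} {s (suc a′)} {s b} {s b′} {s b} {s b′} (φ-concave le) (s-concave a′≤a) ℕₚ.≤-refl

  -- A swap across the classes leaves both total sizes unchanged, so the `φ` terms agree, and in
  -- each class the counts move closer together.
  g-swap : ∀ {a a′ b b′} → a′ ≤ a → b ≤ b′ → g (suc a) b + g a′ (suc b′) ≤ g a (suc b) + g (suc a′) b′
  g-swap {a} {a′} {b} {b′} a′≤a b≤b′ = interleave {φ (suc a + b)} {φ (a′ + suc b′)} {φ (a + suc b)} {φ (suc a′ + b′)}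
    {s (suc a)} {s a′} {s a} {s (suc a′)} {s b} {s (suc b′)} {s (suc b)} {s b′}
    (ℕₚ.≤-reflexive (cong₂ _+_ (cong φ (sym (ℕₚ.+-suc a b))) (cong φ (ℕₚ.+-suc a′ b′))))
    (s-concave a′≤a)
    (subst₂ _≤_ (ℕₚ.+-comm (s (suc b′)) (s b)) (ℕₚ.+-comm (s b′) (s (suc b))) (s-concave b≤b′))

  module _ {n} (C : Subset n) where

    count : Subset n → ℕ
    count S = ∣ S ∩ C ∣

    count-mono : ∀ {S T} → S ⊆ T → count S ≤ count T
    count-mono {S} S⊆T = p⊆q⇒∣p∣≤∣q∣ λ k∈ → let k∈S , k∈C = x∈p∩q⁻ S C k∈ in x∈p∩q⁺ (S⊆T k∈S , k∈C)

    count-⊥ : count ⊥ ≡ 0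
    count-⊥ = trans (cong ∣_∣ (∩-zeroˡ C)) (∣⊥∣≡0 n)

    count-⊞ : ∀ {S i} → i ∈ C → i ∉ S → count (S ⊞ i) ≡ suc (count S)
    count-⊞ {S} {i} i∈C i∉S = trans (cong ∣_∣ eq) (∣⊞∣ i λ i∈ → i∉S (p∩q⊆p S C i∈))
      where
      forth : (S ⊞ i) ∩ C ⊆ (S ∩ C) ⊞ i
      forth k∈ with x∈p∩q⁻ (S ⊞ i) C k∈
      ... | k∈S+i , k∈C with ∈-⊞⁻ i k∈S+i
      ... | inj₁ refl = i∈S⊞i i
      ... | inj₂ k∈S  = ∈-⊞⁺ i (x∈p∩q⁺ (k∈S , k∈C))
      eq : (S ⊞ i) ∩ C ≡ (S ∩ C) ⊞ i
      eq = ⊆-antisym forth (⊞-⊆ i (λ k∈ → let k∈S , k∈C = x∈p∩q⁻ S C k∈ in x∈p∩q⁺ (∈-⊞⁺ i k∈S , k∈C))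
                                  (x∈p∩q⁺ (i∈S⊞i i , i∈C)))

    count-⊞-∉ : ∀ {S i} → i ∉ C → count (S ⊞ i) ≡ count S
    count-⊞-∉ {S} {i} i∉C = cong ∣_∣ (⊆-antisym forth
      λ k∈ → let k∈S , k∈C = x∈p∩q⁻ S C k∈ in x∈p∩q⁺ (∈-⊞⁺ i k∈S , k∈C))
      where
      forth : (S ⊞ i) ∩ C ⊆ S ∩ C
      forth k∈ with x∈p∩q⁻ (S ⊞ i) C k∈
      ... | k∈S+i , k∈C with ∈-⊞⁻ i k∈S+i
      ... | inj₁ refl = contradiction k∈C i∉C
      ... | inj₂ k∈S  = x∈p∩q⁺ (k∈S , k∈C)

    count-⊟ : ∀ {S i} → i ∈ C → i ∈ S → suc (count (S ⊟ i)) ≡ count S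
    count-⊟ {S} {i} i∈C i∈S = trans (cong (λ T → suc ∣ T ∣) eq) (∣⊟∣ i (x∈p∩q⁺ (i∈S , i∈C)))
      where
      eq : (S ⊟ i) ∩ C ≡ (S ∩ C) ⊟ i
      eq = ⊆-antisym
        (λ k∈ → let k∈S-i , k∈C = x∈p∩q⁻ (S ⊟ i) C k∈ ; k∈S , k≢i = ∈-⊟⁻ i k∈S-i in ∈-⊟⁺ i (x∈p∩q⁺ (k∈S , k∈C)) k≢i)
        (λ k∈ → let k∈SC , k≢i = ∈-⊟⁻ i k∈ ; k∈S , k∈C = x∈p∩q⁻ S C k∈SC in x∈p∩q⁺ (∈-⊟⁺ i k∈S k≢i , k∈C))

    count-⊟-∉ : ∀ {S i} → i ∉ C → count (S ⊟ i) ≡ count S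
    count-⊟-∉ {S} {i} i∉C = cong ∣_∣ (⊆-antisym
      (λ k∈ → let k∈S-i , k∈C = x∈p∩q⁻ (S ⊟ i) C k∈ in x∈p∩q⁺ (proj₁ (∈-⊟⁻ i k∈S-i) , k∈C))
      (λ k∈ → let k∈S , k∈C = x∈p∩q⁻ S C k∈ in x∈p∩q⁺ (∈-⊟⁺ i k∈S (λ { refl → i∉C k∈C }) , k∈C)))

    count-larger : ∀ {S T} → count S < count T → ∃ λ j → j ∈ T × j ∉ S × j ∈ C
    count-larger {S} {T} lt with Finₚ.any? (λ j → (j ∈? T) ×-dec ¬? (j ∈? S) ×-dec (j ∈? C))
    ... | yes found = found
    ... | no none = contradiction (p⊆q⇒∣p∣≤∣q∣ sub) (ℕₚ.<⇒≱ lt)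
      where
      sub : T ∩ C ⊆ S ∩ C
      sub {k} k∈ with x∈p∩q⁻ T C k∈ | k ∈? S
      ... | k∈T , k∈C | yes k∈S = x∈p∩q⁺ (k∈S , k∈C)
      ... | k∈T , k∈C | no k∉S  = contradiction (k , k∈T , k∉S , k∈C) none

  worth : ∀ {n} → Subset n → Subset n → ℕ
  worth C S = g (count C S) (count (∁ C) S)

  ∁-involutive : ∀ {n} (C : Subset n) → ∁ (∁ C) ≡ C
  ∁-involutive C = ⊆-antisym (λ k∈ → x∉∁p⇒x∈p (x∈∁p⇒x∉p k∈)) (λ k∈ → x∉p⇒x∈∁p (x∈p⇒x∉∁p k∈))

  worth-∁ : ∀ {n} (C S : Subset n) → worth (∁ C) S ≡ worth C S
  worth-∁ C S = trans (cong (λ D → g (count (∁ C) S) (count D S)) (∁-involutive C)) (g-comm (count (∁ C) S) (count C S))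

  worth-mono : ∀ {n} (C : Subset n) {S T} → S ⊆ T → worth C S ≤ worth C T
  worth-mono C S⊆T = g-mono (count-mono C S⊆T) (count-mono (∁ C) S⊆T)

  worth≤5 : ∀ {n} (C S : Subset n) → worth C S ≤ 5
  worth≤5 C S = g≤5 (count C S) (count (∁ C) S)

  worth-⊥ : ∀ {n} (C : Subset n) → worth C ⊥ ≡ 0
  worth-⊥ C = cong₂ g (count-⊥ C) (count-⊥ (∁ C))

  Exchangeable : ∀ {n} → (Subset n → ℕ) → Subset n → Subset n → Fin n → Set
  Exchangeable f S T i = f S + f T ≤ f (S ⊟ i) + f (T ⊞ i)
    ⊎ ∃ λ j → j ∈ T × j ∉ S × f S + f T ≤ f (S ⊟ i ⊞ j) + f (T ⊞ i ⊟ j)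

  -- If `T` has an item of `C` outside `S`, swapping `i` for it changes no count. Otherwise `T` has
  -- at most as many items of `C` as `S ⊟ i`. If `T` is also no larger than `S ⊟ i` in total, `i`
  -- can simply move. If it is larger, `T` has more items outside `C` than `S`, and one of them
  -- outside `S` is given in return.
  worth-exchange-∈ : ∀ {n} (C S T : Subset n) i → i ∈ S → i ∉ T → i ∈ C → Exchangeable (worth C) S T i
  worth-exchange-∈ C S T i i∈S i∉T i∈C with Finₚ.any? (λ j → (j ∈? T) ×-dec ¬? (j ∈? S) ×-dec (j ∈? C))
  ... | yes (j , j∈T , j∉S , j∈C) = inj₂ (j , j∈T , j∉S , ℕₚ.≤-reflexive (cong₂ _+_
      (cong₂ g (trans (sym (count-⊟ C {S} i∈C i∈S)) (sym (count-⊞ C {S ⊟ i} j∈C λ j∈ → j∉S (proj₁ (∈-⊟⁻ i j∈)))))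
               (sym (trans (count-⊞-∉ (∁ C) {S ⊟ i} (x∈p⇒x∉∁p j∈C)) (count-⊟-∉ (∁ C) {S} (x∈p⇒x∉∁p i∈C)))))
      (cong₂ g (ℕₚ.suc-injective (trans (sym (count-⊞ C {T} i∈C i∉T)) (sym (count-⊟ C {T ⊞ i} j∈C (∈-⊞⁺ i j∈T)))))
               (sym (trans (count-⊟-∉ (∁ C) {T ⊞ i} (x∈p⇒x∉∁p j∈C)) (count-⊞-∉ (∁ C) {T} (x∈p⇒x∉∁p i∈C)))))))
  ... | no none = other (a′ + b′ ≤? a + b)
    where
    a = count C (S ⊟ i)
    a′ = count C T
    b = count (∁ C) S
    b′ = count (∁ C) T
    i∉∁C = x∈p⇒x∉∁p i∈C
    fewer : a′ ≤ a
    fewer = p⊆q⇒∣p∣≤∣q∣ sub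
      where
      sub : T ∩ C ⊆ (S ⊟ i) ∩ C
      sub {k} k∈ with x∈p∩q⁻ T C k∈ | k ∈? S
      ... | k∈T , k∈C | yes k∈S = x∈p∩q⁺ (∈-⊟⁺ i k∈S (λ { refl → i∉T k∈T }) , k∈C)
      ... | k∈T , k∈C | no k∉S  = contradiction (k , k∈T , k∉S , k∈C) none
    S≡ : worth C S ≡ g (suc a) b
    S≡ = cong (λ x → g x b) (sym (count-⊟ C {S} i∈C i∈S))
    other : Dec (a′ + b′ ≤ a + b) → Exchangeable (worth C) S T i
    other (yes le) = inj₁ (subst₂ _≤_ (cong (_+ worth C T) (sym S≡))
      (cong₂ _+_ (cong (g a) (sym (count-⊟-∉ (∁ C) {S} i∉∁C)))
                   (sym (cong₂ g (count-⊞ C {T} i∈C i∉T) (count-⊞-∉ (∁ C) {T} i∉∁C))))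
      (g-move b b′ fewer le))
    other (no ¬le) with count-larger (∁ C) {S} {T} (ℕₚ.≰⇒> λ b′≤b → ¬le (ℕₚ.+-mono-≤ fewer b′≤b))
    ... | j , j∈T , j∉S , j∈∁C = inj₂ (j , j∈T , j∉S , subst₂ _≤_
        (cong₂ _+_ (sym S≡) (cong (g a′) b′≡))
        (cong₂ _+_
          (sym (cong₂ g (count-⊞-∉ C {S ⊟ i} j∉C)
            (trans (count-⊞ (∁ C) {S ⊟ i} j∈∁C λ j∈ → j∉S (proj₁ (∈-⊟⁻ i j∈))) (cong suc (count-⊟-∉ (∁ C) {S} i∉∁C)))))
          (sym (cong (λ x → g x (count (∁ C) (T ⊞ i ⊟ j))) (trans (count-⊟-∉ C {T ⊞ i} j∉C) (count-⊞ C {T} i∈C i∉T)))))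
        (g-swap {a} {a′} fewer (ℕₚ.≤-pred (subst (suc b ≤_) (sym b′≡) (ℕₚ.≰⇒> λ b′≤b → ¬le (ℕₚ.+-mono-≤ fewer b′≤b))))))
      where
      j∉C : j ∉ C
      j∉C = x∈∁p⇒x∉p j∈∁C
      b′≡ : suc (count (∁ C) (T ⊞ i ⊟ j)) ≡ b′
      b′≡ = trans (count-⊟ (∁ C) {T ⊞ i} j∈∁C (∈-⊞⁺ i j∈T)) (count-⊞-∉ (∁ C) {T} i∉∁C)

  private
    unflip : ∀ {n} (C A B X Y : Subset n) → worth (∁ C) A + worth (∁ C) B ≤ worth (∁ C) X + worth (∁ C) Y →
             worth C A + worth C B ≤ worth C X + worth C Y
    unflip C A B X Y = subst₂ _≤_ (cong₂ _+_ (worth-∁ C A) (worth-∁ C B)) (cong₂ _+_ (worth-∁ C X) (worth-∁ C Y))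

  worth-exchange : ∀ {n} (C S T : Subset n) i → i ∈ S → i ∉ T → Exchangeable (worth C) S T i
  worth-exchange C S T i i∈S i∉T with i ∈? C
  ... | yes i∈C = worth-exchange-∈ C S T i i∈S i∉T i∈C
  ... | no i∉C with worth-exchange-∈ (∁ C) S T i i∈S i∉T (x∉p⇒x∈∁p i∉C)
  ... | inj₁ le = inj₁ (unflip C S T (S ⊟ i) (T ⊞ i) le)
  ... | inj₂ (j , j∈T , j∉S , le) = inj₂ (j , j∈T , j∉S , unflip C S T (S ⊟ i ⊞ j) (T ⊞ i ⊟ j) le)

  worth-single-∈ : ∀ {n} (C : Subset n) {i} → i ∈ C → worth C (⊥ ⊞ i) ≡ 3
  worth-single-∈ C i∈C = cong₂ g (trans (count-⊞ C {⊥} i∈C ∉⊥) (cong suc (count-⊥ C)))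
    (trans (count-⊞-∉ (∁ C) {⊥} (x∈p⇒x∉∁p i∈C)) (count-⊥ (∁ C)))

  worth-single : ∀ {n} (C : Subset n) i → worth C (⊥ ⊞ i) ≡ 3
  worth-single C i with i ∈? C
  ... | yes i∈C = worth-single-∈ C i∈C
  ... | no i∉C  = trans (sym (worth-∁ C (⊥ ⊞ i))) (worth-single-∈ (∁ C) (x∉p⇒x∈∁p i∉C))

  worth-same-∈ : ∀ {n} (C : Subset n) {i j} → i ≢ j → i ∈ C → j ∈ C → worth C (⊥ ⊞ i ⊞ j) ≡ 4
  worth-same-∈ C {i} i≢j i∈C j∈C = cong₂ g
    (trans (count-⊞ C {⊥ ⊞ i} j∈C (∉⊥⊞ i≢j)) (cong suc (trans (count-⊞ C {⊥} i∈C ∉⊥) (cong suc (count-⊥ C)))))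
    (trans (count-⊞-∉ (∁ C) {⊥ ⊞ i} (x∈p⇒x∉∁p j∈C)) (trans (count-⊞-∉ (∁ C) {⊥} (x∈p⇒x∉∁p i∈C)) (count-⊥ (∁ C))))

  worth-same-∉ : ∀ {n} (C : Subset n) {i j} → i ≢ j → i ∉ C → j ∉ C → worth C (⊥ ⊞ i ⊞ j) ≡ 4
  worth-same-∉ C {i} {j} i≢j i∉C j∉C = trans (sym (worth-∁ C (⊥ ⊞ i ⊞ j)))
    (worth-same-∈ (∁ C) i≢j (x∉p⇒x∈∁p i∉C) (x∉p⇒x∈∁p j∉C))

  worth-cross : ∀ {n} (C : Subset n) {i j} → i ∈ C → j ∉ C → worth C (⊥ ⊞ i ⊞ j) ≡ 5
  worth-cross C {i} i∈C j∉C = cong₂ g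
    (trans (count-⊞-∉ C {⊥ ⊞ i} j∉C) (trans (count-⊞ C {⊥} i∈C ∉⊥) (cong suc (count-⊥ C))))
    (trans (count-⊞ (∁ C) {⊥ ⊞ i} (x∉p⇒x∈∁p j∉C) (∉⊥⊞ {i = i} λ { refl → j∉C i∈C }))
      (cong suc (trans (count-⊞-∉ (∁ C) {⊥} (x∈p⇒x∉∁p i∈C)) (count-⊥ (∁ C)))))

  worth-pair : ∀ {n} (C : Subset n) {i j} → i ≢ j → 4 ≤ worth C (⊥ ⊞ i ⊞ j)
  worth-pair C {i} {j} i≢j with i ∈? C | j ∈? C
  ... | yes i∈C | yes j∈C = ℕₚ.≤-reflexive (sym (worth-same-∈ C i≢j i∈C j∈C))
  ... | no i∉C  | no j∉C  = ℕₚ.≤-reflexive (sym (worth-same-∉ C i≢j i∉C j∉C))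
  ... | yes i∈C | no j∉C  = ℕₚ.≤-trans (ℕₚ.n≤1+n 4) (ℕₚ.≤-reflexive (sym (worth-cross C i∈C j∉C)))
  ... | no i∉C  | yes j∈C = ℕₚ.≤-trans (ℕₚ.n≤1+n 4) (ℕₚ.≤-reflexive (sym (trans (sym (worth-∁ C (⊥ ⊞ i ⊞ j)))
    (worth-cross (∁ C) (x∉p⇒x∈∁p i∉C) (x∈p⇒x∉∁p j∈C)))))

  data Small {n} : Subset n → Set where
    none : Small ⊥
    one  : ∀ i → Small (⊥ ⊞ i)
    two  : ∀ {i j} → i ≢ j → Small (⊥ ⊞ i ⊞ j)

  private
    count≡0 : ∀ {n} (C S : Subset n) → ¬ (∃ λ i → i ∈ S ∩ C) → count C S ≡ 0
    count≡0 {n} C S empty = trans (cong ∣_∣ (Empty-unique empty)) (∣⊥∣≡0 n)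

    one-class : ∀ {n} (C S : Subset n) → ¬ (∃ λ i → i ∈ S ∩ ∁ C) → ∃ λ P → Small P × P ⊆ S × worth C S ≤ worth C P
    one-class C S empty with nonempty? (S ∩ C)
    ... | no empty′ = ⊥ , none , ⊥⊆ , ℕₚ.≤-reflexive (trans (cong₂ g (count≡0 C S empty′) (count≡0 (∁ C) S empty)) (sym (worth-⊥ C)))
    ... | yes (i , i∈) with x∈p∩q⁻ S C i∈ | nonempty? ((S ⊟ i) ∩ C)
    ... | i∈S , i∈C | no empty′ = ⊥ ⊞ i , one i , ⊞-⊆ i ⊥⊆ i∈S , ℕₚ.≤-reflexive (trans
        (cong₂ g (trans (sym (count-⊟ C {S} i∈C i∈S)) (cong suc (count≡0 C (S ⊟ i) empty′))) (count≡0 (∁ C) S empty))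
        (sym (worth-single C i)))
    ... | i∈S , i∈C | yes (j , j∈) with x∈p∩q⁻ (S ⊟ i) C j∈
    ... | j∈S-i , j∈C = ⊥ ⊞ i ⊞ j , two i≢j , ⊞-⊆ j (⊞-⊆ i ⊥⊆ i∈S) (proj₁ (∈-⊟⁻ i j∈S-i))
        , ℕₚ.≤-trans (subst (λ b → g (count C S) b ≤ 4) (sym (count≡0 (∁ C) S empty))
            (ℕₚ.+-mono-≤ (φ≤3 (count C S + 0)) (ℕₚ.≤-trans (ℕₚ.≤-reflexive (ℕₚ.+-identityʳ _)) (s≤1 (count C S)))))
          (worth-pair C i≢j)
      where
      i≢j : i ≢ j
      i≢j i≡j = proj₂ (∈-⊟⁻ i j∈S-i) (sym i≡j)

  -- Every worth is already reached on at most two items, so a monotone function dominates `worth C`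
  -- once it does so on `Small` sets.
  represent : ∀ {n} (C S : Subset n) → ∃ λ P → Small P × P ⊆ S × worth C S ≤ worth C P
  represent C S with nonempty? (S ∩ C) | nonempty? (S ∩ ∁ C)
  ... | _ | no empty = one-class C S empty
  ... | yes (i , i∈) | yes (j , j∈) =
    let i∈S , i∈C = x∈p∩q⁻ S C i∈ ; j∈S , j∈∁C = x∈p∩q⁻ S (∁ C) j∈
    in ⊥ ⊞ i ⊞ j , two (λ { refl → x∈p⇒x∉∁p i∈C j∈∁C }) , ⊞-⊆ j (⊞-⊆ i ⊥⊆ i∈S) j∈S
       , ℕₚ.≤-trans (worth≤5 C S) (ℕₚ.≤-reflexive (sym (worth-cross C i∈C (x∈∁p⇒x∉p j∈∁C))))
  ... | no empty | yes _ with one-class (∁ C) S (λ { (i , i∈) → empty (i , subst (λ D → i ∈ S ∩ D) (∁-involutive C) i∈) })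
  ... | P , small , P⊆S , le = P , small , P⊆S , subst₂ _≤_ (worth-∁ C S) (worth-∁ C P) le

-- On four or more items, a gross substitutes valuation that is not generated.

module Counterexample (ℝ : CompleteOrderedField) where
  open CompleteOrderedField ℝ renaming (Carrier to R)
  open Valuations ℝ
  open OrderedField ℝ
  open Markets ℝ
  open GrossSubstitutes ℝ
  open WeightedRanks ℝ
  open LocalExchange ℝ
  open UnitDemand ℝ
  open Subsets
  open TwoClasses

  module _ {m : ℕ} where

    C : Subset (4 ℕ.+ m)
    C = true ∷ true ∷ ⊥

    value : Subset (4 ℕ.+ m) → R
    value S = ι (worth C S)

    twoClass : Valuation (4 ℕ.+ m)
    twoClass = record
      { ground = ⊤ ; val = value ; val-∅ = cong ι (worth-⊥ C)
      ; val-nonneg = λ S _ → ι-nonneg (worth C S)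
      ; val-mono = λ S T S⊆T _ → ι-mono (worth-mono C S⊆T) }

    twoClass-GS : IsGS twoClass
    twoClass-GS = GS⇒IsGS twoClass (GS-cong (subsets _) (λ S → cong value (sym (∩-identityʳ S)))
      (exchange⇒GS exch))
      where
      sum≤ : ∀ a b c d → a ℕ.+ b ℕ.≤ c ℕ.+ d → ι a + ι b ≤ ι c + ι d
      sum≤ a b c d le = subst₂ _≤_ (ι-+ a b) (ι-+ c d) (ι-mono le)
      exch : Exchange value
      exch S T i i∈S i∉T with worth-exchange C S T i i∈S i∉T
      ... | inj₁ le = inj₁ (sum≤ (worth C S) (worth C T) (worth C (S ⊟ i)) (worth C (T ⊞ i)) le)
      ... | inj₂ (j , j∈T , j∉S , le) = inj₂ (j , j∈T , j∉S
        , sum≤ (worth C S) (worth C T) (worth C (S ⊟ i ⊞ j)) (worth C (T ⊞ i ⊟ j)) le)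

    private
      0∈C : fzero ∈ C
      0∈C = here
      1∈C : 1′ ∈ C
      1∈C = there here
      ∉C : ∀ {i} → fsuc (fsuc i) ∉ C
      ∉C (there (there i∈⊥)) = ∉⊥ i∈⊥
      pattern 3+ i = fsuc (fsuc (fsuc i))

    -- A second item of the same class; this needs two items in each class.
    partner : ∀ k → ∃ λ i → i ≢ k × worth C (⊥ ⊞ i ⊞ k) ≡ 4
    partner 0′     = 1′ , (λ ()) , worth-same-∈ C {1′} {0′} (λ ()) 1∈C 0∈C
    partner 1′     = 0′ , (λ ()) , worth-same-∈ C {0′} {1′} (λ ()) 0∈C 1∈C
    partner 2′     = 3+ fzero , (λ ()) , worth-same-∉ C {3+ fzero} {2′} (λ ()) ∉C ∉C
    partner (3+ k) = 2′ , (λ ()) , worth-same-∉ C {2′} {3+ k} (λ ()) ∉C ∉C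

    -- Removing one item exhausts neither class, so a pair across the classes always survives.
    crossing : ∀ k → ∃ λ i → ∃ λ j → i ≢ j × i ≢ k × j ≢ k × worth C (⊥ ⊞ i ⊞ j) ≡ 5
    crossing 0′     = 1′ , 2′ , (λ ()) , (λ ()) , (λ ()) , worth-cross C {1′} {2′} 1∈C ∉C
    crossing 1′     = 0′ , 2′ , (λ ()) , (λ ()) , (λ ()) , worth-cross C {0′} {2′} 0∈C ∉C
    crossing 2′     = 0′ , 3+ fzero , (λ ()) , (λ ()) , (λ ()) , worth-cross C {0′} {3+ fzero} 0∈C ∉C
    crossing (3+ k) = 0′ , 2′ , (λ ()) , (λ ()) , (λ ()) , worth-cross C {0′} {2′} 0∈C ∉C

    Full : Valuation (4 ℕ.+ m) → Fin (4 ℕ.+ m) → Set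
    Full u i = i ∈ ground u × ι 3 ≤ val u (⊥ ⊞ i)

    -- What is used of a merge with these values, symmetric in the two valuations so that `swap`
    -- allows their roles to be exchanged. Separate `X`, `Y` and `Z` avoid writing bundles as
    -- differences.
    record Decomposition (u₁ u₂ : Valuation (4 ℕ.+ m)) : Set where
      field
        bound : ∀ {X Y Z} → X ⊆ ground u₁ → Y ⊆ ground u₂ → (∀ {k} → k ∈ X → k ∉ Y) → X ⊆ Z → Y ⊆ Z →
                val u₁ X + val u₂ Y ≤ value Z
        attained : ∀ S → ∃ λ X → ∃ λ Y → X ⊆ ground u₁ × Y ⊆ ground u₂ × (∀ {k} → k ∈ X → k ∉ Y) × X ⊆ S × Y ⊆ S ×
                   value S ≤ val u₁ X + val u₂ Y

    swap : ∀ {u₁ u₂} → Decomposition u₁ u₂ → Decomposition u₂ u₁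
    swap {u₁} {u₂} D = record
      { bound = λ {X} {Y} {Z} X⊆ Y⊆ disjoint X⊆Z Y⊆Z → subst (_≤ value Z) (+-comm _ _)
          (bound Y⊆ X⊆ (λ k∈Y k∈X → disjoint k∈X k∈Y) Y⊆Z X⊆Z)
      ; attained = λ S → let X , Y , X⊆ , Y⊆ , disjoint , X⊆S , Y⊆S , le = attained S in
          Y , X , Y⊆ , X⊆ , (λ k∈Y k∈X → disjoint k∈X k∈Y) , Y⊆S , X⊆S , subst (value S ≤_) (+-comm _ _) le }
      where open Decomposition D

    decompose : ∀ {u₁ u₂ w} → ground w ≡ ⊤ → (∀ S → val w S ≡ value S) → IsMerge u₁ u₂ w → Decomposition u₁ u₂
    decompose {u₁} {u₂} {w} w≡⊤ w≡ (ground≡ , isMax) = record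
      { bound = λ {X} {Y} {Z} X⊆ Y⊆ disjoint X⊆Z Y⊆Z → ≤-trans
          (subst (λ A → val u₁ X + val u₂ A ≤ val w (Y ∪ X)) (rest X Y disjoint)
            (proj₂ (isMax (Y ∪ X) (⊆w (Y ∪ X))) X
              ((λ k∈X → x∈p∩q⁺ (q⊆p∪q Y X k∈X , X⊆ k∈X)) , λ k∈ → Y⊆ (subst (_ ∈_) (rest X Y disjoint) k∈))))
          (≤-trans (≤-reflexive (w≡ (Y ∪ X))) (ι-mono (worth-mono C (∪-lub Y⊆Z X⊆Z))))
      ; attained = λ S → let T , (T⊆ , rest⊆) , eq = proj₁ (isMax S (⊆w S)) in
          T , S ─ T , (λ k∈ → p∩q⊆q S _ (T⊆ k∈)) , rest⊆ , (λ k∈T k∈ → proj₂ (∈-─⁻ S T k∈) k∈T)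
          , (λ k∈ → p∩q⊆p S _ (T⊆ k∈)) , p─q⊆p S T , ≤-reflexive (trans (sym (w≡ S)) (sym eq)) }
      where
      ⊆w : ∀ S → S ⊆ ground w
      ⊆w S _ = subst (_ ∈_) (sym w≡⊤) ∈⊤
      rest : ∀ X Y → (∀ {k} → k ∈ X → k ∉ Y) → (Y ∪ X) ─ X ≡ Y
      rest X Y disjoint = ∪-─-cancel λ k∈Y k∈X → disjoint k∈X k∈Y

    module _ {u₁ u₂ : Valuation (4 ℕ.+ m)} (D : Decomposition u₁ u₂) where
      open Decomposition D

      private
        ι≤⇒⊥ : ∀ {k l} → ι k ≤ ι l → l ℕ.< k → False
        ι≤⇒⊥ {k} {l} le lt = ℕₚ.<⇒≱ lt (ι-cancel k l le)

        u₁≤0 : ∀ {X} → X ⊆ ⊥ → val u₁ X ≤ 0#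
        u₁≤0 X⊆⊥ = ≤-trans (val-mono u₁ _ ⊥ X⊆⊥ ⊥⊆) (≤-reflexive (val-∅ u₁))

        u₂≤0 : ∀ {Y} → Y ⊆ ⊥ → val u₂ Y ≤ 0#
        u₂≤0 Y⊆⊥ = ≤-trans (val-mono u₂ _ ⊥ Y⊆⊥ ⊥⊆) (≤-reflexive (val-∅ u₂))

      -- In an optimal split of a single item one side receives nothing, so the other alone accounts
      -- for the worth 3.
      some-full : ∀ i → Full u₁ i ⊎ Full u₂ i
      some-full i with attained (⊥ ⊞ i)
      ... | X , Y , X⊆ , Y⊆ , disjoint , X⊆i , Y⊆i , le = cases (i ∈? X) (i ∈? Y)
        where
        3≤ : ι 3 ≤ val u₁ X + val u₂ Y
        3≤ = ≤-trans (≤-reflexive (cong ι (sym (worth-single C i)))) le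
        cases : Dec (i ∈ X) → Dec (i ∈ Y) → Full u₁ i ⊎ Full u₂ i
        cases (yes i∈X) _ = inj₁ (X⊆ i∈X , linear (ι 3 ∷ val u₁ X ∷ val u₂ Y ∷ val u₁ (⊥ ⊞ i) ∷ [])
          (λ c x y z → (c ≼ x ⊕ y) ∷ (x ≼ z) ∷ (y ≼ 𝟘) ∷ [] ⊢ c ≼ z) refl
          3≤ (val-mono u₁ _ _ X⊆i (⊞-⊆ i ⊥⊆ (X⊆ i∈X))) (u₂≤0 (⊆-⊞⁻ i Y⊆i (disjoint i∈X))))
        cases (no i∉X) (yes i∈Y) = inj₂ (Y⊆ i∈Y , linear (ι 3 ∷ val u₁ X ∷ val u₂ Y ∷ val u₂ (⊥ ⊞ i) ∷ [])
          (λ c x y z → (c ≼ x ⊕ y) ∷ (y ≼ z) ∷ (x ≼ 𝟘) ∷ [] ⊢ c ≼ z) refl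
          3≤ (val-mono u₂ _ _ Y⊆i (⊞-⊆ i ⊥⊆ (Y⊆ i∈Y))) (u₁≤0 (⊆-⊞⁻ i X⊆i i∉X)))
        cases (no i∉X) (no i∉Y) = ⊥-elim (ι≤⇒⊥ {3} {0} (linear (ι 3 ∷ val u₁ X ∷ val u₂ Y ∷ [])
          (λ c x y → (c ≼ x ⊕ y) ∷ (x ≼ 𝟘) ∷ (y ≼ 𝟘) ∷ [] ⊢ c ≼ 𝟘) refl
          3≤ (u₁≤0 (⊆-⊞⁻ i X⊆i i∉X)) (u₂≤0 (⊆-⊞⁻ i Y⊆i i∉Y))) (ℕ.s≤s ℕ.z≤n))

      -- Two items with full worth in different valuations would together be worth at least 6, while
      -- no set is worth more than 5.
      all-full : Full u₁ fzero → ∀ i → Full u₁ i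
      all-full full₀@(0∈ , 3≤) i with some-full i
      ... | inj₁ full = full
      ... | inj₂ (i∈ , 3≤′) with fzero Finₚ.≟ i
      ... | yes refl = full₀
      ... | no 0≢i = ⊥-elim (ι≤⇒⊥ {6} {5} (subst (_≤ ι 5) (sym (ι-+ 3 3)) (≤-trans (+-mono₂ 3≤ 3≤′)
        (≤-trans (bound {Z = ⊤} (⊞-⊆ fzero ⊥⊆ 0∈) (⊞-⊆ i ⊥⊆ i∈)
          (⊥⊞-disjoint 0≢i) ⊆⊤ ⊆⊤)
          (ι-mono (worth≤5 C ⊤))))) ℕₚ.≤-refl)

      -- Every u₂{k} is at most 1 because of k's partner, so only u₁ can account for the pairs
      -- of value 5; these leave nothing for any u₂{k}, so u₁ accounts for all pairs.
      module _ (gs₂ : IsGS u₂) (full : ∀ i → Full u₁ i) where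

        ⊆E₁ : ∀ {S} → S ⊆ ground u₁
        ⊆E₁ {_} {k} _ = proj₁ (full k)

        at-most : ∀ S → val u₁ S ≤ value S
        at-most S = linear (val u₁ S ∷ val u₂ ⊥ ∷ value S ∷ []) (λ a b c → (a ⊕ b ≼ c) ∷ (𝟘 ≼ b) ∷ [] ⊢ a ≼ c) refl
          (bound ⊆E₁ ⊥⊆ (λ _ → ∉⊥) (λ k → k) ⊥⊆) (≤-reflexive (sym (val-∅ u₂)))

        -- Submodularity over the empty set, from the gross substitutability of `u₂`; it turns
        -- bounds on single items into bounds on pairs.
        subadditive : ∀ {i j} → i ≢ j → i ∈ ground u₂ → j ∈ ground u₂ →
          val u₂ (⊥ ⊞ i ⊞ j) ≤ val u₂ (⊥ ⊞ i) + val u₂ (⊥ ⊞ j)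
        subadditive {i} {j} i≢j i∈ j∈ = linear (val u₂ (⊥ ⊞ i ⊞ j) ∷ val u₂ (⊥ ⊞ i) ∷ val u₂ (⊥ ⊞ j) ∷ extend u₂ ⊥ ∷ [])
          (λ a b c d → (a ⊕ d ≼ b ⊕ c) ∷ (𝟘 ≼ d) ∷ [] ⊢ a ≼ b ⊕ c) refl
          (subst₂ (λ a b → a + extend u₂ ⊥ ≤ b) (extend-⊆ u₂ (⊞-⊆ j (⊞-⊆ i ⊥⊆ i∈) j∈))
            (cong₂ _+_ (extend-⊆ u₂ (⊞-⊆ i ⊥⊆ i∈)) (extend-⊆ u₂ (⊞-⊆ j ⊥⊆ j∈)))
            (submodular (λ S → val-nonneg u₂ _ (p∩q⊆q S _)) (extend-mono u₂) (IsGS⇒GS u₂ gs₂) ⊥ ∉⊥ ∉⊥ i≢j))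
          (≤-reflexive (sym (extend-⊥ u₂)))

        module _ (ε : ℕ) (small : ∀ k → k ∈ ground u₂ → val u₂ (⊥ ⊞ k) ≤ ι ε) where

          one-left : ∀ {Y j} → Y ⊆ ground u₂ → Y ⊆ ⊥ ⊞ j → val u₂ Y ≤ ι ε
          one-left {Y} {j} Y⊆ Y⊆j with j ∈? Y
          ... | yes j∈Y = ≤-trans (val-mono u₂ _ _ Y⊆j (⊞-⊆ j ⊥⊆ (Y⊆ j∈Y))) (small j (Y⊆ j∈Y))
          ... | no j∉Y  = ≤-trans (u₂≤0 (⊆-⊞⁻ j Y⊆j j∉Y)) (ι-nonneg ε)

          two-left : ∀ {Y i j} → i ≢ j → Y ⊆ ground u₂ → Y ⊆ ⊥ ⊞ i ⊞ j → val u₂ Y ≤ ι ε + ι ε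
          two-left {Y} {i} {j} i≢j Y⊆ Y⊆ij with i ∈? Y | j ∈? Y
          ... | yes i∈Y | yes j∈Y = ≤-trans (val-mono u₂ _ _ Y⊆ij (⊞-⊆ j (⊞-⊆ i ⊥⊆ (Y⊆ i∈Y)) (Y⊆ j∈Y)))
            (≤-trans (subadditive i≢j (Y⊆ i∈Y) (Y⊆ j∈Y)) (+-mono₂ (small i (Y⊆ i∈Y)) (small j (Y⊆ j∈Y))))
          ... | _ | no j∉Y = linear (val u₂ Y ∷ ι ε ∷ []) (λ y e → (y ≼ e) ∷ (𝟘 ≼ e) ∷ [] ⊢ y ≼ e ⊕ e) refl
            (one-left Y⊆ (⊆-⊞⁻ j Y⊆ij j∉Y)) (ι-nonneg ε)
          ... | no i∉Y | yes _ = linear (val u₂ Y ∷ ι ε ∷ []) (λ y e → (y ≼ e) ∷ (𝟘 ≼ e) ∷ [] ⊢ y ≼ e ⊕ e) refl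
            (one-left Y⊆ (⊆-⊞⊞⁻ i j Y⊆ij i∉Y)) (ι-nonneg ε)

          -- A split of the pair that leaves `u₁` without one of the items is worth at most 3 + `ε`
          -- or `ε` + `ε`. With `ε` = 1 this falls short of pairs worth 5; once the singles in `u₂`
          -- are known to be worth 0, `ε` = 0 covers the pairs worth 4 too.
          pair : ∀ {i j} → i ≢ j → 3 ℕ.+ ε ℕ.< worth C (⊥ ⊞ i ⊞ j) → ε ℕ.+ ε ℕ.< worth C (⊥ ⊞ i ⊞ j) →
            value (⊥ ⊞ i ⊞ j) ≤ val u₁ (⊥ ⊞ i ⊞ j)
          pair {i} {j} i≢j lt₃ lt₂ with attained (⊥ ⊞ i ⊞ j)
          ... | X , Y , X⊆ , Y⊆ , disjoint , X⊆ij , Y⊆ij , le = cases (i ∈? X) (j ∈? X)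
            where
            V = value (⊥ ⊞ i ⊞ j)
            X⊆i⇒ : ∀ {i} → X ⊆ ⊥ ⊞ i → val u₁ X ≤ ι 3
            X⊆i⇒ {i} X⊆i = ≤-trans (val-mono u₁ _ _ X⊆i ⊆E₁) (≤-trans (at-most (⊥ ⊞ i)) (≤-reflexive (cong ι (worth-single C i))))
            too-small₃ : val u₁ X ≤ ι 3 → val u₂ Y ≤ ι ε → V ≤ val u₁ (⊥ ⊞ i ⊞ j)
            too-small₃ x≤ y≤ = ⊥-elim (ι≤⇒⊥ (≤-trans le (subst (val u₁ X + val u₂ Y ≤_) (sym (ι-+ 3 ε)) (+-mono₂ x≤ y≤))) lt₃)
            cases : Dec (i ∈ X) → Dec (j ∈ X) → V ≤ val u₁ (⊥ ⊞ i ⊞ j)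
            cases (yes i∈X) (yes j∈X) = linear (V ∷ val u₁ X ∷ val u₂ Y ∷ val u₁ (⊥ ⊞ i ⊞ j) ∷ [])
              (λ v x y z → (v ≼ x ⊕ y) ∷ (x ≼ z) ∷ (y ≼ 𝟘) ∷ [] ⊢ v ≼ z) refl
              le (val-mono u₁ _ _ X⊆ij ⊆E₁) (u₂≤0 (⊆-⊞⁻ i (⊆-⊞⁻ j Y⊆ij (disjoint j∈X)) (disjoint i∈X)))
            cases (yes i∈X) (no j∉X) = too-small₃ (X⊆i⇒ (⊆-⊞⁻ j X⊆ij j∉X))
              (one-left Y⊆ (⊆-⊞⊞⁻ i j Y⊆ij (disjoint i∈X)))
            cases (no i∉X) (yes j∈X) = too-small₃
              (X⊆i⇒ (⊆-⊞⊞⁻ i j X⊆ij i∉X)) (one-left Y⊆ (⊆-⊞⁻ j Y⊆ij (disjoint j∈X)))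
            cases (no i∉X) (no j∉X) = ⊥-elim (ι≤⇒⊥ (≤-trans le (subst (val u₁ X + val u₂ Y ≤_) (sym (ι-+ ε ε))
              (linear (val u₁ X ∷ val u₂ Y ∷ ι ε ∷ []) (λ x y e → (x ≼ 𝟘) ∷ (y ≼ e ⊕ e) ∷ [] ⊢ x ⊕ y ≼ e ⊕ e) refl
                (u₁≤0 (⊆-⊞⁻ i (⊆-⊞⁻ j X⊆ij j∉X) i∉X))
                (two-left i≢j Y⊆ Y⊆ij)))) lt₂)

        single≤1 : ∀ k → k ∈ ground u₂ → val u₂ (⊥ ⊞ k) ≤ ι 1
        single≤1 k k∈ = let i , i≢k , w4 = partner k in
          linear (ι 1 ∷ ι 3 ∷ ι 4 ∷ val u₁ (⊥ ⊞ i) ∷ val u₂ (⊥ ⊞ k) ∷ value (⊥ ⊞ i ⊞ k) ∷ [])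
            (λ o t f a b v → (t ≼ a) ∷ (a ⊕ b ≼ v) ∷ (v ≼ f) ∷ (f ≼ o ⊕ t) ∷ [] ⊢ b ≼ o) refl
            (proj₂ (full i))
            (bound ⊆E₁ (⊞-⊆ k ⊥⊆ k∈) (⊥⊞-disjoint i≢k)
              (∈-⊞⁺ k) (⊞-⊆ k ⊥⊆ (i∈S⊞i k)))
            (≤-reflexive (cong ι w4)) (≤-reflexive (ι-+ 1 3))

        single≤0 : ∀ k → k ∈ ground u₂ → val u₂ (⊥ ⊞ k) ≤ ι 0
        single≤0 k k∈ with crossing k
        ... | i , j , i≢j , i≢k , j≢k , w5 =
          linear (val u₁ (⊥ ⊞ i ⊞ j) ∷ val u₂ (⊥ ⊞ k) ∷ value (⊥ ⊞ i ⊞ j) ∷ ι 5 ∷ value ⊤ ∷ [])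
            (λ a b v f t → (v ≼ a) ∷ (f ≼ v) ∷ (a ⊕ b ≼ t) ∷ (t ≼ f) ∷ [] ⊢ b ≼ 𝟘) refl
            (pair 1 single≤1 i≢j (subst (4 ℕ.<_) (sym w5) ℕₚ.≤-refl) (subst (2 ℕ.<_) (sym w5) (ℕₚ.m≤m+n 3 2)))
            (≤-reflexive (cong ι (sym w5)))
            (bound {X = ⊥ ⊞ i ⊞ j} {⊥ ⊞ k} {⊤} ⊆E₁ (⊞-⊆ k ⊥⊆ k∈) apart ⊆⊤ ⊆⊤)
            (ι-mono (worth≤5 C ⊤))
          where
          apart : ∀ {x} → x ∈ ⊥ ⊞ i ⊞ j → x ∉ ⊥ ⊞ k
          apart x∈ x∈k with ∈-⊞⁻ k x∈k
          ... | inj₂ x∈⊥ = ∉⊥ x∈⊥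
          ... | inj₁ refl with ∈-⊞⁻ j x∈
          ... | inj₁ k≡j = j≢k (sym k≡j)
          ... | inj₂ k∈i = ∉⊥⊞ i≢k k∈i

        at-least : ∀ S → value S ≤ val u₁ S
        at-least S with represent C S
        ... | P , small , P⊆S , le = ≤-trans (ι-mono le) (≤-trans (on-small small) (val-mono u₁ _ _ P⊆S ⊆E₁))
          where
          on-small : ∀ {P} → Small P → value P ≤ val u₁ P
          on-small none = ≤-trans (≤-reflexive (cong ι (worth-⊥ C))) (≤-reflexive (sym (val-∅ u₁)))
          on-small (one i) = ≤-trans (≤-reflexive (cong ι (worth-single C i))) (proj₂ (full i))
          on-small (two i≢j) = pair 0 single≤0 i≢j (worth-pair C i≢j) (ℕₚ.≤-trans (ℕ.s≤s ℕ.z≤n) (worth-pair C i≢j))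

        irreducible : ground u₁ ≡ ⊤ × (∀ S → val u₁ S ≡ value S)
        irreducible = ⊆-antisym ⊆⊤ ⊆E₁ , λ S → antisym (at-most S) (at-least S)

    private
      single-sum : ∀ {k} (Z : Subset k) p → Z ⊆ ⊥ → sumOver Z p ≡ 0#
      single-sum Z p Z⊆⊥ = sumOver-zero Z {p} λ k k∈Z → contradiction (Z⊆⊥ k∈Z) ∉⊥

    -- Both items of C weigh 3, so the sets inside C have rank 0, 3 or 6, and never 4.
    not-rank : ∀ M w u → ground u ≡ ⊤ → (∀ S → val u S ≡ value S) → ¬ IsWeightedRank M w u
    not-rank M w u u≡⊤ u≡ (ground≡ , isMax) = clash
      where
      attained : ∀ T → ∃ λ I → I ⊆ T × sumOver I w ≡ value T
      attained T = let I , (_ , I⊆T) , eq = proj₁ (isMax T λ _ → subst (_ ∈_) (trans (sym u≡⊤) ground≡) ∈⊤)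
                   in I , I⊆T , trans eq (u≡ T)
      rest : Fin (2 ℕ.+ m) → R
      rest k = w (fsuc (fsuc k))
      ι≢ : ∀ {k l} → ι k ≡ ι l → k ≢ l → False
      ι≢ {k} {l} eq k≢l = k≢l (ℕₚ.≤-antisym (ι-cancel k l (≤-reflexive eq)) (ι-cancel l k (≤-reflexive (sym eq))))
      w₀ : w 0′ ≡ ι 3
      w₀ with attained (⊥ ⊞ 0′)
      ... | false ∷ Z , I⊆ , eq = ⊥-elim (ι≢ {0} {3}
        (trans (sym (single-sum Z _ (drop-∷-⊆ I⊆))) (trans eq (cong ι (worth-single C 0′)))) λ ())
      ... | true ∷ Z , I⊆ , eq = trans (sym (trans (cong (w 0′ +_) (single-sum Z _ (drop-∷-⊆ I⊆))) (+-identityʳ _)))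
        (trans eq (cong ι (worth-single C 0′)))
      w₁ : w 1′ ≡ ι 3
      w₁ with attained (⊥ ⊞ 1′)
      ... | true ∷ Z , I⊆ , eq = contradiction (I⊆ here) λ ()
      ... | false ∷ false ∷ Z , I⊆ , eq = ⊥-elim (ι≢ {0} {3}
        (trans (sym (single-sum Z _ (drop-∷-⊆ (drop-∷-⊆ I⊆)))) (trans eq (cong ι (worth-single C 1′)))) λ ())
      ... | false ∷ true ∷ Z , I⊆ , eq = trans (sym (trans (cong (w 1′ +_) (single-sum Z _ (drop-∷-⊆ (drop-∷-⊆ I⊆)))) (+-identityʳ _)))
        (trans eq (cong ι (worth-single C 1′)))
      clash : False
      clash with attained (⊥ ⊞ 0′ ⊞ 1′)
      ... | x ∷ y ∷ Z , I⊆ , eq = weigh x y (trans eq (cong ι (worth-same-∈ C {0′} {1′} (λ ()) 0∈C 1∈C)))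
        where
        Z≡0 : sumOver Z rest ≡ ι 0
        Z≡0 = single-sum Z rest (drop-∷-⊆ (drop-∷-⊆ I⊆))
        weigh : ∀ x y → sumOver (x ∷ y ∷ Z) w ≡ ι 4 → False
        weigh false false eq = ι≢ {0} {4} (trans (sym Z≡0) eq) λ ()
        weigh true  false eq = ι≢ {3} {4} (trans (sym (trans (cong₂ _+_ w₀ Z≡0) (sym (ι-+ 3 0)))) eq) λ ()
        weigh false true  eq = ι≢ {3} {4} (trans (sym (trans (cong₂ _+_ w₁ Z≡0) (sym (ι-+ 3 0)))) eq) λ ()
        weigh true  true  eq = ι≢ {6} {4}
          (trans (sym (trans (cong₂ _+_ w₀ (trans (cong₂ _+_ w₁ Z≡0) (sym (ι-+ 3 0)))) (sym (ι-+ 3 3)))) eq) λ ()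

    -- Induction on the generation of `w`. The claim concerns every valuation with the given values,
    -- because the induction moves to other valuations that only share the ground set and the values
    -- of `twoClass`.
    not-MBV : ∀ {w} → MBVgen (4 ℕ.+ m) w → ground w ≡ ⊤ → (∀ S → val w S ≡ value S) → False
    not-MBV (rank M w _ u isRank) u≡⊤ u≡ = not-rank M w u u≡⊤ u≡ isRank
    not-MBV (endow u T w mbv T⊆E (ground≡ , w≡u)) w≡⊤ w≡ = not-MBV mbv (⊆-antisym ⊆⊤ ⊤⊆E) λ S →
        trans (sym (u≡w S)) (w≡ S)
      where
      outside-T : ∀ {k} → k ∈ ground u ─ T
      outside-T = subst (_ ∈_) (trans (sym w≡⊤) ground≡) ∈⊤
      ⊤⊆E : ⊤ ⊆ ground u
      ⊤⊆E _ = p─q⊆p (ground u) T outside-T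
      T≡⊥ : T ≡ ⊥
      T≡⊥ = ⊆-antisym (λ k∈T → contradiction k∈T (proj₂ (∈-─⁻ (ground u) T outside-T))) ⊥⊆
      u≡w : ∀ S → val w S ≡ val u S
      u≡w S = trans (w≡u S (λ _ → subst (_ ∈_) (sym w≡⊤) ∈⊤)) (antisym
        (linear (val u S ∷ (val u (S ∪ T) ⊖ val u T) ∷ val u (S ∪ T) ∷ val u T ∷ [])
          (λ a b c d → (b ⊕ d ≼ c) ∷ (c ≼ a) ∷ (𝟘 ≼ d) ∷ [] ⊢ b ≼ a) refl
          (≤-reflexive (⊖-+ _ _)) (≤-reflexive S∪T) (≤-reflexive (sym uT)))
        (linear (val u S ∷ (val u (S ∪ T) ⊖ val u T) ∷ val u (S ∪ T) ∷ val u T ∷ [])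
          (λ a b c d → (c ≼ b ⊕ d) ∷ (a ≼ c) ∷ (d ≼ 𝟘) ∷ [] ⊢ a ≼ b) refl
          (≤-reflexive (sym (⊖-+ _ _))) (≤-reflexive (sym S∪T)) (≤-reflexive uT)))
        where
        S∪T : val u (S ∪ T) ≡ val u S
        S∪T = cong (val u) (trans (cong (S ∪_) T≡⊥) (∪-identityʳ S))
        uT : val u T ≡ 0#
        uT = trans (cong (val u) T≡⊥) (val-∅ u)
    not-MBV (merge u₁ u₂ w mbv₁ mbv₂ isMerge) w≡⊤ w≡ with decompose {u₁} {u₂} {w} w≡⊤ w≡ isMerge
    ... | D with some-full D fzero
    ... | inj₁ full = let ground≡ , val≡ = irreducible D (MBV⇒GS mbv₂) (all-full D full) in not-MBV mbv₁ ground≡ val≡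
    ... | inj₂ full = let ground≡ , val≡ = irreducible (swap D) (MBV⇒GS mbv₁) (all-full (swap D) full)
                      in not-MBV mbv₂ ground≡ val≡

open import Data.Nat using (_≤_)

theorem1p2 : (ℝ : CompleteOrderedField) → let open Valuations ℝ in
    (∀ n → 1 ≤ n → n ≤ 3 → ∀ (u : Valuation n) → MBVgen n u ⇔ GSV n u)
    × (∀ n → 4 ≤ n → (∀ (u : Valuation n) → MBVgen n u → GSV n u)
                      × ∃ (λ (u : Valuation n) → GSV n u × ¬ MBVgen n u))
theorem1p2 ℝ =
    (λ n 1≤n n≤3 u → mk⇔ (WeightedRanks.MBV⇒GS ℝ) (UnitDemand.GS⇒MBV ℝ n 1≤n n≤3 u))
  , λ { (suc (suc (suc (suc m)))) _ → (λ u → WeightedRanks.MBV⇒GS ℝ)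
        , Counterexample.twoClass ℝ , Counterexample.twoClass-GS ℝ
        , λ mbv → Counterexample.not-MBV ℝ mbv refl (λ _ → refl)
      ; 1 (ℕ.s≤s ()) ; 2 (ℕ.s≤s (ℕ.s≤s ())) ; 3 (ℕ.s≤s (ℕ.s≤s (ℕ.s≤s ()))) }
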